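{- Let $q>3$ and let $f(x)\in\mathbb{F}_{q^n}[x]$ be a scattered polynomial such that $L_f$ is not of pseudoregulus type. Then the translation plane $\mathcal{A}_f$ is not a generalized André plane.
   Context: $q$ is a prime power, $n>1$. A $q$-polynomial $f(x)=\sum_{i=0}^{n-1}a_ix^{q^i}\in\mathbb{F}_{q^n}[x]$ is scattered if for all $y,z\in\mathbb{F}_{q^n}$, $zf(y)-yf(z)=0$ implies $y,z$ are $\mathbb{F}_q$-linearly dependent. $U_f=\{(x,f(x))\colon x\in\mathbb{F}_{q^n}\}$, $L_f=\{\langle(x,f(x))\rangle_{\mathbb{F}_{q^n}}\colon x\ne0\}\subseteq\mathrm{PG}(1,q^n)$. $L_f$ is of pseudoregulus type if there exist $\varphi\in\mathrm{GL}(2,q^n)$ and $s$ with $\gcd(s,n)=1$ such that $\varphi$ maps $L_f$ onto $\{\langle(x,x^{q^s})\rangle_{\mathbb{F}_{q^n}}\colon x\ne0\}$. With $\mathcal{D}=\{\langle v\rangle_{\mathbb{F}_{q^n}}\colon v\ne0\}$, the set $\mathcal{B}_f=(\mathcal{D}\setminus L_f)\cup\{hU_f\colon h\in\mathbb{F}_{q^n}^*\}$ is a spread of $\mathbb{F}_{q^n}^2$ (as $2n$-dimensional $\mathbb{F}_q$-space), and $\mathcal{A}_f$ is the translation plane whose points are vectors of $\mathbb{F}_{q^n}^2$ and whose lines are the cosets $v+W$, $W\in\mathcal{B}_f$. A generalized André plane is a translation plane coordinatized by a generalized André system, i.e. a quasifield $(F,+,\circ)$ with $F$ a finite field, $x\circ0=0$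 and $x\circ y=x^{\lambda(y)}y$ for $y\neq0$, where $\lambda\colon F^*\to\mathrm{Aut}(F)$ satisfies $\lambda(1)=\mathrm{id}$. -}

module Defs where

open import Level using (Level; _⊔_; suc)
open import Algebra.Bundles using (CommutativeRing; Semiring)
open import Algebra.Core using (Op₁; Op₂)
open import Algebra.Definitions using (_DistributesOverʳ_; RightZero)
open import Algebra.Module.Bundles using (LeftModule)
import Algebra.Module.Construct.DirectProduct as DirectProduct
import Algebra.Module.Construct.TensorUnit as TensorUnit
open import Algebra.Module.Morphism.Structures using (module LeftModuleMorphisms)
open import Algebra.Morphism.Structures using (module RingMorphisms)
open import Algebra.Structures using (IsAbelianGroup; IsLoop)
import Algebra.Definitions.RawSemiring as RawSemiringDefinitions
open import Data.Fin.Base using (Fin; toℕ)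
open import Data.Nat.Base as ℕ using (ℕ)
open import Data.Nat.GCD using (gcd)
open import Data.Nat.Primality using (Prime)
open import Data.Product using (Σ-syntax; ∃; ∃-syntax; ∃!; _×_; _,_; proj₁)
open import Data.Product.Relation.Binary.Pointwise.NonDependent using (×-setoid)
open import Data.Sum.Base using (_⊎_)
open import Data.Vec.Functional using (Vector)
open import Function.Base using (_on_)
open import Function.Bundles using (Inverse; _⇔_)
open import Relation.Binary.Bundles using (Setoid)
open import Relation.Binary.Core using (Rel)
open import Relation.Binary.PropositionalEquality using (_≡_) renaming (setoid to ≡-setoid)
open import Relation.Nullary.Negation using (¬_)
open import Relation.Unary using (Pred; _∈_; _≐_; _∪_; _∖_)

private
  variable
    c ℓ c′ ℓ′ p₁ e₁ a₁ b₁ p₂ e₂ a₂ b₂ : Level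

IsPrimePower : ℕ → Set
IsPrimePower q = ∃[ p ] ∃[ k ] (Prime p × 0 ℕ.< k × q ≡ p ℕ.^ k)

record FiniteField c ℓ : Set (suc (c ⊔ ℓ)) where
  field
    commutativeRing : CommutativeRing c ℓ

  open CommutativeRing commutativeRing public

  field
    1≉0         : 1# ≉ 0#
    invertible  : ∀ {x} → x ≉ 0# → ∃[ y ] x * y ≈ 1#
    order       : ℕ
    enumeration : Inverse setoid (≡-setoid (Fin order))

  open RawSemiringDefinitions (Semiring.rawSemiring semiring) public using (_^_; sum)

  NonZero : Set (c ⊔ ℓ)
  NonZero = ∃[ x ] x ≉ 0#

  Aut : Set (c ⊔ ℓ)
  Aut = ∃[ σ ] RingMorphisms.IsRingIsomorphism rawRing rawRing σ

-- Subsets are predicates, compared up to _≐_; every IsLine below is closed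
-- under _≐_.
record Geometry p e a b : Set (suc (p ⊔ e ⊔ a ⊔ b)) where
  field
    points : Setoid p e

  open Setoid points public using () renaming (Carrier to Point)

  field
    IsLine : Pred (Pred Point a) b

record _≅_ (G : Geometry p₁ e₁ a₁ b₁) (H : Geometry p₂ e₂ a₂ b₂)
         : Set (p₁ ⊔ e₁ ⊔ suc a₁ ⊔ b₁ ⊔ p₂ ⊔ e₂ ⊔ suc a₂ ⊔ b₂) where
  private
    module G = Geometry G
    module H = Geometry H

  field
    bijection : Inverse G.points H.points

  open Inverse bijection using (to)

  MapsLine : Pred G.Point a₁ → Pred H.Point a₂ → Set (p₁ ⊔ a₁ ⊔ a₂)
  MapsLine X Y = ∀ x → x ∈ X ⇔ to x ∈ Y

  field
    line-to   : ∀ {X} → G.IsLine X → ∃[ Y ] (H.IsLine Y × MapsLine X Y)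
    line-from : ∀ {Y} → H.IsLine Y → ∃[ X ] (G.IsLine X × MapsLine X Y)

module _ {a ℓ} {A : Set a} (_≈_ : Rel A ℓ) where

  -- Right-distributive, so the coordinatized plane has the lines
  -- y = x ∘ m + b and x = d.
  record IsQuasifield (_+_ _∘_ : Op₂ A) (-_ : Op₁ A) (0# 1# : A) : Set (a ⊔ ℓ) where
    field
      +-isAbelianGroup : IsAbelianGroup _≈_ _+_ 0# -_
      ∘-cong           : ∀ {x y u v} → x ≈ y → u ≈ v → (x ∘ u) ≈ (y ∘ v)
      1≉0              : ¬ (1# ≈ 0#)
      ∘-nonZero        : ∀ {x y} → ¬ (x ≈ 0#) → ¬ (y ≈ 0#) → ¬ ((x ∘ y) ≈ 0#)

    A* : Set (a ⊔ ℓ)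
    A* = ∃[ x ] ¬ (x ≈ 0#)

    _∘*_ : Op₂ A*
    (x , x≉0) ∘* (y , y≉0) = x ∘ y , ∘-nonZero x≉0 y≉0

    field
      _\\_ _//_   : Op₂ A*
      ∘*-isLoop   : IsLoop (_≈_ on proj₁) _∘*_ _\\_ _//_ (1# , 1≉0)
      ∘-distribʳ  : _DistributesOverʳ_ _≈_ _∘_ _+_
      ∘-zeroʳ     : RightZero _≈_ 0# _∘_
      planar      : ∀ m n b → ¬ (m ≈ n) → ∃! _≈_ λ x → (x ∘ m) ≈ ((x ∘ n) + b)

record GeneralizedAndréSystem c ℓ : Set (suc (c ⊔ ℓ)) where
  field
    F : FiniteField c ℓ

  open FiniteField F public using (Carrier; _≈_; _≉_; _+_; _*_; -_; 0#; 1#; 1≉0; NonZero; Aut; setoid)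

  field
    λ′      : NonZero → Aut
    λ′-cong : ∀ y z → proj₁ y ≈ proj₁ z → ∀ x → proj₁ (λ′ y) x ≈ proj₁ (λ′ z) x
    λ′-1    : ∀ x → proj₁ (λ′ (1# , 1≉0)) x ≈ x

    _∘_     : Op₂ Carrier
    ∘-zero  : ∀ x → (x ∘ 0#) ≈ 0#
    ∘-def   : ∀ x y (y≉0 : y ≉ 0#) → (x ∘ y) ≈ (proj₁ (λ′ (y , y≉0)) x * y)

    isQuasifield : IsQuasifield _≈_ _+_ _∘_ -_ 0# 1#

  plane : Geometry c ℓ ℓ (c ⊔ ℓ)
  plane = record
    { points = ×-setoid setoid setoid
    ; IsLine = λ X → (∃[ d ] X ≐ λ (x , y) → x ≈ d)
                   ⊎ (∃[ m ] ∃[ b ] X ≐ λ (x , y) → y ≈ ((x ∘ m) + b))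
    }

-- No separate requirement that G be a translation plane is needed: planes
-- over quasifields are translation planes.
IsGeneralizedAndréPlane : ∀ c′ ℓ′ → Geometry p₁ e₁ a₁ b₁ → Set _
IsGeneralizedAndréPlane c′ ℓ′ G =
  Σ[ S ∈ GeneralizedAndréSystem c′ ℓ′ ] G ≅ GeneralizedAndréSystem.plane S

module _ (F : FiniteField c ℓ) where

  open FiniteField F

  qPolynomial : ℕ → ∀ {n} → Vector Carrier n → Carrier → Carrier
  qPolynomial q as x = sum λ i → as i * x ^ (q ℕ.^ toℕ i)

  -- When F has order q ^ n, the subfield of order q consists of the roots
  -- of X ^ q - X.
  𝔽 : ℕ → Pred Carrier ℓ
  𝔽 q x = x ^ q ≈ x

  Dependent : ℕ → Carrier → Carrier → Set (c ⊔ ℓ)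
  Dependent q y z = ∃[ a ] ∃[ b ]
    (a ∈ 𝔽 q × b ∈ 𝔽 q × ¬ (a ≈ 0# × b ≈ 0#) × a * y + b * z ≈ 0#)

  Scattered : ℕ → (Carrier → Carrier) → Set (c ⊔ ℓ)
  Scattered q f = ∀ y z → z * f y - y * f z ≈ 0# → Dependent q y z

  F² : LeftModule ring c ℓ
  F² = DirectProduct.leftModule TensorUnit.leftModule TensorUnit.leftModule

  open LeftModule F² using (Carrierᴹ; _≈ᴹ_; _≉ᴹ_; _+ᴹ_; _*ₗ_; 0ᴹ; ≈ᴹ-setoid; rawLeftModule)

  Subset : Set (suc (c ⊔ ℓ))
  Subset = Pred Carrierᴹ (c ⊔ ℓ)

  image : (Carrierᴹ → Carrierᴹ) → Subset → Subset
  image φ X w = ∃[ v ] (v ∈ X × w ≈ᴹ φ v)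

  ⟨_⟩ : Carrierᴹ → Subset
  ⟨ v ⟩ w = ∃[ h ] w ≈ᴹ h *ₗ v

  U : (Carrier → Carrier) → Subset
  U f w = ∃[ x ] w ≈ᴹ (x , f x)

  L : (Carrier → Carrier) → Pred Subset (c ⊔ ℓ)
  L f P = ∃[ x ] (x ≉ 0# × P ≐ ⟨ x , f x ⟩)

  -- GL(2, F), as the F-linear automorphisms of F².
  IsGL : (Carrierᴹ → Carrierᴹ) → Set (c ⊔ ℓ)
  IsGL = LeftModuleMorphisms.IsLeftModuleIsomorphism rawLeftModule rawLeftModule

  MapsOnto : (Carrierᴹ → Carrierᴹ) → Pred Subset (c ⊔ ℓ) → Pred Subset (c ⊔ ℓ) → Set (suc (c ⊔ ℓ))
  MapsOnto φ A B = (∀ P → P ∈ A → image φ P ∈ B)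
                 × (∀ Q → Q ∈ B → ∃[ P ] (P ∈ A × Q ≐ image φ P))

  PseudoregulusType : ℕ → ℕ → (Carrier → Carrier) → Set (suc (c ⊔ ℓ))
  PseudoregulusType q n f = ∃[ φ ] ∃[ s ]
    (IsGL φ × gcd s n ≡ 1 × MapsOnto φ (L f) (L λ x → x ^ (q ℕ.^ s)))

  𝒟 : Pred Subset (c ⊔ ℓ)
  𝒟 P = ∃[ v ] (v ≉ᴹ 0ᴹ × P ≐ ⟨ v ⟩)

  ℬ : (Carrier → Carrier) → Pred Subset (c ⊔ ℓ)
  ℬ f = (𝒟 ∖ L f) ∪ (λ W → ∃[ h ] (h ≉ 0# × W ≐ image (h *ₗ_) (U f)))

  𝒜 : (Carrier → Carrier) → Geometry c ℓ (c ⊔ ℓ) (suc (c ⊔ ℓ))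
  𝒜 f = record
    { points = ≈ᴹ-setoid
    ; IsLine = λ X → ∃[ v ] ∃[ W ] (W ∈ ℬ f × X ≐ image (v +ᴹ_) W)
    }

-- Let K be the field of f, with N = q ^ n elements, and let ψ be the given isomorphism from 𝒜 f onto
-- the plane of a generalized André system over E, normalized at the origin. Comparing parallelograms
-- shows that ψ is additive, so K* acts on E × E. It permutes the components hU (with stabilizers 𝔽*),
-- and it fixes the other components of ℬ f; as q > 3, these are more than half of all components. In
-- E × E the components are the two axes and the graphs of semilinear maps x ↦ x ^ λ m, and Dedekind's
-- independence of characters controls all sums of such maps.
--
-- If both axes are fixed by K*, a pigeonhole argument writes every g in K* on the second axis as a
-- quotient of two graphs, so g is semilinear; as g + 1 is semilinear too, g acts by a scalar of E. Hence
-- the two actions identify K with E, U becomes the graph of a semilinear map over K, and comparing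
-- q-polynomials identifies that map with x ↦ x ^ q ^ s. So L f is of pseudoregulus type.
--
-- If an axis is moved by K*, translating g by the elements of 𝔽 produces parallelograms of semilinear
-- maps, which force g to act on that axis by scalars of E. If only one axis is moved, two fixed graphs
-- already contradict this. If both are moved, a fixed graph with a nontrivial automorphism θ forces the
-- matrix entries of K into the fixed field of θ, and then K = 𝔽 + k 𝔽 for the k exchanging the axes,
-- which is impossible for n > 2. For n = 2 every scattered f is a x + b x ^ q with b nonzero, whence L f
-- is of pseudoregulus type.

module Submission where

open import Defs
open import Level using (_⊔_)
open import Algebra.Bundles using (AbelianGroup; CommutativeRing; RawRing)
open import Algebra.Module.Bundles using (LeftModule)
open import Algebra.Morphism.Structures using (module RingMorphisms)
open import Data.Empty using (⊥; ⊥-elim)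
open import Data.Fin.Base as Fin using (Fin; zero; suc)
open import Data.Fin.Patterns using (0F; 1F; 2F; 3F)
import Data.Fin.Permutation as Permutation
import Data.Fin.Properties as Fin
open import Data.List.Base as List using (List; []; _∷_)
import Data.List.Properties as List
open import Data.List.Relation.Unary.All as All using (All; []; _∷_)
import Data.List.Relation.Unary.All.Properties as All
open import Data.Maybe.Base using (Maybe; just; nothing)
open import Data.Nat.Base as ℕ using (ℕ; zero; suc)
open import Data.Nat.Combinatorics using (nCn≡1; nC1≡n; nCk+nC[k+1]≡[n+1]C[k+1]; k>n⇒nCk≡0)
  renaming (_C_ to _choose_)
open import Data.Nat.Divisibility using (_∣_; divides; ∣⇒≤; m∣m*n; 0∣⇒≡0)
open import Data.Nat.GCD using (gcd[m,n]∣m; gcd[m,n]∣n)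
open import Data.Nat.Primality using (Prime; euclidsLemma; prime⇒nonTrivial)
import Data.Nat.Properties as ℕ
open import Data.Nat.Tactic.RingSolver using (solve-∀)
open import Data.Product using (∃; ∃-syntax; _×_; _,_; proj₁; proj₂)
open import Data.Sum.Base using (_⊎_; inj₁; inj₂)
open import Data.Vec.Functional using (Vector; replicate)
open import Function.Base using (_∘_)
open import Function.Bundles using (Inverse; Equivalence)
open import Function.Definitions using (Injective)
open import Relation.Binary.Definitions using (tri<; tri≈; tri>)
open import Relation.Binary.PropositionalEquality as ≡ using (_≡_)
open import Relation.Nullary using (¬_; Dec; yes; no; contradiction)
open import Relation.Nullary.Decidable using (map′; ¬?; _×-dec_)
open import Relation.Unary using (Pred; _∈_; _≐_)

-- Ring solver with integer coefficients

-- A map x ↦ x ^ λ m * m is a constant times a multiplicative character, so an additive relation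
-- between graphs is a linear relation between characters. The obstacle is that in positive
-- characteristic the coefficients of coinciding characters may cancel; every parallelogram is
-- therefore chosen so that the sums that can arise stay nonzero. Scatteredness enters as the
-- statement that hU and h′U share a nonzero vector only if h′ / h lies in 𝔽, so orbit components
-- correspond to K* / 𝔽*. At the end it confines the elements fixed by x ↦ x ^ q ^ s to 𝔽, which
-- gives gcd (s , n) = 1. The condition q > 3 supplies three distinct elements 1, t, t′ of 𝔽*. The
-- pigeonhole only refutes the absence of suitable fixed slopes; it is applied to contradictions and
-- to decidable equations, where a refutation is enough. The condition n > 2 enters through degrees:
-- 𝔽 + k 𝔽 lies among the roots of a monic polynomial of degree q ^ 2, which cannot vanish at all q
-- ^ n elements.

module IntegerSolver {c ℓ} (R : CommutativeRing c ℓ) where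
  open CommutativeRing R
  open import Algebra.Solver.Ring.AlmostCommutativeRing
  open import Algebra.Properties.Semiring.Mult semiring
    using (×-homo-+; ×1-homo-*) renaming (_×_ to _·_)
  open import Algebra.Properties.Ring ring
  open import Algebra.Properties.AbelianGroup +-abelianGroup using (⁻¹-∙-comm; ⁻¹-involutive)
  open import Algebra.Properties.CommutativeSemigroup
    (CommutativeRing.+-commutativeSemigroup R) using (interchange)
  open import Relation.Binary.Reasoning.Setoid setoid

  reduce : ℕ → ℕ → ℕ × ℕ
  reduce (suc a) (suc b) = reduce a b
  reduce a       b       = a , b

  -- An integer coefficient is a reduced formal difference of natural numbers.
  Coefficient : RawRing _ _
  Coefficient = record
    { Carrier = ℕ × ℕ
    ; _≈_     = _≡_
    ; _+_     = λ (a , b) (c , d) → reduce (a ℕ.+ c) (b ℕ.+ d)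
    ; _*_     = λ (a , b) (c , d) → reduce (a ℕ.* c ℕ.+ b ℕ.* d) (a ℕ.* d ℕ.+ b ℕ.* c)
    ; -_      = λ (a , b) → b , a
    ; 0#      = 0 , 0
    ; 1#      = 1 , 0
    }

  private
    module C = RawRing Coefficient

    value : C.Carrier → Carrier
    value (a , b) = a · 1# - b · 1#

    -- The literals 0 and 1 must evaluate to 0# and 1# on the nose.
    ⟦_⟧ : C.Carrier → Carrier
    ⟦ 0 , 0 ⟧ = 0#
    ⟦ 1 , 0 ⟧ = 1#
    ⟦ x ⟧     = value x

    x-0≈x : ∀ x → x - 0# ≈ x
    x-0≈x x = trans (+-congˡ -0#≈0#) (+-identityʳ x)

    ⟦⟧≈value : ∀ x → ⟦ x ⟧ ≈ value x
    ⟦⟧≈value (0 , 0)             = sym (x-0≈x 0#)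
    ⟦⟧≈value (0 , suc b)         = refl
    ⟦⟧≈value (1 , 0)             = sym (trans (x-0≈x _) (+-identityʳ 1#))
    ⟦⟧≈value (1 , suc b)         = refl
    ⟦⟧≈value (suc (suc a) , b)   = refl

    difference-cong : ∀ a b c d → a ℕ.+ d ≡ c ℕ.+ b → value (a , b) ≈ value (c , d)
    difference-cong a b c d eq = begin
      a · 1# - b · 1#
        ≈⟨ +-congʳ (+-identityʳ _) ⟨
      (a · 1# + 0#) - b · 1#
        ≈⟨ +-congʳ (+-congˡ (-‿inverseʳ _)) ⟨
      (a · 1# + (d · 1# - d · 1#)) - b · 1#
        ≈⟨ +-congʳ (+-assoc _ _ _) ⟨
      ((a · 1# + d · 1#) - d · 1#) - b · 1#
        ≈⟨ +-congʳ (+-congʳ (×-homo-+ 1# a d)) ⟨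
      ((a ℕ.+ d) · 1# - d · 1#) - b · 1#
        ≡⟨ ≡.cong (λ n → (n · 1# - d · 1#) - b · 1#) eq ⟩
      ((c ℕ.+ b) · 1# - d · 1#) - b · 1#
        ≈⟨ +-congʳ (+-congʳ (×-homo-+ 1# c b)) ⟩
      ((c · 1# + b · 1#) - d · 1#) - b · 1#
        ≈⟨ +-assoc _ _ _ ⟩
      (c · 1# + b · 1#) + (- (d · 1#) - b · 1#)
        ≈⟨ interchange _ _ _ _ ⟩
      (c · 1# - d · 1#) + (b · 1# - b · 1#)
        ≈⟨ +-congˡ (-‿inverseʳ _) ⟩
      (c · 1# - d · 1#) + 0#
        ≈⟨ +-identityʳ _ ⟩
      c · 1# - d · 1# ∎

    reduce-value : ∀ a b → value (reduce a b) ≈ value (a , b)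
    reduce-value zero    b       = refl
    reduce-value (suc a) zero    = refl
    reduce-value (suc a) (suc b) = trans (reduce-value a b)
      (difference-cong a b (suc a) (suc b) (ℕ.+-suc a b))

    +-value : ∀ x y → value (x C.+ y) ≈ value x + value y
    +-value (a , b) (c , d) = begin
      value (reduce (a ℕ.+ c) (b ℕ.+ d))
        ≈⟨ reduce-value (a ℕ.+ c) (b ℕ.+ d) ⟩
      (a ℕ.+ c) · 1# - (b ℕ.+ d) · 1#
        ≈⟨ +-cong (×-homo-+ 1# a c) (-‿cong (×-homo-+ 1# b d)) ⟩
      (a · 1# + c · 1#) - (b · 1# + d · 1#)
        ≈⟨ +-congˡ (⁻¹-∙-comm _ _) ⟨
      (a · 1# + c · 1#) + (- (b · 1#) - d · 1#)
        ≈⟨ interchange _ _ _ _ ⟩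
      (a · 1# - b · 1#) + (c · 1# - d · 1#) ∎

    -‿value : ∀ x → value (C.- x) ≈ - value x
    -‿value (a , b) = begin
      b · 1# - a · 1#          ≈⟨ +-comm _ _ ⟩
      - (a · 1#) + b · 1#      ≈⟨ +-congˡ (⁻¹-involutive _) ⟨
      - (a · 1#) - - (b · 1#)  ≈⟨ ⁻¹-∙-comm _ _ ⟩
      - (a · 1# - b · 1#)      ∎

    distrib-difference : ∀ a b c d →
      (a - b) * (c - d) ≈ (a * c + b * d) - (a * d + b * c)
    distrib-difference a b c d = begin
      (a - b) * (c - d)
        ≈⟨ distribʳ _ _ _ ⟩
      a * (c - d) + - b * (c - d)
        ≈⟨ +-cong (distribˡ _ _ _) (distribˡ _ _ _) ⟩
      (a * c + a * - d) + (- b * c + - b * - d)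
        ≈⟨ +-cong (+-congˡ (sym (-‿distribʳ-* a d)))
                  (+-cong (sym (-‿distribˡ-* b c)) (trans (sym (-‿distribˡ-* b (- d)))
                     (trans (-‿cong (sym (-‿distribʳ-* b d))) (⁻¹-involutive _)))) ⟩
      (a * c - a * d) + (- (b * c) + b * d)
        ≈⟨ +-congˡ (+-comm _ _) ⟩
      (a * c - a * d) + (b * d - b * c)
        ≈⟨ interchange _ _ _ _ ⟩
      (a * c + b * d) + (- (a * d) - b * c)
        ≈⟨ +-congˡ (⁻¹-∙-comm _ _) ⟩
      (a * c + b * d) - (a * d + b * c) ∎

    *-value : ∀ x y → value (x C.* y) ≈ value x * value y
    *-value (a , b) (c , d) = begin
      value (reduce (a ℕ.* c ℕ.+ b ℕ.* d) (a ℕ.* d ℕ.+ b ℕ.* c))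
        ≈⟨ reduce-value (a ℕ.* c ℕ.+ b ℕ.* d) (a ℕ.* d ℕ.+ b ℕ.* c) ⟩
      (a ℕ.* c ℕ.+ b ℕ.* d) · 1# - (a ℕ.* d ℕ.+ b ℕ.* c) · 1#
        ≈⟨ +-cong (·-dot a c b d) (-‿cong (·-dot a d b c)) ⟩
      (a · 1# * c · 1# + b · 1# * d · 1#) - (a · 1# * d · 1# + b · 1# * c · 1#)
        ≈⟨ distrib-difference _ _ _ _ ⟨
      value (a , b) * value (c , d) ∎
      where
      ·-dot : ∀ a c b d → (a ℕ.* c ℕ.+ b ℕ.* d) · 1# ≈ (a · 1#) * (c · 1#) + (b · 1#) * (d · 1#)
      ·-dot a c b d = trans (×-homo-+ 1# (a ℕ.* c) (b ℕ.* d))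
        (+-cong (×1-homo-* a c) (×1-homo-* b d))

    morphism : Coefficient -Raw-AlmostCommutative⟶ fromCommutativeRing R
    morphism = record
      { ⟦_⟧    = ⟦_⟧
      ; +-homo = λ x y → trans (⟦⟧≈value (x C.+ y))
          (trans (+-value x y) (sym (+-cong (⟦⟧≈value x) (⟦⟧≈value y))))
      ; *-homo = λ x y → trans (⟦⟧≈value (x C.* y))
          (trans (*-value x y) (sym (*-cong (⟦⟧≈value x) (⟦⟧≈value y))))
      ; -‿homo = λ x → trans (⟦⟧≈value (C.- x))
          (trans (-‿value x) (-‿cong (sym (⟦⟧≈value x))))
      ; 0-homo = refl
      ; 1-homo = refl
      }

    _coefficient≟_ : ∀ x y → Maybe (⟦ x ⟧ ≈ ⟦ y ⟧)
    x@(a , b) coefficient≟ y@(c , d) with a ℕ.+ d ℕ.≟ c ℕ.+ b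
    ... | yes eq = just (trans (⟦⟧≈value x)
                     (trans (difference-cong a b c d eq) (sym (⟦⟧≈value y))))
    ... | no  _  = nothing

  open import Algebra.Solver.Ring Coefficient (fromCommutativeRing R) morphism _coefficient≟_ public
    using (solve; _:=_; _:+_; _:*_; _:-_; :-_; con; Polynomial)

  :0 :1 : ∀ {n} → Polynomial n
  :0 = con (0 , 0)
  :1 = con (1 , 0)

-- Finite fields and independence of characters

-- If y were missed, punching it out would inject `Fin (suc n)` into `Fin n`.
injective⇒surjective : ∀ {n} {f : Fin n → Fin n} → Injective _≡_ _≡_ f →
                       ∀ y → ∃[ x ] f x ≡ y
injective⇒surjective {zero}          inj ()
injective⇒surjective {suc n} {f = f} inj y with Fin.any? (λ x → f x Fin.≟ y)
... | yes hit = hit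
... | no miss = contradiction
  (Fin.injective⇒≤ λ {i} {j} eq → inj (Fin.punchOut-injective (missed i) (missed j) eq))
  ℕ.1+n≰n
  where
  missed : ∀ x → ¬ y ≡ f x
  missed x eq = miss (x , ≡.sym eq)

module FieldTheory {c ℓ} (F : FiniteField c ℓ) where
  open FiniteField F public hiding (zero)
  open IntegerSolver commutativeRing public
  open import Algebra.Properties.Ring ring public
    using (-‿distribˡ-*; -0#≈0#)
  open import Algebra.Properties.Group (FiniteField.+-group F) public
    using () renaming (∙-cancelˡ to +-cancelˡ; ∙-cancelʳ to +-cancelʳ;
                       x∙y⁻¹≈ε⇒x≈y to x-y≈0⇒x≈y; x≈y⇒x∙y⁻¹≈ε to x≈y⇒x-y≈0)
  open import Algebra.Properties.Semiring.Exp semiring public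
    using (^-homo-*; ^-assocʳ; ^-congˡ; ^-congʳ)
  open import Algebra.Properties.CommutativeSemiring.Exp commutativeSemiring public
    using (^-distrib-*)
  open import Relation.Binary.Reasoning.Setoid setoid

  private
    module E = Inverse enumeration

  index : Carrier → Fin order
  index = E.to

  element : Fin order → Carrier
  element = E.from

  element-index : ∀ x → element (index x) ≈ x
  element-index x = E.strictlyInverseʳ x

  index-element : ∀ i → index (element i) ≡ i
  index-element = E.strictlyInverseˡ

  index-cong : ∀ {x y} → x ≈ y → index x ≡ index y
  index-cong = E.to-cong

  index-injective : ∀ {x y} → index x ≡ index y → x ≈ y
  index-injective {x} {y} eq =
    trans (sym (element-index x)) (trans (reflexive (≡.cong element eq)) (element-index y))

  element-injective : ∀ {i j} → element i ≈ element j → i ≡ j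
  element-injective {i} {j} eq =
    ≡.trans (≡.sym (index-element i)) (≡.trans (index-cong eq) (index-element j))

  infix 4 _≟_
  _≟_ : ∀ x y → Dec (x ≈ y)
  x ≟ y = map′ index-injective index-cong (index x Fin.≟ index y)

  module _ {p} {P : Carrier → Set p} (resp : ∀ {x y} → x ≈ y → P x → P y)
           (P? : ∀ x → Dec (P x)) where

    any? : Dec (∃ P)
    any? = map′ (λ (i , p) → element i , p)
                (λ (x , p) → index x , resp (sym (element-index x)) p)
                (Fin.any? (λ i → P? (element i)))

  module _ {p} {P : Carrier → Set p} (resp : ∀ {x y} → x ≈ y → P x → P y)
           (P? : ∀ x → Dec (P x)) where

    all⊎counterexample : (∀ x → P x) ⊎ (∃[ x ] ¬ P x)
    all⊎counterexample with any? (λ x≈y ¬p p → ¬p (resp (sym x≈y) p)) (λ x → ¬? (P? x))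
    ... | yes counterexample = inj₂ counterexample
    ... | no  ¬counterexample = inj₁ all
      where
      all : ∀ x → P x
      all x with P? x
      ... | yes p = p
      ... | no ¬p = contradiction (x , ¬p) ¬counterexample

  infixl 8 _⁻¹
  -- Total, with value 0 at 0, so that inverses can be written in terms without a proof argument;
  -- only the laws ask for `x ≉ 0#`.
  _⁻¹ : Carrier → Carrier
  x ⁻¹ with x ≟ 0#
  ... | yes _   = 0#
  ... | no  x≉0 = proj₁ (invertible x≉0)

  ⁻¹-inverseʳ : ∀ {x} → x ≉ 0# → x * x ⁻¹ ≈ 1#
  ⁻¹-inverseʳ {x} x≉0 with x ≟ 0#
  ... | yes x≈0 = contradiction x≈0 x≉0
  ... | no  x≉0 = proj₂ (invertible x≉0)

  ⁻¹-inverseˡ : ∀ {x} → x ≉ 0# → x ⁻¹ * x ≈ 1#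
  ⁻¹-inverseˡ x≉0 = trans (*-comm _ _) (⁻¹-inverseʳ x≉0)

  *-cancelˡ : ∀ {x y z} → x ≉ 0# → x * y ≈ x * z → y ≈ z
  *-cancelˡ {x} {y} {z} x≉0 eq = begin
    y                ≈⟨ *-identityˡ y ⟨
    1# * y           ≈⟨ *-congʳ (⁻¹-inverseˡ x≉0) ⟨
    x ⁻¹ * x * y     ≈⟨ *-assoc _ _ _ ⟩
    x ⁻¹ * (x * y)   ≈⟨ *-congˡ eq ⟩
    x ⁻¹ * (x * z)   ≈⟨ *-assoc _ _ _ ⟨
    x ⁻¹ * x * z     ≈⟨ *-congʳ (⁻¹-inverseˡ x≉0) ⟩
    1# * z           ≈⟨ *-identityˡ z ⟩
    z                ∎

  *-cancelʳ : ∀ {x y z} → x ≉ 0# → y * x ≈ z * x → y ≈ z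
  *-cancelʳ x≉0 eq = *-cancelˡ x≉0 (trans (*-comm _ _) (trans eq (*-comm _ _)))

  integralˡ : ∀ {x y} → x ≉ 0# → x * y ≈ 0# → y ≈ 0#
  integralˡ x≉0 eq = *-cancelˡ x≉0 (trans eq (sym (zeroʳ _)))

  integralʳ : ∀ {x y} → y ≉ 0# → x * y ≈ 0# → x ≈ 0#
  integralʳ y≉0 eq = integralˡ y≉0 (trans (*-comm _ _) eq)

  *-nonZero : ∀ {x y} → x ≉ 0# → y ≉ 0# → x * y ≉ 0#
  *-nonZero x≉0 y≉0 eq = y≉0 (integralˡ x≉0 eq)

  ⁻¹-nonZero : ∀ {x} → x ≉ 0# → x ⁻¹ ≉ 0#
  ⁻¹-nonZero {x} x≉0 eq = 1≉0 (begin
    1#         ≈⟨ ⁻¹-inverseʳ x≉0 ⟨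
    x * x ⁻¹   ≈⟨ *-congˡ eq ⟩
    x * 0#     ≈⟨ zeroʳ x ⟩
    0#         ∎)

  ^-nonZero : ∀ {x} n → x ≉ 0# → x ^ n ≉ 0#
  ^-nonZero zero    x≉0 = 1≉0
  ^-nonZero (suc n) x≉0 = *-nonZero x≉0 (^-nonZero n x≉0)

  1^n≈1 : ∀ n → 1# ^ n ≈ 1#
  1^n≈1 zero    = refl
  1^n≈1 (suc n) = trans (*-identityˡ _) (1^n≈1 n)

  0^n≈0 : ∀ n → 0# ^ suc n ≈ 0#
  0^n≈0 n = zeroˡ _

  -- If every element occurred among the `xs`, choosing a position for each would inject the field
  -- into `Fin k`.
  avoid : ∀ {k} → k ℕ.< order → (xs : Fin k → Carrier) → ∃[ x ] (∀ i → x ≉ xs i)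
  avoid k<N xs with Fin.any? (λ i → Fin.all? (λ j → ¬? (element i ≟ xs j)))
  ... | yes (i , avoids) = element i , avoids
  ... | no  covered = contradiction (Fin.injective⇒≤ position-injective) (ℕ.<⇒≱ k<N)
    where
    position : ∀ i → ∃[ j ] element i ≈ xs j
    position i with Fin.any? (λ j → element i ≟ xs j)
    ... | yes hit = hit
    ... | no ¬hit = contradiction (i , λ j eq → ¬hit (j , eq)) covered
    position-injective : Injective _≡_ _≡_ (proj₁ ∘ position)
    position-injective {i} {j} eq = element-injective (trans (proj₂ (position i))
      (trans (reflexive (≡.cong xs eq)) (sym (proj₂ (position j)))))

  -- Monic d f: f is the function of a monic polynomial of degree d, in Horner form.
  data Monic : ℕ → (Carrier → Carrier) → Set (c ⊔ ℓ) where
    one  : ∀ {f} → (∀ x → f x ≈ 1#) → Monic 0 f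
    step : ∀ {d f g} a → Monic d g → (∀ x → f x ≈ x * g x + a) → Monic (suc d) f

  -- Synthetic division by x - r: the quotient of x g + a has the quotient of g as its Horner tail
  -- and the value g r as its constant term.
  factor : ∀ {d f} → Monic (suc d) f → ∀ r →
           ∃[ g ] (Monic d g × ∀ x → f x ≈ (x - r) * g x + f r)
  factor {f = f} (step {g = g} a (one g≈1) f≈) r = g , one g≈1 , λ x → begin
    f x                          ≈⟨ f≈ x ⟩
    x * g x + a                  ≈⟨ solve 4 (λ x r g a → x :* g :+ a := (x :- r) :* g :+ (r :* g :+ a)) refl x r (g x) a ⟩
    (x - r) * g x + (r * g x + a) ≈⟨ +-congˡ (+-congʳ (*-congˡ (trans (g≈1 x) (sym (g≈1 r))))) ⟩
    (x - r) * g x + (r * g r + a) ≈⟨ +-congˡ (f≈ r) ⟨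
    (x - r) * g x + f r          ∎
  factor {f = f} (step {g = g} a gm@(step _ _ _) f≈) r with factor gm r
  ... | h , hm , g≈ = (λ x → x * h x + g r) , step (g r) hm (λ x → refl) , λ x → begin
    f x                           ≈⟨ f≈ x ⟩
    x * g x + a                   ≈⟨ +-congʳ (*-congˡ (g≈ x)) ⟩
    x * ((x - r) * h x + g r) + a ≈⟨ solve 5 (λ x r h g a → x :* ((x :- r) :* h :+ g) :+ a :=
                                       (x :- r) :* (x :* h :+ g) :+ (r :* g :+ a)) refl x r (h x) (g r) a ⟩
    (x - r) * (x * h x + g r) + (r * g r + a) ≈⟨ +-congˡ (f≈ r) ⟨
    (x - r) * (x * h x + g r) + f r ∎

  roots≤degree : ∀ {d f} → Monic d f → ∀ {m} (xs : Fin m → Carrier) →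
                 (∀ {i j} → xs i ≈ xs j → i ≡ j) → (∀ i → f (xs i) ≈ 0#) → m ℕ.≤ d
  roots≤degree _ {zero} _ _ _ = ℕ.z≤n
  roots≤degree (one f≈1) {suc m} xs _ root =
    contradiction (trans (sym (f≈1 _)) (root zero)) 1≉0
  roots≤degree {suc d} {f} fm@(step _ _ _) {suc m} xs inj root with factor fm (xs zero)
  ... | g , gm , f≈ = ℕ.s≤s (roots≤degree gm (xs ∘ suc) (Fin.suc-injective ∘ inj) root′)
    where
    root′ : ∀ i → g (xs (suc i)) ≈ 0#
    root′ i = integralˡ (λ eq → Fin.0≢1+n (≡.sym (inj (x-y≈0⇒x≈y _ _ eq)))) (begin
      (xs (suc i) - xs zero) * g (xs (suc i))               ≈⟨ +-identityʳ _ ⟨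
      (xs (suc i) - xs zero) * g (xs (suc i)) + 0#          ≈⟨ +-congˡ (root zero) ⟨
      (xs (suc i) - xs zero) * g (xs (suc i)) + f (xs zero) ≈⟨ f≈ _ ⟨
      f (xs (suc i))                                        ≈⟨ root (suc i) ⟩
      0#                                                    ∎)

  Monic-shift : ∀ k {d f} → Monic d f → Monic (k ℕ.+ d) (λ x → x ^ k * f x)
  Monic-shift zero    (one f≈1)      = one λ x → trans (*-identityˡ _) (f≈1 x)
  Monic-shift zero    (step a gm f≈) = step a gm λ x → trans (*-identityˡ _) (f≈ x)
  Monic-shift (suc k) fm = step 0# (Monic-shift k fm) λ x → trans (*-assoc _ _ _) (sym (+-identityʳ _))

  Monic-+ : ∀ {d f} a → Monic (suc d) f → Monic (suc d) (λ x → f x + a)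
  Monic-+ a (step b gm f≈) = step (b + a) gm λ x → trans (+-congʳ (f≈ x)) (+-assoc _ _ _)

  Monic-≈ : ∀ {d f g} → (∀ x → g x ≈ f x) → Monic d f → Monic d g
  Monic-≈ g≈f (one f≈1)      = one λ x → trans (g≈f x) (f≈1 x)
  Monic-≈ g≈f (step a hm f≈) = step a hm λ x → trans (g≈f x) (f≈ x)

  ^-Monic : ∀ k → Monic k (_^ k)
  ^-Monic k = ≡.subst (λ d → Monic d (_^ k)) (ℕ.+-identityʳ k)
    (Monic-≈ (λ x → sym (*-identityʳ _)) (Monic-shift k (one {f = λ _ → 1#} λ _ → refl)))

  nonRoot : ∀ {d f} → Monic d f → d ℕ.< order → ∃[ x ] f x ≉ 0#
  nonRoot {f = f} fm d<N with Fin.any? (λ i → ¬? (f (element i) ≟ 0#))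
  ... | yes (i , p) = element i , p
  ... | no  allRoots = contradiction (roots≤degree fm element element-injective root) (ℕ.<⇒≱ d<N)
    where
    root : ∀ i → f (element i) ≈ 0#
    root i with f (element i) ≟ 0#
    ... | yes p = p
    ... | no ¬p = contradiction (i , ¬p) allRoots

  -- An endomorphism of the multiplicative monoid; `χ-1` excludes the zero map, for which
  -- independence would fail.
  record Character : Set (c ⊔ ℓ) where
    field
      χ      : Carrier → Carrier
      χ-cong : ∀ {x y} → x ≈ y → χ x ≈ χ y
      χ-*    : ∀ x y → χ (x * y) ≈ χ x * χ y
      χ-1    : χ 1# ≈ 1#

  open Character public

  infix 4 _≈χ_
  _≈χ_ : Character → Character → Set (c ⊔ ℓ)
  χ₁ ≈χ χ₂ = ∀ x → χ χ₁ x ≈ χ χ₂ x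

  ≈χ⊎differ : ∀ χ₁ χ₂ → χ₁ ≈χ χ₂ ⊎ (∃[ x ] χ χ₁ x ≉ χ χ₂ x)
  ≈χ⊎differ χ₁ χ₂ = all⊎counterexample
    (λ x≈y eq → trans (χ-cong χ₁ (sym x≈y)) (trans eq (χ-cong χ₂ x≈y)))
    (λ x → χ χ₁ x ≟ χ χ₂ x)

  Combination : Set (c ⊔ ℓ)
  Combination = List (Carrier × Character)

  eval : Combination → Carrier → Carrier
  eval []             x = 0#
  eval ((a , φ) ∷ ts) x = a * χ φ x + eval ts x

  reweight : (Character → Carrier) → Combination → Combination
  reweight w = List.map λ (a , φ) → a * w φ , φ

  -- Evaluating at `x * y` multiplies the term of ω by ω y. Subtracting φ y times the value at x
  -- leaves the weight ω y - φ y, so the term of φ itself drops out.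
  eval-reweight : ∀ (φ : Character) y ts x →
    eval (reweight (λ ω → χ ω y - χ φ y) ts) x ≈ eval ts (x * y) - χ φ y * eval ts x
  eval-reweight φ y []             x =
    solve 1 (λ p → :0 := :0 :- p :* :0) refl (χ φ y)
  eval-reweight φ y ((a , ω) ∷ ts) x = begin
    a * (χ ω y - χ φ y) * χ ω x + eval (reweight _ ts) x
      ≈⟨ +-congˡ (eval-reweight φ y ts x) ⟩
    a * (χ ω y - χ φ y) * χ ω x + (eval ts (x * y) - χ φ y * eval ts x)
      ≈⟨ solve 6 (λ a w p v s t → a :* (w :- p) :* v :+ (s :- p :* t) :=
           a :* (v :* w) :+ s :- p :* (a :* v :+ t)) refl
           a (χ ω y) (χ φ y) (χ ω x) (eval ts (x * y)) (eval ts x) ⟩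
    a * (χ ω x * χ ω y) + eval ts (x * y) - χ φ y * (a * χ ω x + eval ts x)
      ≈⟨ +-congʳ (+-congʳ (*-congˡ (χ-* ω x y))) ⟨
    a * χ ω (x * y) + eval ts (x * y) - χ φ y * (a * χ ω x + eval ts x) ∎

  -- Dedekind's elimination: multiplying the argument by some y with ω y ≉ φ y
  -- removes ω from the relation and rescales the coefficient of φ.
  isolated-coefficient : ∀ a φ ts → (∀ x → a * χ φ x + eval ts x ≈ 0#) →
    All (λ (_ , ω) → ∃[ y ] χ ω y ≉ χ φ y) ts → a ≈ 0#
  isolated-coefficient a φ ts = go (List.length ts) a φ ts ≡.refl
   where
   -- Recursion on the length, since the reweighted list is not a structural part of the given one.
   go : ∀ n a φ ts → List.length ts ≡ n → (∀ x → a * χ φ x + eval ts x ≈ 0#) →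
        All (λ (_ , ω) → ∃[ y ] χ ω y ≉ χ φ y) ts → a ≈ 0#
   go _ a φ [] _ rel [] = begin
    a                  ≈⟨ *-identityʳ a ⟨
    a * 1#             ≈⟨ *-congˡ (χ-1 φ) ⟨
    a * χ φ 1#         ≈⟨ +-identityʳ _ ⟨
    a * χ φ 1# + 0#    ≈⟨ rel 1# ⟩
    0#                 ∎
   go (suc n) a φ ((b , ω) ∷ ts) len rel ((y , ωy≉φy) ∷ differ) =
     integralʳ (λ eq → ωy≉φy (sym (x-y≈0⇒x≈y _ _ eq)))
       (go n (a * (χ φ y - χ ω y)) φ (reweight w ts)
         (≡.trans (List.length-map _ ts) (ℕ.suc-injective len)) rel′ (reweighted ts differ))
     where
     w : Character → Carrier
     w ψ = χ ψ y - χ ω y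
     reweighted : ∀ ts → All (λ (_ , ω) → ∃[ y ] χ ω y ≉ χ φ y) ts →
                  All (λ (_ , ω) → ∃[ y ] χ ω y ≉ χ φ y) (reweight w ts)
     reweighted []       []       = []
     reweighted (_ ∷ ts) (p ∷ ps) = p ∷ reweighted ts ps
     rel′ : ∀ x → a * w φ * χ φ x + eval (reweight w ts) x ≈ 0#
     rel′ x = begin
       a * w φ * χ φ x + eval (reweight w ts) x
         ≈⟨ +-congˡ (eval-reweight ω y ts x) ⟩
       a * (χ φ y - χ ω y) * χ φ x + (eval ts (x * y) - χ ω y * eval ts x)
         ≈⟨ solve 8 (λ a p q v b u s t → a :* (p :- q) :* v :+ (s :- q :* t) :=
              (a :* (v :* p) :+ (b :* (u :* q) :+ s)) :- q :* (a :* v :+ (b :* u :+ t))) refl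
              a (χ φ y) (χ ω y) (χ φ x) b (χ ω x) (eval ts (x * y)) (eval ts x) ⟩
       (a * (χ φ x * χ φ y) + (b * (χ ω x * χ ω y) + eval ts (x * y)))
         - χ ω y * (a * χ φ x + (b * χ ω x + eval ts x))
         ≈⟨ +-congʳ (+-cong (*-congˡ (χ-* φ x y)) (+-congʳ (*-congˡ (χ-* ω x y)))) ⟨
       (a * χ φ (x * y) + (b * χ ω (x * y) + eval ts (x * y)))
         - χ ω y * (a * χ φ x + (b * χ ω x + eval ts x))
         ≈⟨ +-cong (rel (x * y)) (-‿cong (*-congˡ (rel x))) ⟩
       0# - χ ω y * 0#
         ≈⟨ solve 1 (λ q → :0 :- q :* :0 := :0) refl (χ ω y) ⟩
       0# ∎

-- Fermat, Frobenius and subfields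

choose-absorption : ∀ n k → suc k ℕ.* (suc n choose suc k) ≡ suc n ℕ.* (n choose k)
choose-absorption zero    zero    = ≡.refl
choose-absorption zero    (suc k) = ≡.trans
  (≡.cong (suc (suc k) ℕ.*_) (k>n⇒nCk≡0 {1} {suc (suc k)} (ℕ.s≤s ℕ.z<s)))
  (≡.trans (ℕ.*-zeroʳ k) (≡.cong (1 ℕ.*_) (≡.sym (k>n⇒nCk≡0 {0} {suc k} ℕ.z<s))))
choose-absorption (suc n) zero    = ≡.trans (ℕ.*-identityˡ _)
  (≡.trans (nC1≡n (suc (suc n))) (≡.sym (ℕ.*-identityʳ _)))
choose-absorption (suc n) (suc k) = begin
  suc (suc k) ℕ.* (suc (suc n) choose suc (suc k))
    ≡⟨ ≡.cong (suc (suc k) ℕ.*_) (nCk+nC[k+1]≡[n+1]C[k+1] (suc n) (suc k)) ⟨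
  suc (suc k) ℕ.* (a ℕ.+ (suc n choose suc (suc k)))
    ≡⟨ ℕ.*-distribˡ-+ (suc (suc k)) a _ ⟩
  (a ℕ.+ suc k ℕ.* a) ℕ.+ suc (suc k) ℕ.* (suc n choose suc (suc k))
    ≡⟨ ≡.cong₂ (λ u v → (a ℕ.+ u) ℕ.+ v) (choose-absorption n k) (choose-absorption n (suc k)) ⟩
  (a ℕ.+ suc n ℕ.* (n choose k)) ℕ.+ suc n ℕ.* (n choose suc k)
    ≡⟨ ℕ.+-assoc a _ _ ⟩
  a ℕ.+ (suc n ℕ.* (n choose k) ℕ.+ suc n ℕ.* (n choose suc k))
    ≡⟨ ≡.cong (a ℕ.+_) (ℕ.*-distribˡ-+ (suc n) (n choose k) (n choose suc k)) ⟨
  a ℕ.+ suc n ℕ.* ((n choose k) ℕ.+ (n choose suc k))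
    ≡⟨ ≡.cong (λ u → a ℕ.+ suc n ℕ.* u) (nCk+nC[k+1]≡[n+1]C[k+1] n k) ⟩
  suc (suc n) ℕ.* a ∎
  where
  open ≡.≡-Reasoning
  a = suc n choose suc k

-- By absorption the prime divides `suc k` times the binomial coefficient, and it is too large to
-- divide `suc k`.
prime∣binomial : ∀ {p k} → Prime (suc p) → k ℕ.< p → suc p ∣ (suc p choose suc k)
prime∣binomial {p} {k} pp k<p
  with euclidsLemma (suc k) (suc p choose suc k) pp
         (≡.subst (suc p ∣_) (≡.sym (choose-absorption p k)) (m∣m*n (p choose k)))
... | inj₁ p∣k = contradiction (ℕ.s≤s k<p) (ℕ.≤⇒≯ (∣⇒≤ p∣k))
... | inj₂ p∣C = p∣C

power-minus-one : ∀ r j → ∃[ k ] suc r ℕ.^ j ≡ suc (r ℕ.* k)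
power-minus-one r zero    = 0 , ≡.cong suc (≡.sym (ℕ.*-zeroʳ r))
power-minus-one r (suc j) with power-minus-one r j
... | k , eq = k ℕ.+ suc (r ℕ.* k) , ≡.trans (≡.cong (suc r ℕ.*_) eq) (identity r k)
  where
  identity : ∀ r k → suc r ℕ.* suc (r ℕ.* k) ≡ suc (r ℕ.* (k ℕ.+ suc (r ℕ.* k)))
  identity = solve-∀

-- The degree count for `subfield-nonRoot`, with Q = r + 2 and N = 1 + (r + 1)(k + 1): a polynomial
-- of degree m < Q times the cofactor of degree (r + 1) k stays below degree N.
cofactor-degree : ∀ r k {m} → m ℕ.< suc r ℕ.+ 1 → m ℕ.+ suc r ℕ.* k ℕ.< suc (suc r ℕ.* suc k)
cofactor-degree r k {m} m<Q = begin-strict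
  m ℕ.+ suc r ℕ.* k            <⟨ ℕ.+-monoˡ-< (suc r ℕ.* k) m<Q ⟩
  suc r ℕ.+ 1 ℕ.+ suc r ℕ.* k  ≡⟨ identity r k ⟩
  suc (suc r ℕ.* suc k)        ∎
  where
  open ℕ.≤-Reasoning
  identity : ∀ r k → suc r ℕ.+ 1 ℕ.+ suc r ℕ.* k ≡ suc (suc r ℕ.* suc k)
  identity = solve-∀

module FiniteFieldTheory {c ℓ} (F : FiniteField c ℓ) where
  open FieldTheory F public
  open import Algebra.Properties.Semiring.Mult semiring public
    using (×1-homo-*; ×-assoc-*; ×-congʳ) renaming (_×_ to _·_)
  open import Algebra.Properties.CommutativeMonoid.Sum +-commutativeMonoid public
    using (sum-cong-≋; sum-remove; sum-permute; ∑-distrib-+; sum-init-last; sum-replicate; sum-replicate-zero)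
  import Algebra.Properties.CommutativeMonoid.Sum *-commutativeMonoid as Product
  import Algebra.Properties.CommutativeSemiring.Binomial commutativeSemiring as Binomial
  open import Relation.Binary.Reasoning.Setoid setoid

  private
    permute : (f g : Carrier → Carrier) →
              (∀ {x y} → x ≈ y → f x ≈ f y) → (∀ {x y} → x ≈ y → g x ≈ g y) →
              (∀ x → f (g x) ≈ x) → (∀ x → g (f x) ≈ x) → Permutation.Permutation order order
    permute f g f-cong g-cong fg gf = Permutation.permutation
      (λ i → index (f (element i))) (λ i → index (g (element i)))
      (λ i → inverse f g f-cong fg i)
      (λ i → inverse g f g-cong gf i)
      where
      inverse : ∀ f g → (∀ {x y} → x ≈ y → f x ≈ f y) → (∀ x → f (g x) ≈ x) →
                ∀ i → index (f (element (index (g (element i))))) ≡ i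
      inverse f g f-cong fg i = element-injective (begin
        element (index (f (element (index (g (element i)))))) ≈⟨ element-index _ ⟩
        f (element (index (g (element i))))                   ≈⟨ f-cong (element-index _) ⟩
        f (g (element i))                                     ≈⟨ fg _ ⟩
        element i                                             ∎)

  -- Translation by 1 permutes the field, so it does not change the sum of all elements, although it
  -- adds 1 to each of them.
  order·1≈0 : order · 1# ≈ 0#
  order·1≈0 = +-cancelˡ (sum element) _ _ (begin
    sum element + order · 1#
      ≈⟨ +-congˡ (sum-replicate order) ⟨
    sum element + sum (replicate order 1#)
      ≈⟨ ∑-distrib-+ element _ ⟨
    sum (λ i → element i + 1#)
      ≈⟨ sum-cong-≋ (λ i → element-index (element i + 1#)) ⟨
    sum (λ i → element (index (element i + 1#)))
      ≈⟨ sum-permute element (permute (_+ 1#) (_- 1#) +-congʳ +-congʳ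
           (λ x → solve 1 (λ x → x :- :1 :+ :1 := x) refl x)
           (λ x → solve 1 (λ x → x :+ :1 :- :1 := x) refl x)) ⟨
    sum element
      ≈⟨ +-identityʳ _ ⟨
    sum element + 0# ∎)

  private
    product : ∀ {n} → Vector Carrier n → Carrier
    product = Product.sum

    unless : ∀ {a} {A : Set a} → Dec A → Carrier → Carrier
    unless (yes _) x = 1#
    unless (no  _) x = x

    -- One factor of the product is 1, so it falls short of x ^ n by one x.
    product-unless : ∀ {n} (i : Fin n) x → x * product (λ j → unless (j Fin.≟ i) x) ≈ x ^ n
    product-unless {suc n} i x = *-congˡ (begin
      product (λ j → unless (j Fin.≟ i) x)
        ≈⟨ Product.sum-remove {i = i} (λ j → unless (j Fin.≟ i) x) ⟩
      unless (i Fin.≟ i) x * product (λ j → unless (Fin.punchIn i j Fin.≟ i) x)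
        ≈⟨ *-cong (hit (i Fin.≟ i)) (Product.sum-cong-≋ (λ j → miss (Fin.punchInᵢ≢i i j) (_ Fin.≟ i))) ⟩
      1# * product (replicate n x)
        ≈⟨ *-identityˡ _ ⟩
      product (replicate n x)
        ≈⟨ Product.sum-replicate n ⟩
      x ^ n ∎)
      where
      hit : ∀ (d : Dec (i ≡ i)) → unless d x ≈ 1#
      hit (yes _) = refl
      hit (no i≢i) = contradiction ≡.refl i≢i
      miss : ∀ {j} → ¬ (j ≡ i) → (d : Dec (j ≡ i)) → unless d x ≈ x
      miss j≢i (yes j≡i) = contradiction j≡i j≢i
      miss _ (no _)  = refl

    product-nonZero : ∀ {n} (t : Vector Carrier n) → (∀ i → t i ≉ 0#) → product t ≉ 0#
    product-nonZero {zero}  t nz = 1≉0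
    product-nonZero {suc n} t nz = *-nonZero (nz zero) (product-nonZero (t ∘ suc) (nz ∘ suc))

  -- Multiplication by a nonzero x permutes the nonzero elements, and comparing their products gives
  -- x ^ (N - 1) = 1. The factor at 0 is replaced by 1, so that the products can still run over all
  -- indices.
  fermat : ∀ x → x ^ order ≈ x
  fermat x with x ≟ 0#
  ... | yes x≈0 = begin
    x ^ order   ≈⟨ ^-congˡ order x≈0 ⟩
    0# ^ order  ≈⟨ zero-power order (index 0#) ⟩
    0#          ≈⟨ x≈0 ⟨
    x           ∎
    where
    zero-power : ∀ n → Fin n → 0# ^ n ≈ 0#
    zero-power (suc n) _ = zeroˡ _
  ... | no x≉0 = begin
    x ^ order      ≈⟨ product-unless (index 0#) x ⟨
    x * product xs ≈⟨ *-congˡ (*-cancelʳ (product-nonZero es es-nonZero) (trans (sym rearranged) (sym (*-identityˡ _)))) ⟩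
    x * 1#         ≈⟨ *-identityʳ x ⟩
    x              ∎
    where
    es xs : Vector Carrier order
    es i = unless (i Fin.≟ index 0#) (element i)
    xs i = unless (i Fin.≟ index 0#) x

    es-nonZero : ∀ i → es i ≉ 0#
    es-nonZero i with i Fin.≟ index 0#
    ... | yes _ = 1≉0
    ... | no  i≢ = λ eq → i≢ (≡.trans (≡.sym (index-element i)) (index-cong eq))

    π = permute (x *_) (x ⁻¹ *_) *-congˡ *-congˡ
      (λ y → trans (sym (*-assoc _ _ _)) (trans (*-congʳ (⁻¹-inverseʳ x≉0)) (*-identityˡ y)))
      (λ y → trans (sym (*-assoc _ _ _)) (trans (*-congʳ (⁻¹-inverseˡ x≉0)) (*-identityˡ y)))

    shifted : ∀ i → es (π Permutation.⟨$⟩ʳ i) ≈ xs i * es i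
    shifted i with i Fin.≟ index 0# | index (x * element i) Fin.≟ index 0#
    ... | yes _ | yes _ = sym (*-identityˡ _)
    ... | yes ≡.refl | no i≢ = contradiction
      (index-cong (trans (*-congˡ (element-index 0#)) (zeroʳ x))) i≢
    ... | no i≢  | yes eq = contradiction
      (≡.trans (≡.sym (index-element i)) (index-cong (integralˡ x≉0 (index-injective eq)))) i≢
    ... | no _  | no _  = element-index _

    rearranged : product es ≈ product xs * product es
    rearranged = begin
      product es                                    ≈⟨ Product.sum-permute es π ⟩
      product (λ i → es (π Permutation.⟨$⟩ʳ i))     ≈⟨ Product.sum-cong-≋ shifted ⟩
      product (λ i → xs i * es i)                   ≈⟨ Product.∑-distrib-+ xs es ⟩
      product xs * product es                       ∎

  ·1-^ : ∀ p e → (p ℕ.^ e) · 1# ≈ (p · 1#) ^ e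
  ·1-^ p zero    = +-identityʳ 1#
  ·1-^ p (suc e) = trans (×1-homo-* p (p ℕ.^ e)) (*-congˡ (·1-^ p e))

  characteristic : ∀ p e → order ≡ p ℕ.^ e → p · 1# ≈ 0#
  characteristic p e eq with p · 1# ≟ 0#
  ... | yes p≈0 = p≈0
  ... | no  p≉0 = contradiction
    (trans (sym (·1-^ p e)) (trans (reflexive (≡.cong (_· 1#) (≡.sym eq))) order·1≈0))
    (^-nonZero e p≉0)

  private
    multiple-vanishes : ∀ {p m} → p · 1# ≈ 0# → p ∣ m → ∀ x → m · x ≈ 0#
    multiple-vanishes {p} {m} p≈0 (divides k ≡.refl) x = begin
      (k ℕ.* p) · x          ≈⟨ ×-congʳ (k ℕ.* p) (*-identityˡ x) ⟨
      (k ℕ.* p) · (1# * x)   ≈⟨ ×-assoc-* (k ℕ.* p) 1# x ⟨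
      (k ℕ.* p) · 1# * x     ≈⟨ *-congʳ (×1-homo-* k p) ⟩
      k · 1# * p · 1# * x    ≈⟨ *-congʳ (*-congˡ p≈0) ⟩
      k · 1# * 0# * x        ≈⟨ *-congʳ (zeroʳ _) ⟩
      0# * x                 ≈⟨ zeroˡ x ⟩
      0#                     ∎

  freshman : ∀ {p} → Prime p → p · 1# ≈ 0# → ∀ x y → (x + y) ^ p ≈ x ^ p + y ^ p
  freshman {suc zero}    pp = contradiction (prime⇒nonTrivial pp) λ ()
  freshman {suc (suc p)} pp p≈0 x y = begin
    (x + y) ^ q
      ≈⟨ Binomial.theorem q x y ⟩
    t zero + sum (t ∘ suc)
      ≈⟨ +-congˡ (sum-init-last (t ∘ suc)) ⟩
    t zero + (sum (λ i → t (suc (Fin.inject₁ i))) + t (suc (Fin.fromℕ (suc p))))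
      ≈⟨ +-cong first (+-cong (trans (sum-cong-≋ middle) (sum-replicate-zero (suc p))) last) ⟩
    y ^ q + (0# + x ^ q)
      ≈⟨ solve 2 (λ a b → a :+ (:0 :+ b) := b :+ a) refl (y ^ q) (x ^ q) ⟩
    x ^ q + y ^ q ∎
    where
    q = suc (suc p)
    t = Binomial.binomialTerm x y q
    first : t zero ≈ y ^ q
    first = trans (+-identityʳ _) (*-identityˡ _)
    middle : ∀ i → t (suc (Fin.inject₁ i)) ≈ 0#
    middle i = multiple-vanishes p≈0 (prime∣binomial pp
      (≡.subst (ℕ._< suc p) (≡.sym (Fin.toℕ-inject₁ i)) (Fin.toℕ<n i))) _
    last : t (suc (Fin.fromℕ (suc p))) ≈ x ^ q
    last rewrite Fin.toℕ-fromℕ p | nCn≡1 (suc (suc p)) | ℕ.n∸n≡0 p =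
      trans (+-identityʳ _) (*-identityʳ _)

  Additive : (Carrier → Carrier) → Set _
  Additive f = ∀ x y → f (x + y) ≈ f x + f y

  ^-additive : ∀ {p} → Prime p → p · 1# ≈ 0# → ∀ k → Additive (_^ (p ℕ.^ k))
  ^-additive {p} pp p≈0 zero    x y = trans (*-identityʳ _) (sym (+-cong (*-identityʳ _) (*-identityʳ _)))
  ^-additive {p} pp p≈0 (suc k) x y = begin
    (x + y) ^ (p ℕ.* p ℕ.^ k)
      ≈⟨ ^-assocʳ (x + y) p (p ℕ.^ k) ⟨
    ((x + y) ^ p) ^ (p ℕ.^ k)
      ≈⟨ ^-congˡ (p ℕ.^ k) (freshman pp p≈0 x y) ⟩
    (x ^ p + y ^ p) ^ (p ℕ.^ k)
      ≈⟨ ^-additive pp p≈0 k (x ^ p) (y ^ p) ⟩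
    (x ^ p) ^ (p ℕ.^ k) + (y ^ p) ^ (p ℕ.^ k)
      ≈⟨ +-cong (^-assocʳ x p (p ℕ.^ k)) (^-assocʳ y p (p ℕ.^ k)) ⟩
    x ^ (p ℕ.* p ℕ.^ k) + y ^ (p ℕ.* p ℕ.^ k) ∎

  -- Below d f: f is the function of a polynomial of degree less than d.
  data Below : ℕ → (Carrier → Carrier) → Set (c ⊔ ℓ) where
    none : ∀ {f} → (∀ x → f x ≈ 0#) → Below 0 f
    step : ∀ {d f g} a → Below d g → (∀ x → f x ≈ x * g x + a) → Below (suc d) f

  Monic-+-Below : ∀ {d f g} → Monic d f → Below d g → Monic d (λ x → f x + g x)
  Monic-+-Below (one f≈1) (none g≈0) = one λ x →
    trans (+-cong (f≈1 x) (g≈0 x)) (+-identityʳ _)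
  Monic-+-Below {f = f} {g} (step {g = f′} a fm f≈) (step {g = g′} b gb g≈) =
    step (a + b) (Monic-+-Below fm gb) λ x → begin
      f x + g x                          ≈⟨ +-cong (f≈ x) (g≈ x) ⟩
      (x * f′ x + a) + (x * g′ x + b)    ≈⟨ solve 5 (λ x u v a b → (x :* u :+ a) :+ (x :* v :+ b) :=
                                              x :* (u :+ v) :+ (a :+ b)) refl x (f′ x) (g′ x) a b ⟩
      x * (f′ x + g′ x) + (a + b)        ∎

  Below-zero : ∀ d → Below d (λ _ → 0#)
  Below-zero zero    = none λ _ → refl
  Below-zero (suc d) = step 0# (Below-zero d) λ x → trans (sym (zeroʳ x)) (sym (+-identityʳ _))

  Monic-Below : ∀ {d e f} → Monic d f → d ℕ.< e → Below e f
  Monic-Below {e = suc e} (one f≈1) _ = step 1# (Below-zero e) λ x →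
    trans (f≈1 x) (trans (sym (+-identityˡ 1#)) (+-congʳ (sym (zeroʳ x))))
  Monic-Below (step a gm f≈) (ℕ.s≤s d<e) = step a (Monic-Below gm d<e) f≈

  Below-scale : ∀ {d f} a → Below d f → Below d (λ x → a * f x)
  Below-scale a (none f≈0) = none λ x → trans (*-congˡ (f≈0 x)) (zeroʳ a)
  Below-scale {f = f} a (step {g = g} b gb f≈) = step (a * b) (Below-scale a gb) λ x → begin
    a * f x                  ≈⟨ *-congˡ (f≈ x) ⟩
    a * (x * g x + b)        ≈⟨ solve 4 (λ a x g b → a :* (x :* g :+ b) := x :* (a :* g) :+ a :* b) refl a x (g x) b ⟩
    x * (a * g x) + a * b    ∎

  Monic-* : ∀ {d e f g} → Monic d f → Monic e g → Monic (d ℕ.+ e) (λ x → f x * g x)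
  Monic-* (one f≈1) gm = Monic-≈ (λ x → trans (*-congʳ (f≈1 x)) (*-identityˡ _)) gm
  Monic-* {suc d} {e} {f} {g} (step {g = h} a hm f≈) gm = Monic-≈ (λ x → begin
      f x * g x                          ≈⟨ *-congʳ (f≈ x) ⟩
      (x * h x + a) * g x                ≈⟨ solve 4 (λ x h a g → (x :* h :+ a) :* g :=
                                              (x :* (h :* g) :+ :0) :+ a :* g) refl x (h x) a (g x) ⟩
      (x * (h x * g x) + 0#) + a * g x   ∎)
    (Monic-+-Below (step 0# (Monic-* hm gm) λ x → refl)
      (Below-scale a (Monic-Below gm (ℕ.s≤s (ℕ.m≤n+m e d)))))

  linear-Monic : ∀ r → Monic 1 (_- r)
  linear-Monic r = step (- r) (one {f = λ _ → 1#} λ _ → refl) λ x → +-congʳ (sym (*-identityʳ x))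

  Monic-product : ∀ {k} (xs : Fin k → Carrier) → ∃[ f ] (Monic k f × (∀ x i → x ≈ xs i → f x ≈ 0#))
  Monic-product {zero}  xs = (λ _ → 1#) , one (λ _ → refl) , λ x ()
  Monic-product {suc k} xs with Monic-product (xs ∘ suc)
  ... | f , fm , vanish = (λ x → (x - xs zero) * f x) , Monic-* (linear-Monic (xs zero)) fm , λ where
    x zero    eq → trans (*-congʳ (x≈y⇒x-y≈0 eq)) (zeroˡ _)
    x (suc i) eq → trans (*-congˡ (vanish x i eq)) (zeroʳ _)

  ^-identity-Monic : ∀ r → Monic (suc (suc r)) (λ x → x ^ suc (suc r) - x)
  ^-identity-Monic r = Monic-≈
    (λ x → solve 2 (λ x y → x :* y :- x := x :* (y :- :1) :+ :0) refl x (x ^ suc r))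
    (step 0# (Monic-+ (- 1#) (^-Monic (suc r))) λ x → refl)

  -- The sum of x ^ (r i) for i from 0 to k, in Horner form: the cofactor of X ^ r - 1 in X ^ (r (k
  -- + 1)) - 1.
  geometric : ℕ → ℕ → Carrier → Carrier
  geometric r zero    x = 1#
  geometric r (suc k) x = x ^ r * geometric r k x + 1#

  geometric-Monic : ∀ r k → Monic (suc r ℕ.* k) (geometric (suc r) k)
  geometric-Monic r zero    = ≡.subst (λ d → Monic d (geometric (suc r) zero)) (≡.sym (ℕ.*-zeroʳ r)) (one λ _ → refl)
  geometric-Monic r (suc k) = ≡.subst (λ d → Monic d (geometric (suc r) (suc k))) (≡.sym (ℕ.*-suc (suc r) k))
    (Monic-+ 1# (Monic-shift (suc r) (geometric-Monic r k)))

  geometric-sum : ∀ r k x → (x ^ r - 1#) * geometric r k x ≈ x ^ (r ℕ.* suc k) - 1#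
  geometric-sum r zero    x = trans (*-identityʳ _)
    (+-congʳ (^-congʳ x (≡.sym (ℕ.*-identityʳ r))))
  geometric-sum r (suc k) x = begin
    (x ^ r - 1#) * (x ^ r * geometric r k x + 1#)
      ≈⟨ solve 2 (λ y g → (y :- :1) :* (y :* g :+ :1) := y :* ((y :- :1) :* g) :+ (y :- :1)) refl
           (x ^ r) (geometric r k x) ⟩
    x ^ r * ((x ^ r - 1#) * geometric r k x) + (x ^ r - 1#)
      ≈⟨ +-congʳ (*-congˡ (geometric-sum r k x)) ⟩
    x ^ r * (x ^ (r ℕ.* suc k) - 1#) + (x ^ r - 1#)
      ≈⟨ solve 2 (λ y z → y :* (z :- :1) :+ (y :- :1) := y :* z :- :1) refl (x ^ r) (x ^ (r ℕ.* suc k)) ⟩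
    x ^ r * x ^ (r ℕ.* suc k) - 1#
      ≈⟨ +-congʳ (^-homo-* x r (r ℕ.* suc k)) ⟨
    x ^ (r ℕ.+ r ℕ.* suc k) - 1#
      ≈⟨ +-congʳ (^-congʳ x (≡.sym (ℕ.*-suc r (suc k)))) ⟩
    x ^ (r ℕ.* suc (suc k)) - 1# ∎

  -- Since X ^ N - X = (X ^ Q - X) G with G of degree N - Q, the polynomial X ^ Q - X
  -- has too many roots for all of them to be roots of a polynomial of degree m < Q.
  subfield-nonRoot : ∀ Q j → 1 ℕ.< Q → 0 ℕ.< j → order ≡ Q ℕ.^ j →
    ∀ {m f} → Monic m f → m ℕ.< Q → ∃[ x ] (x ^ Q ≈ x × f x ≉ 0#)
  subfield-nonRoot (suc zero) j (ℕ.s≤s ())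
  subfield-nonRoot Q@(suc (suc r)) j _ 0<j eq {m} {f} fm m<Q with power-minus-one (suc r) j
  ... | zero , N≡ = contradiction (≡.trans N≡ (≡.cong suc (ℕ.*-zeroʳ r)))
    λ N≡1 → ℕ.<⇒≢ (ℕ.^-monoʳ-< Q (ℕ.s≤s ℕ.z<s) 0<j) (≡.sym N≡1)
  ... | suc k , N≡ = x , root , λ fx≈0 → fx*gx≉0 (trans (*-congʳ fx≈0) (zeroˡ _))
    where
    -- A nonroot of the product is a nonroot of f and of the cofactor; the second fact places it in
    -- the subfield.
    found = nonRoot (Monic-* fm (geometric-Monic r k))
      (≡.subst (m ℕ.+ suc r ℕ.* k ℕ.<_) (≡.sym (≡.trans eq N≡)) (cofactor-degree r k (≡.subst (m ℕ.<_) (ℕ.+-comm 1 (suc r)) m<Q)))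
    x = proj₁ found
    fx*gx≉0 = proj₂ found
    gx≉0 : geometric (suc r) k x ≉ 0#
    gx≉0 gx≈0 = fx*gx≉0 (trans (*-congˡ gx≈0) (zeroʳ _))
    root : x ^ Q ≈ x
    root = decide (x ≟ 0#)
      where
      power : x ≉ 0# → x * x ^ (suc r ℕ.* suc k) ≈ x * 1#
      power x≉0 = begin
        x ^ suc (suc r ℕ.* suc k)  ≈⟨ ^-congʳ x (≡.trans (≡.sym N≡) (≡.sym eq)) ⟩
        x ^ order                  ≈⟨ fermat x ⟩
        x                          ≈⟨ *-identityʳ x ⟨
        x * 1#                     ∎
      decide : Dec (x ≈ 0#) → x ^ Q ≈ x
      decide (yes x≈0) = trans (^-congˡ Q x≈0) (trans (0^n≈0 (suc r)) (sym x≈0))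
      decide (no  x≉0) = trans (*-congˡ (x-y≈0⇒x≈y _ _ (integralʳ gx≉0 (begin
        (x ^ suc r - 1#) * geometric (suc r) k x ≈⟨ geometric-sum (suc r) k x ⟩
        x ^ (suc r ℕ.* suc k) - 1#               ≈⟨ x≈y⇒x-y≈0 (*-cancelˡ x≉0 (power x≉0)) ⟩
        0#                                       ∎)))) (*-identityʳ x)

  subfield-avoid : ∀ Q j → 1 ℕ.< Q → 0 ℕ.< j → order ≡ Q ℕ.^ j →
    ∀ {m} → m ℕ.< Q → (xs : Fin m → Carrier) → ∃[ x ] (x ^ Q ≈ x × ∀ i → x ≉ xs i)
  subfield-avoid Q j 1<Q 0<j eq m<Q xs with Monic-product xs
  ... | f , fm , vanish with subfield-nonRoot Q j 1<Q 0<j eq fm m<Q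
  ... | x , root , fx≉0 = x , root , λ i x≈ → fx≉0 (vanish x i x≈)

-- Semilinear maps

module Semilinearity {c ℓ} (F : FiniteField c ℓ) where
  open FieldTheory F public
  open import Relation.Binary.Reasoning.Setoid setoid

  differ : ∀ φ ω → ¬ φ ≈χ ω → ∃[ y ] χ φ y ≉ χ ω y
  differ φ ω φ≉ω with ≈χ⊎differ φ ω
  ... | inj₁ φ≈ω = contradiction φ≈ω φ≉ω
  ... | inj₂ d   = d

  ≈χ? : ∀ φ ω → Dec (φ ≈χ ω)
  ≈χ? φ ω with ≈χ⊎differ φ ω
  ... | inj₁ φ≈ω     = yes φ≈ω
  ... | inj₂ (x , d) = no λ φ≈ω → d (φ≈ω x)

  ≈χ-sym : ∀ {φ ω} → φ ≈χ ω → ω ≈χ φ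
  ≈χ-sym eq x = sym (eq x)

  ≈χ-trans : ∀ {φ ω ψ} → φ ≈χ ω → ω ≈χ ψ → φ ≈χ ψ
  ≈χ-trans eq₁ eq₂ x = trans (eq₁ x) (eq₂ x)

  two-characters : ∀ a φ b ω → (∀ x → a * χ φ x + b * χ ω x ≈ 0#) → ¬ φ ≈χ ω → a ≈ 0#
  two-characters a φ b ω rel φ≉ω = isolated-coefficient a φ ((b , ω) ∷ [])
    (λ x → trans (+-congˡ (+-identityʳ _)) (rel x))
    (differ ω φ (λ eq → φ≉ω (≈χ-sym {ω} {φ} eq)) ∷ [])

  isolated₃ : ∀ a φ b ω c ψ → (∀ x → a * χ φ x + (b * χ ω x + c * χ ψ x) ≈ 0#) →
              ¬ φ ≈χ ω → ¬ φ ≈χ ψ → a ≈ 0#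
  isolated₃ a φ b ω c ψ rel φ≉ω φ≉ψ = isolated-coefficient a φ ((b , ω) ∷ (c , ψ) ∷ [])
    (λ x → trans (+-congˡ (+-congˡ (+-identityʳ _))) (rel x))
    (differ ω φ (λ eq → φ≉ω (≈χ-sym {ω} {φ} eq)) ∷ differ ψ φ (λ eq → φ≉ψ (≈χ-sym {ψ} {φ} eq)) ∷ [])

  three-characters : ∀ a φ b ω c ψ → a ≉ 0# → b ≉ 0# →
    (∀ x → a * χ φ x + (b * χ ω x + c * χ ψ x) ≈ 0#) → φ ≈χ ω ⊎ φ ≈χ ψ × ¬ φ ≈χ ω
  three-characters a φ b ω c ψ a≉0 b≉0 rel with ≈χ? φ ω | ≈χ? φ ψ
  ... | yes eq | _ = inj₁ eq
  ... | no φ≉ω | yes eq = inj₂ (eq , φ≉ω)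
  ... | no φ≉ω | no φ≉ψ = contradiction (isolated₃ a φ b ω c ψ rel φ≉ω φ≉ψ) a≉0

  -- With nonzero coefficients no character of the relation can be isolated. If φ agreed with ψ but
  -- not with ω, then ω would be isolated.
  all-equal₃ : ∀ a φ b ω c ψ → a ≉ 0# → b ≉ 0# → c ≉ 0# →
    (∀ x → a * χ φ x + (b * χ ω x + c * χ ψ x) ≈ 0#) → φ ≈χ ω
  all-equal₃ a φ b ω c ψ a≉0 b≉0 c≉0 rel with three-characters a φ b ω c ψ a≉0 b≉0 rel
  ... | inj₁ φ≈ω = φ≈ω
  ... | inj₂ (φ≈ψ , φ≉ω) = contradiction
    (isolated₃ b ω a φ c ψ
      (λ x → trans (solve 3 (λ u v w → v :+ (u :+ w) := u :+ (v :+ w)) refl _ _ _) (rel x))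
      (λ ω≈φ → φ≉ω (≈χ-sym {ω} {φ} ω≈φ))
      (λ ω≈ψ → φ≉ω (≈χ-trans {φ} {ψ} {ω} φ≈ψ (≈χ-sym {ω} {ψ} ω≈ψ))))
    b≉0

  -- If φ₀ and φ₁ differed, collecting the terms that agree with φ₀ would isolate the coefficient
  -- p₀, p₀ - p₂ or p₀ + p₃; when φ₂ and φ₃ both agree with φ₀, the isolated coefficient is p₁
  -- instead. The hypotheses keep all four nonzero.
  parallelogram : ∀ {p₀ p₁ p₂ p₃} φ₀ φ₁ φ₂ φ₃ →
    p₀ ≉ 0# → p₁ ≉ 0# → p₀ ≉ p₂ → p₀ + p₃ ≉ 0# →
    (∀ x → p₀ * χ φ₀ x + p₃ * χ φ₃ x ≈ p₁ * χ φ₁ x + p₂ * χ φ₂ x) → φ₀ ≈χ φ₁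
  parallelogram {p₀} {p₁} {p₂} {p₃} φ₀ φ₁ φ₂ φ₃ p₀≉0 p₁≉0 p₀≉p₂ p₀+p₃≉0 rel
    with ≈χ? φ₀ φ₁ | ≈χ? φ₀ φ₂ | ≈χ? φ₀ φ₃
  ... | yes eq | _ | _ = eq
  ... | no 0≉1 | no 0≉2 | no 0≉3 = contradiction
    (isolated-coefficient p₀ φ₀ ((- p₁ , φ₁) ∷ (- p₂ , φ₂) ∷ (p₃ , φ₃) ∷ [])
      (λ x → trans (solve 7 (λ a s b t c u w → a :+ ((:- b) :* t :+ ((:- c) :* u :+ (w :+ :0))) :=
                               (a :+ w) :- (b :* t :+ c :* u)) refl
                      (p₀ * χ φ₀ x) p₀ p₁ (χ φ₁ x) p₂ (χ φ₂ x) (p₃ * χ φ₃ x))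
                   (x≈y⇒x-y≈0 (rel x)))
      (differ φ₁ φ₀ (λ e → 0≉1 (≈χ-sym {φ₁} {φ₀} e)) ∷ differ φ₂ φ₀ (λ e → 0≉2 (≈χ-sym {φ₂} {φ₀} e))
        ∷ differ φ₃ φ₀ (λ e → 0≉3 (≈χ-sym {φ₃} {φ₀} e)) ∷ []))
    p₀≉0
  ... | no 0≉1 | yes 0≈2 | no 0≉3 = contradiction
    (isolated₃ (p₀ - p₂) φ₀ (- p₁) φ₁ p₃ φ₃
      (λ x → trans (trans
        (solve 6 (λ a c s b t w → (a :- c) :* s :+ ((:- b) :* t :+ w) :=
                                  (a :* s :+ w) :- (b :* t :+ c :* s)) refl
                p₀ p₂ (χ φ₀ x) p₁ (χ φ₁ x) (p₃ * χ φ₃ x))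
        (+-congˡ (-‿cong (+-congˡ (*-congˡ (0≈2 x))))))
        (x≈y⇒x-y≈0 (rel x)))
      0≉1 0≉3)
    (λ eq → p₀≉p₂ (x-y≈0⇒x≈y _ _ eq))
  ... | no 0≉1 | no 0≉2 | yes 0≈3 = contradiction
    (isolated₃ (p₀ + p₃) φ₀ (- p₁) φ₁ (- p₂) φ₂
      (λ x → trans (trans
        (solve 7 (λ a w s b t c u → (a :+ w) :* s :+ ((:- b) :* t :+ (:- c) :* u) :=
                                    (a :* s :+ w :* s) :- (b :* t :+ c :* u)) refl
                p₀ p₃ (χ φ₀ x) p₁ (χ φ₁ x) p₂ (χ φ₂ x))
        (+-congʳ (+-congˡ (*-congˡ (0≈3 x)))))
        (x≈y⇒x-y≈0 (rel x)))
      0≉1 0≉2)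
    p₀+p₃≉0
  ... | no 0≉1 | yes 0≈2 | yes 0≈3 = contradiction
    (two-characters p₁ φ₁ (p₂ - p₀ - p₃) φ₀
      (λ x → trans (trans
        (solve 6 (λ b t c a d s → b :* t :+ (c :- a :- d) :* s :=
                                  (b :* t :+ c :* s) :- (a :* s :+ d :* s)) refl
                p₁ (χ φ₁ x) p₂ p₀ p₃ (χ φ₀ x))
        (+-cong (+-congˡ (*-congˡ (0≈2 x))) (-‿cong (+-congˡ (*-congˡ (0≈3 x))))))
        (x≈y⇒x-y≈0 (sym (rel x))))
      (λ eq → 0≉1 (≈χ-sym {φ₁} {φ₀} eq)))
    p₁≉0

  -- These are the constant multiples of field automorphisms. The law `to-*` expresses this without
  -- naming the automorphism, so that inverses and composites need no bookkeeping of automorphisms.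
  record SL : Set (c ⊔ ℓ) where
    field
      to from   : Carrier → Carrier
      to-cong   : ∀ {x y} → x ≈ y → to x ≈ to y
      from-cong : ∀ {x y} → x ≈ y → from x ≈ from y
      to-+      : ∀ x y → to (x + y) ≈ to x + to y
      to-*      : ∀ x y → to (x * y) * to 1# ≈ to x * to y
      to-from   : ∀ x → to (from x) ≈ x
      from-to   : ∀ x → from (to x) ≈ x

    to-injective : ∀ {x y} → to x ≈ to y → x ≈ y
    to-injective eq = trans (sym (from-to _)) (trans (from-cong eq) (from-to _))

    to-0 : to 0# ≈ 0#
    to-0 = +-cancelˡ (to 0#) _ _ (trans (sym (to-+ 0# 0#))
      (trans (to-cong (+-identityʳ 0#)) (sym (+-identityʳ _))))

    to-nonZero : ∀ {x} → x ≉ 0# → to x ≉ 0#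
    to-nonZero x≉0 eq = x≉0 (to-injective (trans eq (sym to-0)))

    from-0 : from 0# ≈ 0#
    from-0 = trans (from-cong (sym to-0)) (from-to 0#)

    to-1≉0 : to 1# ≉ 0#
    to-1≉0 = to-nonZero 1≉0

    character : Character
    character = record
      { χ      = λ x → to x * to 1# ⁻¹
      ; χ-cong = λ eq → *-congʳ (to-cong eq)
      ; χ-*    = λ x y → *-cancelʳ to-1≉0 (begin
          to (x * y) * to 1# ⁻¹ * to 1#
            ≈⟨ solve 3 (λ p q r → p :* q :* r := p :* r :* q) refl (to (x * y)) (to 1# ⁻¹) (to 1#) ⟩
          to (x * y) * to 1# * to 1# ⁻¹
            ≈⟨ *-congʳ (to-* x y) ⟩
          to x * to y * to 1# ⁻¹
            ≈⟨ *-identityʳ _ ⟨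
          to x * to y * to 1# ⁻¹ * 1#
            ≈⟨ *-congˡ (⁻¹-inverseˡ to-1≉0) ⟨
          to x * to y * to 1# ⁻¹ * (to 1# ⁻¹ * to 1#)
            ≈⟨ solve 4 (λ p q r s → p :* q :* r :* (r :* s) := p :* r :* (q :* r) :* s) refl
                 (to x) (to y) (to 1# ⁻¹) (to 1#) ⟩
          to x * to 1# ⁻¹ * (to y * to 1# ⁻¹) * to 1# ∎)
      ; χ-1    = ⁻¹-inverseʳ to-1≉0
      }

    to-χ : ∀ x → to x ≈ to 1# * χ character x
    to-χ x = begin
      to x                      ≈⟨ *-identityʳ _ ⟨
      to x * 1#                 ≈⟨ *-congˡ (⁻¹-inverseʳ to-1≉0) ⟨
      to x * (to 1# * to 1# ⁻¹) ≈⟨ solve 3 (λ p q r → p :* (q :* r) := q :* (p :* r)) refl _ _ _ ⟩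
      to 1# * (to x * to 1# ⁻¹) ∎

    to-scale : ∀ a x → to (a * x) ≈ χ character a * to x
    to-scale a x = *-cancelʳ to-1≉0 (begin
      to (a * x) * to 1#              ≈⟨ to-* a x ⟩
      to a * to x                     ≈⟨ *-congʳ (to-χ a) ⟩
      to 1# * χ character a * to x    ≈⟨ solve 3 (λ p q r → p :* q :* r := q :* r :* p) refl _ _ _ ⟩
      χ character a * to x * to 1#    ∎)

  open SL

  inverse : SL → SL
  inverse T = record
    { to = from T ; from = to T ; to-cong = from-cong T ; from-cong = to-cong T
    ; to-+ = λ x y → to-injective T (begin
        to T (from T (x + y))                  ≈⟨ to-from T _ ⟩
        x + y                                  ≈⟨ +-cong (to-from T x) (to-from T y) ⟨
        to T (from T x) + to T (from T y)      ≈⟨ to-+ T _ _ ⟨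
        to T (from T x + from T y)             ∎)
    ; to-* = λ x y → to-injective T (*-cancelʳ (to-1≉0 T) (begin
        to T (from T (x * y) * from T 1#) * to T 1#     ≈⟨ to-* T _ _ ⟩
        to T (from T (x * y)) * to T (from T 1#)        ≈⟨ *-cong (to-from T _) (to-from T _) ⟩
        x * y * 1#                                      ≈⟨ *-identityʳ _ ⟩
        x * y                                           ≈⟨ *-cong (to-from T x) (to-from T y) ⟨
        to T (from T x) * to T (from T y)               ≈⟨ to-* T _ _ ⟨
        to T (from T x * from T y) * to T 1#            ∎))
    ; to-from = from-to T ; from-to = to-from T }

  infixr 9 _⊙_
  _⊙_ : SL → SL → SL
  S ⊙ T = record
    { to = λ x → to S (to T x) ; from = λ x → from T (from S x)
    ; to-cong = λ eq → to-cong S (to-cong T eq) ; from-cong = λ eq → from-cong T (from-cong S eq)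
    ; to-+ = λ x y → trans (to-cong S (to-+ T x y)) (to-+ S _ _)
    ; to-* = λ x y → begin
        to S (to T (x * y)) * to S (to T 1#)   ≈⟨ to-* S _ _ ⟨
        to S (to T (x * y) * to T 1#) * to S 1# ≈⟨ *-congʳ (to-cong S (to-* T x y)) ⟩
        to S (to T x * to T y) * to S 1#       ≈⟨ to-* S _ _ ⟩
        to S (to T x) * to S (to T y)          ∎
    ; to-from = λ x → trans (to-cong S (to-from T _)) (to-from S x)
    ; from-to = λ x → trans (from-cong T (from-to S _)) (from-to T x) }

  scaling : ∀ a → a ≉ 0# → SL
  scaling a a≉0 = record
    { to = a *_ ; from = a ⁻¹ *_ ; to-cong = *-congˡ ; from-cong = *-congˡ
    ; to-+ = distribˡ a
    ; to-* = λ x y → solve 3 (λ a x y → a :* (x :* y) :* (a :* :1) := a :* x :* (a :* y)) refl a x y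
    ; to-from = λ x → trans (sym (*-assoc _ _ _)) (trans (*-congʳ (⁻¹-inverseʳ a≉0)) (*-identityˡ x))
    ; from-to = λ x → trans (sym (*-assoc _ _ _)) (trans (*-congʳ (⁻¹-inverseˡ a≉0)) (*-identityˡ x)) }

  trivial : Character
  trivial = record { χ = λ x → x ; χ-cong = λ eq → eq ; χ-* = λ _ _ → refl ; χ-1 = refl }

  Scalar : SL → Set (c ⊔ ℓ)
  Scalar T = character T ≈χ trivial

  to-Scalar : ∀ T → Scalar T → ∀ x → to T x ≈ to T 1# * x
  to-Scalar T scalar x = trans (to-χ T x) (*-congˡ (scalar x))

  -- Of the two parallelograms X, X+Y, X+Y, X+2Y and X, X+Y, X+Z, X+Y+Z at least one
  -- has its diagonal sum 2X+Y+Z nonzero.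
  affine-line : ∀ (X XY XYY XZ XYZ : SL) (Y Z : Carrier → Carrier) →
    (∀ x → to XY x ≈ to X x + Y x) → (∀ x → to XYY x ≈ to X x + Y x + Y x) →
    (∀ x → to XZ x ≈ to X x + Z x) → (∀ x → to XYZ x ≈ to X x + Y x + Z x) →
    Y 1# ≉ 0# → Z 1# ≉ 0# → Y 1# ≉ Z 1# → character X ≈χ character XY
  affine-line X XY XYY XZ XYZ Y Z XY≈ XYY≈ XZ≈ XYZ≈ Y≉0 Z≉0 Y≉Z
    with to X 1# + to XYY 1# ≟ 0#
  ... | no  2X+2Y≉0 = parallelogram (character X) (character XY) (character XY) (character XYY)
    (to-1≉0 X) (to-1≉0 XY)
    (λ eq → Y≉0 (+-cancelˡ (to X 1#) _ _ (trans (sym (XY≈ 1#)) (trans (sym eq) (sym (+-identityʳ _))))))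
    2X+2Y≉0
    (λ x → begin
      to X 1# * χ (character X) x + to XYY 1# * χ (character XYY) x ≈⟨ +-cong (to-χ X x) (to-χ XYY x) ⟨
      to X x + to XYY x                     ≈⟨ +-congˡ (XYY≈ x) ⟩
      to X x + (to X x + Y x + Y x)         ≈⟨ solve 2 (λ p q → p :+ (p :+ q :+ q) := (p :+ q) :+ (p :+ q)) refl _ _ ⟩
      (to X x + Y x) + (to X x + Y x)       ≈⟨ +-cong (XY≈ x) (XY≈ x) ⟨
      to XY x + to XY x                     ≈⟨ +-cong (to-χ XY x) (to-χ XY x) ⟩
      _                                     ∎)
  ... | yes 2X+2Y≈0 = parallelogram (character X) (character XY) (character XZ) (character XYZ)
    (to-1≉0 X) (to-1≉0 XY)
    (λ eq → Z≉0 (+-cancelˡ (to X 1#) _ _ (trans (sym (XZ≈ 1#)) (trans (sym eq) (sym (+-identityʳ _))))))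
    (λ 2X+Y+Z≈0 → Y≉Z (+-cancelˡ (to X 1# + (to X 1# + Y 1#)) _ _ (begin
      to X 1# + (to X 1# + Y 1#) + Y 1#     ≈⟨ +-assoc _ _ _ ⟩
      to X 1# + (to X 1# + Y 1# + Y 1#)     ≈⟨ +-congˡ (XYY≈ 1#) ⟨
      to X 1# + to XYY 1#                   ≈⟨ trans 2X+2Y≈0 (sym 2X+Y+Z≈0) ⟩
      to X 1# + to XYZ 1#                   ≈⟨ +-congˡ (XYZ≈ 1#) ⟩
      to X 1# + (to X 1# + Y 1# + Z 1#)     ≈⟨ +-assoc _ _ _ ⟨
      to X 1# + (to X 1# + Y 1#) + Z 1#     ∎)))
    (λ x → begin
      to X 1# * χ (character X) x + to XYZ 1# * χ (character XYZ) x ≈⟨ +-cong (to-χ X x) (to-χ XYZ x) ⟨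
      to X x + to XYZ x                     ≈⟨ +-congˡ (XYZ≈ x) ⟩
      to X x + (to X x + Y x + Z x)         ≈⟨ solve 3 (λ p q r → p :+ (p :+ q :+ r) := (p :+ q) :+ (p :+ r)) refl _ _ _ ⟩
      (to X x + Y x) + (to X x + Z x)       ≈⟨ +-cong (XY≈ x) (XZ≈ x) ⟨
      to XY x + to XZ x                     ≈⟨ +-cong (to-χ XY x) (to-χ XZ x) ⟩
      _                                     ∎)

  injective⇒inverse : ∀ {f : Carrier → Carrier} → (∀ {x y} → x ≈ y → f x ≈ f y) →
    (∀ {x y} → f x ≈ f y → x ≈ y) → ∀ y → ∃[ x ] f x ≈ y
  injective⇒inverse {f} cong inj y
    with injective⇒surjective {f = λ i → index (f (element i))}
           (λ eq → element-injective (inj (index-injective eq))) (index y)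
  ... | i , eq = element i , index-injective eq

  -- Writing X for the inverse of T₀ and γ for to T₀ ∘ α, the hypotheses say that X + γ⁻¹, X + 2γ⁻¹,
  -- X + τγ⁻¹ and X + γ⁻¹ + τγ⁻¹ are semilinear, so γ⁻¹ has the character of X.
  scalar-by-translates : ∀ (T₀ T₁ T₂ Tτ T₁τ : SL) (α τ : Carrier → Carrier) →
    (∀ {x y} → x ≈ y → α x ≈ α y) → (∀ {x y} → α x ≈ α y → x ≈ y) → α 0# ≈ 0# →
    (∀ {x y} → x ≈ y → τ x ≈ τ y) →
    (∀ {x} → x ≉ 0# → τ x ≉ 0#) → (∀ {x} → x ≉ 0# → x ≉ τ x) →
    (∀ x → to T₁  (α x + x)       ≈ to T₀ (α x)) → (∀ x → to T₂  (α x + x + x)   ≈ to T₀ (α x)) →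
    (∀ x → to Tτ  (α x + τ x)     ≈ to T₀ (α x)) → (∀ x → to T₁τ (α x + x + τ x) ≈ to T₀ (α x)) →
    ∀ x → α x ≈ α 1# * x
  scalar-by-translates T₀ T₁ T₂ Tτ T₁τ α τ α-cong α-inj α-0 τ-cong τ≉0 τ≉id T₁≈ T₂≈ Tτ≈ T₁τ≈ x =
    *-cancelʳ u≉0 (begin
      α x * u            ≈⟨ *-congʳ (α-χ x) ⟩
      p * ω x * u        ≈⟨ solve 3 (λ p w u → p :* w :* u := p :* (u :* w)) refl p (ω x) u ⟩
      p * (u * ω x)      ≈⟨ *-congˡ (id-χ x) ⟨
      p * x              ≈⟨ *-congʳ p≈ ⟩
      α 1# * u * x       ≈⟨ solve 3 (λ a u x → a :* u :* x := a :* x :* u) refl (α 1#) u x ⟩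
      α 1# * x * u       ∎)
    where
    γ δ : Carrier → Carrier
    γ x = to T₀ (α x)
    γ-cong : ∀ {x y} → x ≈ y → γ x ≈ γ y
    γ-cong eq = to-cong T₀ (α-cong eq)
    γ-inj : ∀ {x y} → γ x ≈ γ y → x ≈ y
    γ-inj eq = α-inj (to-injective T₀ eq)
    δ y = proj₁ (injective⇒inverse γ-cong γ-inj y)
    γδ : ∀ y → γ (δ y) ≈ y
    γδ y = proj₂ (injective⇒inverse γ-cong γ-inj y)
    δγ : ∀ x → δ (γ x) ≈ x
    δγ x = γ-inj (γδ (γ x))
    δ-nonZero : δ 1# ≉ 0#
    δ-nonZero eq = 1≉0 (begin
      1#          ≈⟨ γδ 1# ⟨
      γ (δ 1#)    ≈⟨ γ-cong eq ⟩
      γ 0#        ≈⟨ to-cong T₀ α-0 ⟩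
      to T₀ 0#    ≈⟨ to-0 T₀ ⟩
      0#          ∎)
    X = inverse T₀
    X≈ : ∀ y → to X y ≈ α (δ y)
    X≈ y = trans (from-cong T₀ (sym (γδ y))) (from-to T₀ _)
    translate : ∀ (T : SL) (β : Carrier → Carrier) → (∀ x → to T (β x) ≈ γ x) → ∀ y → from T y ≈ β (δ y)
    translate T β T≈ y = trans (from-cong T (trans (sym (γδ y)) (sym (T≈ _)))) (from-to T _)
    X~X+δ : character X ≈χ character (inverse T₁)
    X~X+δ = affine-line X (inverse T₁) (inverse T₂) (inverse Tτ) (inverse T₁τ) δ (λ y → τ (δ y))
      (λ y → trans (translate T₁ _ T₁≈ y) (+-congʳ (sym (X≈ y))))
      (λ y → trans (translate T₂ _ T₂≈ y) (+-congʳ (+-congʳ (sym (X≈ y)))))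
      (λ y → trans (translate Tτ _ Tτ≈ y) (+-congʳ (sym (X≈ y))))
      (λ y → trans (translate T₁τ _ T₁τ≈ y) (+-congʳ (+-congʳ (sym (X≈ y)))))
      δ-nonZero (τ≉0 δ-nonZero) (τ≉id δ-nonZero)
    u = δ 1#
    u≉0 = δ-nonZero
    p = to X 1#
    ω : Carrier → Carrier
    ω x = χ (character X) (γ x)
    -- δ is the difference of two semilinear maps with the same character, hence a multiple of that
    -- character.
    δ-χ : ∀ y → δ y ≈ u * χ (character X) y
    δ-χ y = +-cancelˡ (to X y) _ _ (begin
      to X y + δ y                               ≈⟨ +-congʳ (X≈ y) ⟩
      α (δ y) + δ y                              ≈⟨ translate T₁ _ T₁≈ y ⟨
      from T₁ y                                  ≈⟨ to-χ (inverse T₁) y ⟩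
      from T₁ 1# * χ (character (inverse T₁)) y  ≈⟨ *-cong (trans (translate T₁ _ T₁≈ 1#) (+-congʳ (sym (X≈ 1#)))) (sym (X~X+δ y)) ⟩
      (p + u) * χ (character X) y                ≈⟨ distribʳ _ _ _ ⟩
      p * χ (character X) y + u * χ (character X) y ≈⟨ +-congʳ (to-χ X y) ⟨
      to X y + u * χ (character X) y             ∎)
    -- Both α and the identity are constant multiples of ω, so α is multiplication by the quotient
    -- of the two constants.
    α-χ : ∀ x → α x ≈ p * ω x
    α-χ x = trans (sym (from-to T₀ _)) (to-χ X (γ x))
    id-χ : ∀ x → x ≈ u * ω x
    id-χ x = trans (sym (δγ x)) (δ-χ (γ x))
    p≈ : p ≈ α 1# * u
    p≈ = sym (begin
      α 1# * u             ≈⟨ *-congʳ (α-χ 1#) ⟩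
      p * ω 1# * u         ≈⟨ solve 3 (λ p w u → p :* w :* u := p :* (u :* w)) refl p (ω 1#) u ⟩
      p * (u * ω 1#)       ≈⟨ *-congˡ (id-χ 1#) ⟨
      p * 1#               ≈⟨ *-identityʳ p ⟩
      p                    ∎)

-- Actions on the axes

module TwoFields {c ℓ c′ ℓ′} (K : FiniteField c ℓ) (E : FiniteField c′ ℓ′) where
  private
    module K = FieldTheory K
  open Semilinearity E
  open SL
  open import Relation.Binary.Reasoning.Setoid setoid

  injective⇒surjectiveᴷ : K.order ≡ order → ∀ {f : K.Carrier → Carrier} →
    (∀ {x y} → f x ≈ f y → x K.≈ y) → ∀ y → ∃[ x ] f x ≈ y
  injective⇒surjectiveᴷ eq {f} inj y
    with injective⇒surjective {f = λ i → index (f (K.element (≡.subst Fin (≡.sym eq) i)))}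
           (λ e → cast-injective (K.element-injective (inj (index-injective e)))) (index y)
    where
    cast-injective : ∀ {i j} → ≡.subst Fin (≡.sym eq) i ≡ ≡.subst Fin (≡.sym eq) j → i ≡ j
    cast-injective with ≡.sym eq
    ... | ≡.refl = λ e → e
  ... | i , e = _ , index-injective e

  record Operators (P : K.Carrier → Carrier → Carrier) : Set (c ⊔ ℓ ⊔ c′ ⊔ ℓ′) where
    field
      cong₂ : ∀ {g h x y} → g K.≈ h → x ≈ y → P g x ≈ P h y
      +ˡ    : ∀ g h x → P (g K.+ h) x ≈ P g x + P h x
      +ʳ    : ∀ g x y → P g (x + y) ≈ P g x + P g y

    0ʳ : ∀ g → P g 0# ≈ 0#
    0ʳ g = +-cancelˡ (P g 0#) _ _ (trans (sym (+ʳ g 0# 0#))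
      (trans (cong₂ K.refl (+-identityʳ 0#)) (sym (+-identityʳ _))))

    minusˡ : ∀ g h x → P (g K.- h) x ≈ P g x - P h x
    minusˡ g h x = +-cancelʳ (P h x) _ _ (begin
      P (g K.- h) x + P h x    ≈⟨ +ˡ _ _ x ⟨
      P (g K.- h K.+ h) x      ≈⟨ cong₂ (K.solve 2 (λ g h → g K.:- h K.:+ h K.:= g) K.refl g h) refl ⟩
      P g x                    ≈⟨ solve 2 (λ a b → a := a :- b :+ b) refl (P g x) (P h x) ⟩
      P g x - P h x + P h x    ∎)

    minusʳ : ∀ g x y → P g (x - y) ≈ P g x - P g y
    minusʳ g x y = +-cancelʳ (P g y) _ _ (begin
      P g (x - y) + P g y      ≈⟨ +ʳ g _ y ⟨
      P g (x - y + y)          ≈⟨ cong₂ K.refl (solve 2 (λ x y → x :- y :+ y := x) refl x y) ⟩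
      P g x                    ≈⟨ solve 2 (λ a b → a := a :- b :+ b) refl (P g x) (P g y) ⟩
      P g x - P g y + P g y    ∎)

  record SubgroupPred (W : K.Carrier → Set ℓ) : Set (c ⊔ ℓ) where
    field
      resp  : ∀ {g h} → g K.≈ h → W g → W h
      minus : ∀ {g h} → W g → W h → W (g K.- h)

    0∈ : ∀ {g} → W g → W K.0#
    0∈ {g} Wg = resp (K.-‿inverseʳ g) (minus Wg Wg)

    plus : ∀ {g h} → W g → W h → W (g K.+ h)
    plus {g} {h} Wg Wh = resp (K.solve 2 (λ g h → g K.:- (K.:0 K.:- h) K.:= g K.:+ h) K.refl g h)
      (minus Wg (minus (0∈ Wh) Wh))

    shift : ∀ {g h} → W h → ¬ W g → ¬ W (g K.+ h)
    shift {g} {h} Wh ¬Wg Wgh =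
      ¬Wg (resp (K.solve 2 (λ g h → g K.:+ h K.:- h K.:= g) K.refl g h) (minus Wgh Wh))

  -- The action of g on the axis identified with E is x ↦ (P g x , Q g x); for g outside W
  -- it maps the axis to the graph of a semilinear map.
  module AxisAction
    {P Q : K.Carrier → Carrier → Carrier} (P-op : Operators P) (Q-op : Operators Q)
    (free : ∀ {g x} → g K.≉ K.0# → P g x ≈ 0# → Q g x ≈ 0# → x ≈ 0#)
    {W : K.Carrier → Set ℓ} (W-sub : SubgroupPred W)
    (graph : ∀ g → ¬ W g → ∃[ T ] (∀ x → Q g x ≈ to T (P g x)))
    {e s : K.Carrier} (e∈W : W e) (s∈W : W s) (s≉0 : s K.≉ K.0#) (e≉s : e K.≉ s)
    (P-e : ∀ x → P e x ≈ x) (Q-e : ∀ x → Q e x ≈ 0#) (Q-s : ∀ x → Q s x ≈ 0#)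
    where
    private
      module P = Operators P-op
      module Q = Operators Q-op
      module W = SubgroupPred W-sub

    P-injective : ∀ {g} → ¬ W g → ∀ {x y} → P g x ≈ P g y → x ≈ y
    P-injective {g} ¬Wg {x} {y} eq = x-y≈0⇒x≈y x y (free g≉0 Pz≈0 Qz≈0)
      where
      g≉0 : g K.≉ K.0#
      g≉0 g≈0 = ¬Wg (W.resp (K.sym g≈0) (W.0∈ e∈W))
      Pz≈0 : P g (x - y) ≈ 0#
      Pz≈0 = trans (P.minusʳ g x y) (x≈y⇒x-y≈0 eq)
      Qz≈0 : Q g (x - y) ≈ 0#
      Qz≈0 = let (T , Q≈) = graph g ¬Wg in
        trans (Q≈ _) (trans (to-cong T Pz≈0) (to-0 T))

    -- Adding e or s to g stays outside W and leaves Q g unchanged, while P g is shifted by the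
    -- identity or by P s. This yields the translates that `scalar-by-translates` asks for; `e≉s`
    -- keeps the two shifts apart at every nonzero point.
    scalar : ∀ g → ¬ W g → ∀ x → P g x ≈ P g 1# * x
    scalar g ¬Wg = scalar-by-translates
      (T g ¬Wg) (T g₁ ¬W₁) (T g₂ ¬W₂) (T gₛ ¬Wₛ) (T g₁ₛ ¬W₁ₛ) (P g) (P s)
      (P.cong₂ K.refl) (P-injective ¬Wg) (P.0ʳ g) (P.cong₂ K.refl)
      (λ x≉0 eq → x≉0 (free s≉0 eq (Q-s _)))
      (λ {x} x≉0 x≈ → x≉0 (free (λ eq → e≉s (K.x-y≈0⇒x≈y _ _ eq))
        (trans (P.minusˡ e s x) (trans (+-congʳ (P-e x)) (x≈y⇒x-y≈0 x≈)))
        (trans (Q.minusˡ e s x) (trans (+-cong (Q-e x) (-‿cong (Q-s x))) (-‿inverseʳ 0#)))))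
      (λ x → along g₁ ¬W₁ x (add-e g x) (keep g e Q-e x))
      (λ x → along g₂ ¬W₂ x (trans (add-e g₁ x) (+-congʳ (add-e g x)))
               (trans (keep g₁ e Q-e x) (keep g e Q-e x)))
      (λ x → along gₛ ¬Wₛ x (P.+ˡ g s x) (keep g s Q-s x))
      (λ x → along g₁ₛ ¬W₁ₛ x (trans (P.+ˡ g₁ s x) (+-congʳ (add-e g x)))
               (trans (keep g₁ s Q-s x) (keep g e Q-e x)))
      where
      T : ∀ g → ¬ W g → SL
      T g ¬Wg = proj₁ (graph g ¬Wg)
      g₁ = g K.+ e
      g₂ = g₁ K.+ e
      gₛ = g K.+ s
      g₁ₛ = g₁ K.+ s
      ¬W₁ = W.shift e∈W ¬Wg
      ¬W₂ = W.shift e∈W ¬W₁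
      ¬Wₛ = W.shift s∈W ¬Wg
      ¬W₁ₛ = W.shift s∈W ¬W₁
      add-e : ∀ g x → P (g K.+ e) x ≈ P g x + x
      add-e g x = trans (P.+ˡ g e x) (+-congˡ (P-e x))
      keep : ∀ g h → (∀ x → Q h x ≈ 0#) → ∀ x → Q (g K.+ h) x ≈ Q g x
      keep g h Qh≈0 x = trans (Q.+ˡ g h x) (trans (+-congˡ (Qh≈0 x)) (+-identityʳ _))
      along : ∀ h ¬Wh x {y} → P h x ≈ y → Q h x ≈ Q g x → to (T h ¬Wh) y ≈ to (T g ¬Wg) (P g x)
      along h ¬Wh x P≈ Q≈ = trans (to-cong (T h ¬Wh) (sym P≈))
        (trans (sym (proj₂ (graph h ¬Wh) x)) (trans Q≈ (proj₂ (graph g ¬Wg) x)))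

  multiple⇒Scalar : ∀ T m → (∀ y → to T y ≈ m * y) → Scalar T
  multiple⇒Scalar T m T≈ y = *-cancelˡ (to-1≉0 T) (begin
    to T 1# * χ (character T) y  ≈⟨ to-χ T y ⟨
    to T y                       ≈⟨ T≈ y ⟩
    m * y                        ≈⟨ *-congʳ (*-identityʳ m) ⟨
    m * 1# * y                   ≈⟨ *-congʳ (T≈ 1#) ⟨
    to T 1# * y                  ∎)

module AxisCases {c₁ ℓ₁ c₂ ℓ₂} (K : FiniteField c₁ ℓ₁) (E : FiniteField c₂ ℓ₂) where
  open TwoFields K E
  private
    module K = FieldTheory K
  open Semilinearity E
  open SL
  open import Relation.Binary.Reasoning.Setoid setoid

  -- The matrix of the acting element is (a 0 ; C D).
  one-moved-axis : ∀ (T : SL) {a} → a ≉ 0# → (C D : Carrier → Carrier) →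
    (∀ x → C x ≈ to T (a * x)) → (∀ {x y} → x ≈ y → D x ≈ D y) →
    ∀ (S₁ S₂ : SL) → from S₁ 1# ≉ from S₂ 1# →
    (∀ x → C x + D (to S₁ x) ≈ to S₁ (a * x)) → (∀ x → C x + D (to S₂ x) ≈ to S₂ (a * x)) → ⊥
  one-moved-axis T {a} a≉0 C D C≈ D-cong S₁ S₂ distinct fixed₁ fixed₂ = e≉0 e≈0
    where
    R : SL → SL
    R S = T ⊙ scaling a a≉0 ⊙ inverse S
    m : SL → Carrier
    m S = χ (character S) a
    D≈ : ∀ S → (∀ x → C x + D (to S x) ≈ to S (a * x)) → ∀ y → to (R S) y + D y ≈ m S * y
    D≈ S fixed y = begin
      to T (a * from S y) + D y              ≈⟨ +-cong (sym (C≈ _)) (D-cong (sym (to-from S y))) ⟩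
      C (from S y) + D (to S (from S y))     ≈⟨ fixed _ ⟩
      to S (a * from S y)                    ≈⟨ to-scale S a _ ⟩
      m S * to S (from S y)                  ≈⟨ *-congˡ (to-from S y) ⟩
      m S * y                                ∎
    e = m S₂ - m S₁
    -- Eliminating D from the two fixed graphs leaves a relation between R S₁, R S₂ and the
    -- identity.
    relation : ∀ y → to (R S₁) y + (e * y + - to (R S₂) y) ≈ 0#
    relation y = begin
      to (R S₁) y + (e * y + - to (R S₂) y)
        ≈⟨ solve 6 (λ r₁ r₂ m₁ m₂ y d → r₁ :+ ((m₂ :- m₁) :* y :- r₂) :=
             ((r₁ :+ d) :- m₁ :* y) :- ((r₂ :+ d) :- m₂ :* y)) refl
             (to (R S₁) y) (to (R S₂) y) (m S₁) (m S₂) y (D y) ⟩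
      (to (R S₁) y + D y - m S₁ * y) - (to (R S₂) y + D y - m S₂ * y)
        ≈⟨ +-cong (x≈y⇒x-y≈0 (D≈ S₁ fixed₁ y)) (-‿cong (x≈y⇒x-y≈0 (D≈ S₂ fixed₂ y))) ⟩
      0# - 0#
        ≈⟨ -‿inverseʳ 0# ⟩
      0# ∎
    e≉0 : e ≉ 0#
    e≉0 e≈0 = distinct (to-injective (T ⊙ scaling a a≉0) (x-y≈0⇒x≈y _ _ (begin
      to (R S₁) 1# - to (R S₂) 1#                  ≈⟨ +-congˡ (trans (sym (+-identityˡ _)) (+-congʳ (sym (trans (*-congʳ e≈0) (zeroˡ 1#))))) ⟩
      to (R S₁) 1# + (e * 1# + - to (R S₂) 1#)     ≈⟨ relation 1# ⟩
      0#                                           ∎)))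
    -r₂≉0 : - to (R S₂) 1# ≉ 0#
    -r₂≉0 eq = to-1≉0 (R S₂) (trans (solve 1 (λ x → x := :- (:- x)) refl _) (trans (-‿cong eq) -0#≈0#))
    neg-χ : ∀ y → - to (R S₂) y ≈ - to (R S₂) 1# * χ (character (R S₂)) y
    neg-χ y = trans (-‿cong (to-χ (R S₂) y)) (-‿distribˡ-* _ _)
    scalar₁ : Scalar (R S₁)
    scalar₁ = all-equal₃ _ (character (R S₁)) _ trivial _ (character (R S₂))
      (to-1≉0 (R S₁)) e≉0 -r₂≉0
      (λ y → trans (+-cong (sym (to-χ (R S₁) y)) (+-congˡ (sym (neg-χ y)))) (relation y))
    scalar₂ : Scalar (R S₂)
    scalar₂ = all-equal₃ _ (character (R S₂)) _ trivial _ (character (R S₁))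
      -r₂≉0 e≉0 (to-1≉0 (R S₁))
      (λ y → trans (+-cong (sym (neg-χ y)) (+-congˡ (sym (to-χ (R S₁) y))))
        (trans (solve 3 (λ u v w → u :+ (v :+ w) := w :+ (v :+ u)) refl _ _ _) (relation y)))
    proportional : ∀ S → Scalar (R S) → ∀ x → to T (a * x) ≈ to (R S) 1# * to S x
    proportional S scalar x = begin
      to T (a * x)                        ≈⟨ to-cong T (*-congˡ (from-to S x)) ⟨
      to T (a * from S (to S x))          ≈⟨ to-Scalar (R S) scalar (to S x) ⟩
      to (R S) 1# * to S x                ∎
    -- Once R S is scalar, S is proportional to x ↦ T (a x), so its multiplier m S is the quotient
    -- of T (a a) by T a and no longer depends on S.
    m≈ : ∀ S → Scalar (R S) → to T (a * a) ≈ m S * to T (a * 1#)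
    m≈ S scalar = begin
      to T (a * a)                        ≈⟨ proportional S scalar a ⟩
      to (R S) 1# * to S a                ≈⟨ *-congˡ (to-χ S a) ⟩
      to (R S) 1# * (to S 1# * m S)       ≈⟨ solve 3 (λ r s m → r :* (s :* m) := m :* (r :* s)) refl _ _ _ ⟩
      m S * (to (R S) 1# * to S 1#)       ≈⟨ *-congˡ (proportional S scalar 1#) ⟨
      m S * to T (a * 1#)                 ∎
    e≈0 : e ≈ 0#
    e≈0 = x≈y⇒x-y≈0 (*-cancelʳ (to-nonZero T (*-nonZero a≉0 1≉0))
      (trans (sym (m≈ S₂ scalar₂)) (m≈ S₁ scalar₁)))

  -- The second axis is identified with the first so that k (x , 0) = (0 , x). The matrix of g then
  -- has the columns (A g , C g) and (A (g k) , C (g k)), so A and C determine the whole action.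
  module TwoMovedAxes
    (orders : K.order ≡ order)
    {A C : K.Carrier → Carrier → Carrier} (A-op : Operators A) (C-op : Operators C)
    (k : K.Carrier)
    (A-1 : ∀ x → A K.1# x ≈ x) (C-1 : ∀ x → C K.1# x ≈ 0#)
    (A-k : ∀ x → A k x ≈ 0#) (C-k : ∀ x → C k x ≈ x)
    (A-* : ∀ g h x → A (g K.* h) x ≈ A g (A h x) + A (g K.* k) (C h x))
    (C-* : ∀ g h x → C (g K.* h) x ≈ C g (A h x) + C (g K.* k) (C h x))
    (free : ∀ {g x} → g K.≉ K.0# → A g x ≈ 0# → C g x ≈ 0# → x ≈ 0#)
    {W : K.Carrier → Set ℓ₁} (W-sub : SubgroupPred W) (W? : ∀ g → Dec (W g))
    {t : K.Carrier} (t≉0 : t K.≉ K.0#) (t≉1 : t K.≉ K.1#)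
    (C-t : ∀ x → C t x ≈ 0#) (A-kt : ∀ x → A (k K.* t) x ≈ 0#)
    (1∈W : W K.1#) (t∈W : W t) (k∈W : W k) (kt∈W : W (k K.* t))
    (graph : ∀ g → ¬ W g → ∃[ T ] (∀ x → C g x ≈ to T (A g x)))
    (axis-stabilizer : ∀ g → (∀ x → C g x ≈ 0#) → W g × W (k K.* g))
    {g′ : K.Carrier} (g′∉W : ¬ W g′)
    (S : Fin 3 → SL) (S-distinct : ∀ {i j} → to (S i) 1# ≈ to (S j) 1# → i ≡ j)
    (S-fixed : ∀ i g x → to (S i) (A g x + A (g K.* k) (to (S i) x)) ≈ C g x + C (g K.* k) (to (S i) x))
    where
    private
      module A = Operators A-op
      module C = Operators C-op
      module W = SubgroupPred W-sub

    k≉0 : k K.≉ K.0#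
    k≉0 k≈0 = 1≉0 (begin
      1#               ≈⟨ C-k 1# ⟨
      C k 1#           ≈⟨ C.cong₂ (K.trans k≈0 (K.sym (K.-‿inverseʳ k))) refl ⟩
      C (k K.- k) 1#   ≈⟨ C.minusˡ k k 1# ⟩
      C k 1# - C k 1#  ≈⟨ -‿inverseʳ _ ⟩
      0#               ∎)

    private
      module First = AxisAction A-op C-op free W-sub graph 1∈W t∈W t≉0 (λ eq → t≉1 (K.sym eq)) A-1 C-1 C-t

      transposed-graph : ∀ g → ¬ W g → ∃[ T ] (∀ x → A g x ≈ to T (C g x))
      transposed-graph g ¬Wg = let (T , C≈) = graph g ¬Wg in
        inverse T , λ x → trans (sym (from-to T _)) (from-cong T (sym (C≈ x)))

      -- The same argument with the coordinates exchanged: k and k t take the parts of 1 and t, as C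
      -- k is the identity and A vanishes on both.
      module Second = AxisAction C-op A-op (λ g≉0 Cx Ax → free g≉0 Ax Cx) W-sub transposed-graph
        k∈W kt∈W (K.*-nonZero k≉0 t≉0)
        (λ k≈kt → t≉1 (K.*-cancelˡ k≉0 (K.trans (K.sym k≈kt) (K.sym (K.*-identityʳ k)))))
        C-k A-k A-kt

      -- For g in W the sum g′ + g lies outside W, and P is additive in its first argument, so
      -- scalarity passes from the outside of W to all of K.
      extend : ∀ {P} → Operators P → (∀ g → ¬ W g → ∀ x → P g x ≈ P g 1# * x) →
               ∀ g x → P g x ≈ P g 1# * x
      extend {P} P-op scalar g x with W? g
      ... | no ¬Wg = scalar g ¬Wg x
      ... | yes Wg = +-cancelˡ (P g′ x) _ _ (begin
        P g′ x + P g x               ≈⟨ P.+ˡ g′ g x ⟨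
        P (g′ K.+ g) x               ≈⟨ scalar _ (W.shift Wg g′∉W) x ⟩
        P (g′ K.+ g) 1# * x          ≈⟨ *-congʳ (P.+ˡ g′ g 1#) ⟩
        (P g′ 1# + P g 1#) * x       ≈⟨ distribʳ _ _ _ ⟩
        P g′ 1# * x + P g 1# * x     ≈⟨ +-congʳ (scalar g′ g′∉W x) ⟨
        P g′ x + P g 1# * x          ∎)
        where module P = Operators P-op

    a c : K.Carrier → Carrier
    a g = A g 1#
    c g = C g 1#

    A≈ : ∀ g x → A g x ≈ a g * x
    A≈ = extend A-op First.scalar

    C≈ : ∀ g x → C g x ≈ c g * x
    C≈ = extend C-op Second.scalar

    a-cong : ∀ {g h} → g K.≈ h → a g ≈ a h
    a-cong eq = A.cong₂ eq refl
    c-cong : ∀ {g h} → g K.≈ h → c g ≈ c h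
    c-cong eq = C.cong₂ eq refl

    b d : Carrier
    b = a (k K.* k)
    d = c (k K.* k)

    -- The vector k (x , S x) = (b S x , x + d S x) must lie on the graph of S again.
    S-fixed-k : ∀ i x → to (S i) (b * to (S i) x) ≈ x + d * to (S i) x
    S-fixed-k i x = begin
      to (S i) (b * to (S i) x)
        ≈⟨ to-cong (S i) (trans (sym (A≈ _ _)) (trans (sym (+-identityˡ _)) (+-congʳ (sym (A-k x))))) ⟩
      to (S i) (A k x + A (k K.* k) (to (S i) x))
        ≈⟨ S-fixed i k x ⟩
      C k x + C (k K.* k) (to (S i) x)
        ≈⟨ +-cong (C-k x) (C≈ _ _) ⟩
      x + d * to (S i) x ∎

    quadratic : ∀ i → Scalar (S i) → b * (to (S i) 1# * to (S i) 1#) ≈ 1# + d * to (S i) 1#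
    quadratic i scalar = begin
      b * (s * s)            ≈⟨ solve 2 (λ b s → b :* (s :* s) := s :* (b :* s)) refl b s ⟩
      s * (b * s)            ≈⟨ to-Scalar (S i) scalar _ ⟨
      to (S i) (b * s)       ≈⟨ S-fixed-k i 1# ⟩
      1# + d * s             ∎
      where s = to (S i) 1#

    -- A scalar fixed graph has a slope s with b s ^ 2 = 1 + d s. Three distinct solutions force b =
    -- d = 0 and then 1 = 0; this is what the third fixed graph is for.
    nonScalar : ∃[ i ] ¬ Scalar (S i)
    nonScalar with ≈χ? (character (S 0F)) trivial | ≈χ? (character (S 1F)) trivial
                 | ≈χ? (character (S 2F)) trivial
    ... | no ¬p | _ | _ = 0F , ¬p
    ... | _ | no ¬p | _ = 1F , ¬p
    ... | _ | _ | no ¬p = 2F , ¬p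
    ... | yes p₀ | yes p₁ | yes p₂ = contradiction (begin
        1#                                  ≈⟨ solve 2 (λ d s → :1 := :1 :+ d :* s :- d :* s) refl d s₀ ⟩
        1# + d * s₀ - d * s₀                ≈⟨ +-cong (sym (quadratic 0F p₀)) (-‿cong (*-congʳ d≈0)) ⟩
        b * (s₀ * s₀) - 0# * s₀             ≈⟨ +-congʳ (*-congʳ b≈0) ⟩
        0# * (s₀ * s₀) - 0# * s₀            ≈⟨ solve 1 (λ s → :0 :* (s :* s) :- :0 :* s := :0) refl s₀ ⟩
        0#                                  ∎) 1≉0
      where
      s₀ = to (S 0F) 1#
      s₁ = to (S 1F) 1#
      s₂ = to (S 2F) 1#
      difference : ∀ {s s′} → s ≉ s′ → b * (s * s) ≈ 1# + d * s → b * (s′ * s′) ≈ 1# + d * s′ →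
                   b * (s + s′) ≈ d
      difference {s} {s′} s≉s′ eq eq′ = *-cancelʳ (λ e → s≉s′ (x-y≈0⇒x≈y s s′ e)) (begin
        b * (s + s′) * (s - s′)                   ≈⟨ solve 3 (λ b s s′ → b :* (s :+ s′) :* (s :- s′) :=
                                                       b :* (s :* s) :- b :* (s′ :* s′)) refl b s s′ ⟩
        b * (s * s) - b * (s′ * s′)               ≈⟨ +-cong eq (-‿cong eq′) ⟩
        1# + d * s - (1# + d * s′)                ≈⟨ solve 3 (λ d s s′ → (:1 :+ d :* s) :- (:1 :+ d :* s′) :=
                                                       d :* (s :- s′)) refl d s s′ ⟩
        d * (s - s′)                              ∎)
      distinct : ∀ {i j} → ¬ i ≡ j → to (S i) 1# ≉ to (S j) 1#
      distinct i≢j eq = i≢j (S-distinct eq)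
      d₁ = difference (distinct {0F} {1F} λ ()) (quadratic 0F p₀) (quadratic 1F p₁)
      d₂ = difference (distinct {0F} {2F} λ ()) (quadratic 0F p₀) (quadratic 2F p₂)
      b≈0 : b ≈ 0#
      b≈0 = integralʳ (λ e → distinct {1F} {2F} (λ ()) (x-y≈0⇒x≈y s₁ s₂ e)) (begin
        b * (s₁ - s₂)                       ≈⟨ solve 4 (λ b s₀ s₁ s₂ → b :* (s₁ :- s₂) :=
                                                 b :* (s₀ :+ s₁) :- b :* (s₀ :+ s₂)) refl b s₀ s₁ s₂ ⟩
        b * (s₀ + s₁) - b * (s₀ + s₂)       ≈⟨ x≈y⇒x-y≈0 (trans d₁ (sym d₂)) ⟩
        0#                                  ∎)
      d≈0 : d ≈ 0#
      d≈0 = trans (sym d₁) (trans (*-congʳ b≈0) (zeroˡ _))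

    private
      i = proj₁ nonScalar
      Σ = S i
      Σ-nonScalar : ¬ Scalar Σ
      Σ-nonScalar = proj₂ nonScalar
      θ : Carrier → Carrier
      θ = χ (character Σ)
      σ = to Σ 1#

    Σ²-relation : ∀ x → θ b * to Σ (to Σ x) ≈ x + d * to Σ x
    Σ²-relation x = trans (sym (to-scale Σ b _)) (S-fixed-k i x)

    -- In θ b Σ (Σ x) = x + d Σ x the character of Σ is isolated: it is not trivial, and if it were
    -- the character of Σ², then Σ = Σ² Σ⁻¹ would be scalar.
    d≈0 : d ≈ 0#
    d≈0 = integralʳ (to-1≉0 Σ) (isolated₃ (d * σ) (character Σ) 1# trivial
        (- (θ b * to (Σ ⊙ Σ) 1#)) (character (Σ ⊙ Σ))
        (λ x → begin
          d * σ * θ x + (1# * x + - (θ b * to (Σ ⊙ Σ) 1#) * χ (character (Σ ⊙ Σ)) x)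
            ≈⟨ solve 6 (λ d s h x b′ w → d :* s :* h :+ (:1 :* x :+ w) :=
                 (x :+ d :* (s :* h)) :+ w) refl d σ (θ x) x b (- (θ b * to (Σ ⊙ Σ) 1#) * χ (character (Σ ⊙ Σ)) x) ⟩
          (x + d * (σ * θ x)) + - (θ b * to (Σ ⊙ Σ) 1#) * χ (character (Σ ⊙ Σ)) x
            ≈⟨ +-cong (+-congˡ (*-congˡ (sym (to-χ Σ x)))) (trans (sym (-‿distribˡ-* _ _))
                 (-‿cong (trans (*-assoc _ _ _) (*-congˡ (sym (to-χ (Σ ⊙ Σ) x)))))) ⟩
          (x + d * to Σ x) - θ b * to Σ (to Σ x)
            ≈⟨ x≈y⇒x-y≈0 (sym (Σ²-relation x)) ⟩
          0# ∎)
        Σ-nonScalar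
        (λ θ≈ → Σ-nonScalar (multiple⇒Scalar Σ (to Σ σ * σ ⁻¹) (λ y → begin
          to Σ y                                      ≈⟨ to-cong Σ (to-from Σ y) ⟨
          to (Σ ⊙ Σ) (from Σ y)                       ≈⟨ to-χ (Σ ⊙ Σ) _ ⟩
          to Σ σ * χ (character (Σ ⊙ Σ)) (from Σ y)   ≈⟨ *-congˡ (θ≈ (from Σ y)) ⟨
          to Σ σ * (to Σ (from Σ y) * σ ⁻¹)           ≈⟨ *-congˡ (*-congʳ (to-from Σ y)) ⟩
          to Σ σ * (y * σ ⁻¹)                         ≈⟨ solve 3 (λ p y q → p :* (y :* q) := p :* q :* y) refl (to Σ σ) y (σ ⁻¹) ⟩
          to Σ σ * σ ⁻¹ * y                           ∎))))

    k*g : ∀ g → a (k K.* g) ≈ b * c g × c (k K.* g) ≈ a g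
    k*g g = (begin
        a (k K.* g)                              ≈⟨ A-* k g 1# ⟩
        A k (A g 1#) + A (k K.* k) (C g 1#)      ≈⟨ +-cong (A-k _) (A≈ _ _) ⟩
        0# + b * c g                             ≈⟨ +-identityˡ _ ⟩
        b * c g                                  ∎) , (begin
        c (k K.* g)                              ≈⟨ C-* k g 1# ⟩
        C k (A g 1#) + C (k K.* k) (C g 1#)      ≈⟨ +-cong (C-k _) (C≈ _ _) ⟩
        a g + d * c g                            ≈⟨ +-congˡ (trans (*-congʳ d≈0) (zeroˡ _)) ⟩
        a g + 0#                                 ≈⟨ +-identityʳ _ ⟩
        a g                                      ∎)

    -- Invariance of the graph of Σ under g becomes a relation between the identity and θ with
    -- coefficients θ (c g) - c g and (θ (a g) - a g) σ. As θ is nontrivial, both vanish.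
    fixed-coefficients : ∀ g → θ (a g) ≈ a g × θ (c g) ≈ c g
    fixed-coefficients g =
        x-y≈0⇒x≈y _ _ (integralʳ (to-1≉0 Σ) (two-characters _ (character Σ) _ trivial
          (λ x → trans (+-comm _ _) (relation x)) Σ-nonScalar))
      , x-y≈0⇒x≈y _ _ (two-characters _ trivial _ (character Σ) relation
          (λ e → Σ-nonScalar (≈χ-sym {trivial} {character Σ} e)))
      where
      expanded : ∀ x → θ (a g) * to Σ x + θ (c g) * x ≈ c g * x + a g * to Σ x
      expanded x = begin
        θ (a g) * to Σ x + θ (c g) * x
          ≈⟨ +-congˡ (*-congˡ (trans (sym (+-identityʳ x)) (trans (+-congˡ (sym (trans (*-congʳ d≈0) (zeroˡ _))))
               (sym (Σ²-relation x))))) ⟩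
        θ (a g) * to Σ x + θ (c g) * (θ b * to Σ (to Σ x))
          ≈⟨ +-cong (to-scale Σ _ _) (trans (to-scale Σ _ _) (*-congˡ (to-scale Σ _ _))) ⟨
        to Σ (a g * x) + to Σ (c g * (b * to Σ x))
          ≈⟨ to-+ Σ _ _ ⟨
        to Σ (a g * x + c g * (b * to Σ x))
          ≈⟨ to-cong Σ (+-cong (sym (A≈ g x)) (begin
               c g * (b * to Σ x)       ≈⟨ solve 3 (λ c b s → c :* (b :* s) := b :* c :* s) refl (c g) b (to Σ x) ⟩
               b * c g * to Σ x         ≈⟨ *-congʳ (proj₁ (k*g g)) ⟨
               a (k K.* g) * to Σ x     ≈⟨ *-congʳ (a-cong (K.*-comm k g)) ⟩
               a (g K.* k) * to Σ x     ≈⟨ A≈ _ _ ⟨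
               A (g K.* k) (to Σ x)     ∎)) ⟩
        to Σ (A g x + A (g K.* k) (to Σ x))
          ≈⟨ S-fixed i g x ⟩
        C g x + C (g K.* k) (to Σ x)
          ≈⟨ +-cong (C≈ g x) (begin
               C (g K.* k) (to Σ x)     ≈⟨ C≈ _ _ ⟩
               c (g K.* k) * to Σ x     ≈⟨ *-congʳ (c-cong (K.*-comm k g)) ⟨
               c (k K.* g) * to Σ x     ≈⟨ *-congʳ (proj₂ (k*g g)) ⟩
               a g * to Σ x             ∎) ⟩
        c g * x + a g * to Σ x ∎
      relation : ∀ x → (θ (c g) - c g) * x + (θ (a g) - a g) * σ * θ x ≈ 0#
      relation x = begin
        (θ (c g) - c g) * x + (θ (a g) - a g) * σ * θ x
          ≈⟨ +-congˡ (trans (*-assoc _ _ _) (*-congˡ (sym (to-χ Σ x)))) ⟩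
        (θ (c g) - c g) * x + (θ (a g) - a g) * to Σ x
          ≈⟨ solve 6 (λ c′ c x a′ a s → (c′ :- c) :* x :+ (a′ :- a) :* s :=
               (a′ :* s :+ c′ :* x) :- (c :* x :+ a :* s)) refl (θ (c g)) (c g) x (θ (a g)) (a g) (to Σ x) ⟩
        (θ (a g) * to Σ x + θ (c g) * x) - (c g * x + a g * to Σ x)
          ≈⟨ x≈y⇒x-y≈0 (expanded x) ⟩
        0# ∎

    determined : ∀ {g h} → a g ≈ a h → c g ≈ c h → g K.≈ h
    determined {g} {h} a≈ c≈ with g K.- h K.≟ K.0#
    ... | yes eq = K.x-y≈0⇒x≈y g h eq
    ... | no g-h≉0 = contradiction (free g-h≉0
      (trans (A.minusˡ g h 1#) (x≈y⇒x-y≈0 a≈)) (trans (C.minusˡ g h 1#) (x≈y⇒x-y≈0 c≈))) 1≉0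

    χ-minus : ∀ x y → θ (x - y) ≈ θ x - θ y
    χ-minus x y = +-cancelʳ (θ y) _ _ (begin
      θ (x - y) + θ y                  ≈⟨ distribʳ (σ ⁻¹) (to Σ (x - y)) (to Σ y) ⟨
      (to Σ (x - y) + to Σ y) * σ ⁻¹   ≈⟨ *-congʳ (to-+ Σ (x - y) y) ⟨
      θ (x - y + y)                    ≈⟨ χ-cong (character Σ) (solve 2 (λ x y → x :- y :+ y := x) refl x y) ⟩
      θ x                              ≈⟨ solve 2 (λ x y → x := x :- y :+ y) refl (θ x) (θ y) ⟩
      θ x - θ y + θ y                  ∎)

    private
      u = proj₁ (differ (character Σ) trivial Σ-nonScalar)
      θu≉u : θ u ≉ u
      θu≉u = proj₂ (differ (character Σ) trivial Σ-nonScalar)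

    -- 1 and u are independent over the fixed field of θ: applying θ to u r = q - p and subtracting
    -- gives (θ u - u) r = 0.
    coordinates : ∀ p q r → θ p ≈ p → θ q ≈ q → θ r ≈ r → p + u * r ≈ q → p ≈ q × r ≈ 0#
    coordinates p q r θp θq θr eq = trans (sym p+ur≈p) eq , r≈0
      where
      ur≈ : u * r ≈ q - p
      ur≈ = trans (solve 3 (λ u r p → u :* r := (p :+ u :* r) :- p) refl u r p) (+-congʳ eq)
      r≈0 : r ≈ 0#
      r≈0 = integralˡ (λ e → θu≉u (x-y≈0⇒x≈y (θ u) u e)) (begin
        (θ u - u) * r            ≈⟨ solve 3 (λ v u r → (v :- u) :* r := v :* r :- u :* r) refl (θ u) u r ⟩
        θ u * r - u * r          ≈⟨ +-cong (*-congˡ (sym θr)) (-‿cong ur≈) ⟩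
        θ u * θ r - (q - p)      ≈⟨ +-congʳ (χ-* (character Σ) u r) ⟨
        θ (u * r) - (q - p)      ≈⟨ +-cong (χ-cong (character Σ) ur≈) (-‿cong (+-cong (sym θq) (-‿cong (sym θp)))) ⟩
        θ (q - p) - (θ q - θ p)  ≈⟨ x≈y⇒x-y≈0 (χ-minus q p) ⟩
        0#                       ∎)
      p+ur≈p : p + u * r ≈ p
      p+ur≈p = trans (+-congˡ (trans (*-congˡ r≈0) (zeroʳ u))) (+-identityʳ p)

    φ : K.Carrier → Carrier
    φ g = a g + u * c g

    φ-injective : ∀ {g h} → φ g ≈ φ h → g K.≈ h
    φ-injective {g} {h} eq = determined
      (x-y≈0⇒x≈y (a g) (a h) (trans (sym (A.minusˡ g h 1#)) (proj₁ parts)))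
      (x-y≈0⇒x≈y (c g) (c h) (trans (sym (C.minusˡ g h 1#)) (proj₂ parts)))
      where
      fixed : θ (a (g K.- h)) ≈ a (g K.- h) × θ (c (g K.- h)) ≈ c (g K.- h)
      fixed = fixed-coefficients (g K.- h)
      parts : a (g K.- h) ≈ 0# × c (g K.- h) ≈ 0#
      parts = coordinates (a (g K.- h)) 0# (c (g K.- h))
        (proj₁ fixed) (trans (*-congʳ (to-0 Σ)) (zeroˡ (σ ⁻¹))) (proj₂ fixed) (begin
          a (g K.- h) + u * c (g K.- h)   ≈⟨ +-cong (A.minusˡ g h 1#) (*-congˡ (C.minusˡ g h 1#)) ⟩
          (a g - a h) + u * (c g - c h)   ≈⟨ solve 5 (λ p q u r s → (p :- q) :+ u :* (r :- s) :=
                                               (p :+ u :* r) :- (q :+ u :* s)) refl (a g) (a h) u (c g) (c h) ⟩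
          φ g - φ h                       ≈⟨ x≈y⇒x-y≈0 eq ⟩
          0#                              ∎)

    -- φ is an injection between sets of equal size, hence hits y; comparing coordinates over the
    -- fixed field then gives c g = 0.
    preimage : ∀ y → θ y ≈ y → ∃[ g ] (a g ≈ y × c g ≈ 0#)
    preimage y θy = g , coordinates (a g) y (c g) (proj₁ (fixed-coefficients g)) θy
                          (proj₂ (fixed-coefficients g)) (proj₂ found)
      where
      found : ∃[ g ] φ g ≈ y
      found = injective⇒surjectiveᴷ orders {φ} φ-injective y
      g = proj₁ found

    stable : ∀ g → c g ≈ 0# → W g × W (k K.* g)
    stable g c≈0 = axis-stabilizer g (λ x → trans (C≈ g x) (trans (*-congʳ c≈0) (zeroˡ x)))

    -- θ acts nontrivially, and a g, c g lie in its fixed field; so g ↦ a g + u c g is a bijection,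
    -- and g′ is the sum of an element with c = 0 and one with a = 0.
    impossible : ⊥
    impossible = conclude (preimage (a g′) (proj₁ (fixed-coefficients g′)))
                          (preimage (c g′) (proj₂ (fixed-coefficients g′)))
     where
     conclude : ∃[ g₁ ] (a g₁ ≈ a g′ × c g₁ ≈ 0#) → ∃[ g₂ ] (a g₂ ≈ c g′ × c g₂ ≈ 0#) → ⊥
     conclude (g₁ , a₁≈ , c₁≈0) (g₂ , a₂≈ , c₂≈0) =
      g′∉W (W.resp (determined a″≈ c″≈) (W.plus (proj₁ (stable g₁ c₁≈0)) (proj₂ (stable g₂ c₂≈0))))
      where
      a″≈ : a (g₁ K.+ k K.* g₂) ≈ a g′
      a″≈ = begin
        a (g₁ K.+ k K.* g₂)        ≈⟨ A.+ˡ g₁ (k K.* g₂) 1# ⟩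
        a g₁ + a (k K.* g₂)        ≈⟨ +-cong a₁≈ (proj₁ (k*g g₂)) ⟩
        a g′ + b * c g₂            ≈⟨ +-congˡ (trans (*-congˡ c₂≈0) (zeroʳ b)) ⟩
        a g′ + 0#                  ≈⟨ +-identityʳ (a g′) ⟩
        a g′                       ∎
      c″≈ : c (g₁ K.+ k K.* g₂) ≈ c g′
      c″≈ = begin
        c (g₁ K.+ k K.* g₂)        ≈⟨ C.+ˡ g₁ (k K.* g₂) 1# ⟩
        c g₁ + c (k K.* g₂)        ≈⟨ +-cong c₁≈0 (proj₂ (k*g g₂)) ⟩
        0# + a g₂                  ≈⟨ +-identityˡ (a g₂) ⟩
        a g₂                       ≈⟨ a₂≈ ⟩
        c g′                       ∎

-- Coordinates on the translation plane

module AbelianGroupIdentities {a ℓ} (G : AbelianGroup a ℓ) where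
  open AbelianGroup G renaming (_∙_ to _+_; _⁻¹ to infix 8 -_; ε to 0#; ∙-cong to +-cong;
    ∙-congˡ to +-congˡ; ∙-congʳ to +-congʳ; ⁻¹-cong to -‿cong)
  open import Algebra.Properties.AbelianGroup G
  open import Relation.Binary.Reasoning.Setoid setoid

  -0≈0 : - 0# ≈ 0#
  -0≈0 = ε⁻¹≈ε

  minus-zero : ∀ a → a + - 0# ≈ a
  minus-zero a = trans (+-congˡ -0≈0) (identityʳ a)

  minus-cancel : ∀ a b → a + - b + b ≈ a
  minus-cancel a b = trans (assoc a (- b) b) (trans (+-congˡ (inverseˡ b)) (identityʳ a))

  plus-cancel : ∀ a b → a + b + - a ≈ b
  plus-cancel = xyx⁻¹≈y

  plus-minus : ∀ a b → a + (b + - a) ≈ b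
  plus-minus a b = trans (sym (assoc a b (- a))) (plus-cancel a b)

  difference-of-differences : ∀ a b c → (a + - c) + - (b + - c) ≈ a + - b
  difference-of-differences a b c = begin
    (a + - c) + - (b + - c)       ≈⟨ +-congˡ (⁻¹-∙-comm b (- c)) ⟨
    (a + - c) + (- b + - - c)     ≈⟨ +-congˡ (trans (comm _ _) (+-congʳ (⁻¹-involutive c))) ⟩
    (a + - c) + (c + - b)         ≈⟨ assoc _ _ _ ⟨
    a + - c + c + - b             ≈⟨ +-congʳ (minus-cancel a c) ⟩
    a + - b                       ∎

  minus≈0 : ∀ {a b} → a + - b ≈ 0# → a ≈ b
  minus≈0 = x∙y⁻¹≈ε⇒x≈y _ _

  swap-minus : ∀ a b c → (a + - b) + - c ≈ (a + - c) + - b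
  swap-minus a b c = trans (assoc _ _ _) (trans (+-congˡ (comm _ _)) (sym (assoc _ _ _)))

module Coordinatization {c ℓ c′ ℓ′} (K : FiniteField c ℓ)
  (f : FiniteField.Carrier K → FiniteField.Carrier K)
  (f-cong : ∀ {x y} → FiniteField._≈_ K x y → FiniteField._≈_ K (f x) (f y))
  (f-+ : ∀ x y → FiniteField._≈_ K (f (FiniteField._+_ K x y)) (FiniteField._+_ K (f x) (f y)))
  (S : GeneralizedAndréSystem c′ ℓ′)
  (isomorphism : 𝒜 K f ≅ GeneralizedAndréSystem.plane S) where

  private
    module K = FieldTheory K
    module S = GeneralizedAndréSystem S
    module E = FieldTheory S.F
    module V = LeftModule (F² K)
    module P = LeftModule (F² S.F)
    module VG = AbelianGroupIdentities V.+ᴹ-abelianGroup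
    module PG = AbelianGroupIdentities P.+ᴹ-abelianGroup
    module iso = _≅_ isomorphism
    module bij = Inverse iso.bijection
    module Q = IsQuasifield S.isQuasifield

  infixl 6 _-ᴷ_ _-ᴱ_
  _-ᴷ_ : V.Carrierᴹ → V.Carrierᴹ → V.Carrierᴹ
  u -ᴷ v = u V.+ᴹ V.-ᴹ v
  _-ᴱ_ : P.Carrierᴹ → P.Carrierᴹ → P.Carrierᴹ
  x -ᴱ y = x P.+ᴹ P.-ᴹ y

  -ᴱ-cong : ∀ {u v u′ v′} → u P.≈ᴹ u′ → v P.≈ᴹ v′ → u -ᴱ v P.≈ᴹ u′ -ᴱ v′
  -ᴱ-cong p q = P.+ᴹ-cong p (P.-ᴹ‿cong q)

  ∘-+ : ∀ m x y → (x E.+ y) S.∘ m E.≈ x S.∘ m E.+ y S.∘ m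
  ∘-+ = Q.∘-distribʳ

  ∘-congʳ : ∀ {m x y} → x E.≈ y → x S.∘ m E.≈ y S.∘ m
  ∘-congʳ eq = Q.∘-cong eq E.refl

  0∘ : ∀ m → E.0# S.∘ m E.≈ E.0#
  0∘ m = E.+-cancelˡ (E.0# S.∘ m) _ _ (E.trans (E.sym (∘-+ m E.0# E.0#))
    (E.trans (∘-congʳ (E.+-identityʳ E.0#)) (E.sym (E.+-identityʳ _))))

  ∘-minus : ∀ m x y → (x E.- y) S.∘ m E.≈ x S.∘ m E.- y S.∘ m
  ∘-minus m x y = E.+-cancelʳ (y S.∘ m) _ _ (E.trans (E.sym (∘-+ m _ y))
    (E.trans (∘-congʳ (E.solve 2 (λ x y → x E.:- y E.:+ y E.:= x) E.refl x y))
      (E.solve 2 (λ a b → a E.:= a E.:- b E.:+ b) E.refl (x S.∘ m) (y S.∘ m))))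

  data Slope : Set c′ where
    ∞   : Slope
    [_] : E.Carrier → Slope

  ray : Slope → Pred P.Carrierᴹ ℓ′
  ray ∞     (x , y) = x E.≈ E.0#
  ray [ m ] (x , y) = y E.≈ x S.∘ m

  ray? : ∀ s p → Dec (ray s p)
  ray? ∞     (x , y) = x E.≟ E.0#
  ray? [ m ] (x , y) = y E.≟ x S.∘ m

  ray-resp : ∀ s {p q} → p P.≈ᴹ q → ray s p → ray s q
  ray-resp ∞     (x≈ , y≈) r = E.trans (E.sym x≈) r
  ray-resp [ m ] (x≈ , y≈) r = E.trans (E.sym y≈) (E.trans r (∘-congʳ x≈))

  ray-0 : ∀ s → ray s P.0ᴹ
  ray-0 ∞     = E.refl
  ray-0 [ m ] = E.sym (0∘ m)

  ray-minus : ∀ s {p q} → ray s p → ray s q → ray s (p -ᴱ q)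
  ray-minus ∞     r r′ = E.x≈y⇒x-y≈0 (E.trans r (E.sym r′))
  ray-minus [ m ] r r′ = E.trans (E.+-cong r (E.-‿cong r′)) (E.sym (∘-minus m _ _))

  data Comparison (s s′ : Slope) : Set (c′ ⊔ ℓ′) where
    parallel  : (∀ {p} → ray s p → ray s′ p) → Comparison s s′
    crossing  : (∀ {p} → ray s p → ray s′ p → p P.≈ᴹ P.0ᴹ) →
                (∀ p q → ∃[ r ] (ray s (r -ᴱ p) × ray s′ (r -ᴱ q))) → Comparison s s′

  compare : ∀ s s′ → Comparison s s′
  compare ∞ ∞ = parallel λ r → r
  compare ∞ [ m ] = crossing
    (λ { {x , y} x≈0 y≈ → x≈0 , E.trans y≈ (E.trans (∘-congʳ x≈0) (0∘ m)) })
    (λ (x , y) (x′ , y′) → (x , y′ E.+ (x E.- x′) S.∘ m)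
      , E.-‿inverseʳ x
      , E.solve 2 (λ y z → y E.:+ z E.:- y E.:= z) E.refl y′ ((x E.- x′) S.∘ m))
  compare [ m ] ∞ = crossing
    (λ { {x , y} y≈ x≈0 → x≈0 , E.trans y≈ (E.trans (∘-congʳ x≈0) (0∘ m)) })
    (λ (x′ , y′) (x , y) → (x , y′ E.+ (x E.- x′) S.∘ m)
      , E.solve 2 (λ y z → y E.:+ z E.:- y E.:= z) E.refl y′ ((x E.- x′) S.∘ m)
      , E.-‿inverseʳ x)
  compare [ m ] [ n ] with m E.≟ n
  ... | yes m≈n = parallel λ r → E.trans r (Q.∘-cong E.refl m≈n)
  ... | no  m≉n = crossing
    (λ { {x , y} y≈m y≈n → zero-only x y y≈m y≈n })
    meet
    where
    zero-only : ∀ x y → y E.≈ x S.∘ m → y E.≈ x S.∘ n → (x , y) P.≈ᴹ P.0ᴹ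
    zero-only x y y≈m y≈n with Q.planar m n E.0# m≉n
    ... | x₀ , _ , unique = x≈0 , E.trans y≈m (E.trans (∘-congʳ x≈0) (0∘ m))
      where
      x≈0 : x E.≈ E.0#
      x≈0 = E.trans (E.sym (unique (E.trans (E.sym y≈m) (E.trans y≈n (E.sym (E.+-identityʳ _))))))
        (unique (E.trans (0∘ m) (E.sym (E.trans (E.+-identityʳ _) (0∘ n)))))
    meet : ∀ p q → ∃[ r ] (ray [ m ] (r -ᴱ p) × ray [ n ] (r -ᴱ q))
    meet (x , y) (x′ , y′) with Q.planar m n ((y′ E.- x′ S.∘ n) E.- (y E.- x S.∘ m)) m≉n
    ... | x₀ , eq , _ = (x₀ , x₀ S.∘ m E.+ (y E.- x S.∘ m))
      , E.trans (E.solve 3 (λ a y b → a E.:+ (y E.:- b) E.:- y E.:= a E.:- b) E.refl (x₀ S.∘ m) y (x S.∘ m))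
                (E.sym (∘-minus m x₀ x))
      , E.trans (E.+-congʳ (E.+-congʳ eq))
          (E.trans (E.solve 5 (λ a y′ b y d → a E.:+ ((y′ E.:- b) E.:- (y E.:- d)) E.:+ (y E.:- d) E.:- y′ E.:= a E.:- b)
             E.refl (x₀ S.∘ n) y′ (x′ S.∘ n) y (x S.∘ m))
           (E.sym (∘-minus n x₀ x′)))

  slope-of : ∀ {Y} → Geometry.IsLine S.plane Y →
             ∃[ s ] (∀ {p} q → p ∈ Y → (q ∈ Y → ray s (q -ᴱ p)) × (ray s (q -ᴱ p) → q ∈ Y))
  slope-of (inj₁ (d , Y⊆ , ⊆Y)) = ∞ , λ (x , y) p∈Y →
      (λ q∈Y → E.x≈y⇒x-y≈0 (E.trans (Y⊆ q∈Y) (E.sym (Y⊆ p∈Y))))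
    , (λ r → ⊆Y (E.trans (E.x-y≈0⇒x≈y _ _ r) (Y⊆ p∈Y)))
  slope-of (inj₂ (m , b , Y⊆ , ⊆Y)) = [ m ] , λ { {x′ , y′} (x , y) p∈Y →
      (λ q∈Y → E.trans (E.+-cong (Y⊆ q∈Y) (E.-‿cong (Y⊆ p∈Y)))
        (E.trans (E.solve 3 (λ a b c → (a E.:+ b) E.:- (c E.:+ b) E.:= a E.:- c) E.refl (x S.∘ m) b (x′ S.∘ m))
          (E.sym (∘-minus m x x′))))
    , (λ r → ⊆Y (E.trans (E.solve 2 (λ y y′ → y E.:= y E.:- y′ E.:+ y′) E.refl y y′)
        (E.trans (E.+-cong (E.trans r (∘-minus m x x′)) (Y⊆ p∈Y))
          (E.solve 3 (λ a b c → (a E.:- c) E.:+ (c E.:+ b) E.:= a E.:+ b) E.refl (x S.∘ m) b (x′ S.∘ m))))) }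

  through : ∀ s p → Geometry.IsLine S.plane (λ q → ray s (q -ᴱ p))
  through ∞     (x′ , y′) = inj₁ (x′ , (λ r → E.x-y≈0⇒x≈y _ _ r) , E.x≈y⇒x-y≈0)
  through [ m ] (x′ , y′) = inj₂ (m , y′ E.- x′ S.∘ m
    , (λ { {x , y} r → E.trans (E.solve 2 (λ y y′ → y E.:= y E.:- y′ E.:+ y′) E.refl y y′)
        (E.trans (E.+-congʳ (E.trans r (∘-minus m x x′)))
          (E.solve 3 (λ a b c → (a E.:- c) E.:+ b E.:= a E.:+ (b E.:- c)) E.refl (x S.∘ m) y′ (x′ S.∘ m))) })
    , (λ { {x , y} eq → E.trans (E.+-congʳ eq)
        (E.trans (E.solve 3 (λ a b c → a E.:+ (b E.:- c) E.:- b E.:= a E.:- c) E.refl (x S.∘ m) y′ (x′ S.∘ m))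
          (E.sym (∘-minus m x x′))) }))

  off-ray : ∀ s → ∃[ p ] ¬ ray s p
  off-ray ∞     = (E.1# , E.0#) , E.1≉0
  off-ray [ m ] = (E.0# , E.1#) , λ eq → E.1≉0 (E.trans eq (0∘ m))

  Orbit : K.Carrier → Pred V.Carrierᴹ (c ⊔ ℓ)
  Orbit h u = ∃[ x ] u V.≈ᴹ (h K.* x , h K.* f x)

  f-0 : f K.0# K.≈ K.0#
  f-0 = K.+-cancelˡ (f K.0#) _ _ (K.trans (K.sym (f-+ K.0# K.0#))
    (K.trans (f-cong (K.+-identityʳ K.0#)) (K.sym (K.+-identityʳ _))))

  f-minus : ∀ x y → f (x K.- y) K.≈ f x K.- f y
  f-minus x y = K.+-cancelʳ (f y) _ _ (K.trans (K.sym (f-+ _ y))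
    (K.trans (f-cong (K.solve 2 (λ x y → x K.:- y K.:+ y K.:= x) K.refl x y))
      (K.solve 2 (λ a b → a K.:= a K.:- b K.:+ b) K.refl (f x) (f y))))

  record IsComponent (W : Pred V.Carrierᴹ (c ⊔ ℓ)) : Set (c ⊔ ℓ) where
    field
      resp    : ∀ {u v} → u V.≈ᴹ v → W u → W v
      minus   : ∀ {u v} → W u → W v → W (u -ᴷ v)
      nonzero : ∃[ w ] (W w × ¬ w V.≈ᴹ V.0ᴹ)

    has-0 : W V.0ᴹ
    has-0 = let (w , Ww , _) = nonzero in resp (V.-ᴹ‿inverseʳ w) (minus Ww Ww)

    plus : ∀ {u v} → W u → W v → W (u V.+ᴹ v)
    plus {u} {v} Wu Wv = resp
      (V.+ᴹ-cong (V.≈ᴹ-refl {u}) (V.≈ᴹ-trans (V.-ᴹ‿cong (V.+ᴹ-identityˡ (V.-ᴹ v)))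
        ((K.solve 1 (λ a → K.:- (K.:- a) K.:= a) K.refl _) , (K.solve 1 (λ a → K.:- (K.:- a) K.:= a) K.refl _))))
      (minus Wu (minus has-0 Wv))

  span-component : ∀ {v} → ¬ v V.≈ᴹ V.0ᴹ → IsComponent (⟨_⟩ K v)
  span-component {v@(v₁ , v₂)} v≉0 = record
    { resp = λ u≈ (h , eq) → h , V.≈ᴹ-trans (V.≈ᴹ-sym u≈) eq
    ; minus = λ (g , u≈) (h , v≈) → g K.- h ,
        (K.trans (K.+-cong (proj₁ u≈) (K.-‿cong (proj₁ v≈)))
          (K.solve 3 (λ g h v → g K.:* v K.:- h K.:* v K.:= (g K.:- h) K.:* v) K.refl g h v₁)) ,
        (K.trans (K.+-cong (proj₂ u≈) (K.-‿cong (proj₂ v≈)))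
          (K.solve 3 (λ g h v → g K.:* v K.:- h K.:* v K.:= (g K.:- h) K.:* v) K.refl g h v₂))
    ; nonzero = v , (K.1# , V.≈ᴹ-sym (V.*ₗ-identityˡ v)) , v≉0 }

  orbit-component : ∀ {h} → h K.≉ K.0# → IsComponent (Orbit h)
  orbit-component {h} h≉0 = record
    { resp = λ u≈ (x , eq) → x , V.≈ᴹ-trans (V.≈ᴹ-sym u≈) eq
    ; minus = λ (x , u≈) (y , v≈) → x K.- y ,
        (K.trans (K.+-cong (proj₁ u≈) (K.-‿cong (proj₁ v≈)))
          (K.solve 3 (λ h x y → h K.:* x K.:- h K.:* y K.:= h K.:* (x K.:- y)) K.refl h x y)) ,
        (K.trans (K.+-cong (proj₂ u≈) (K.-‿cong (proj₂ v≈)))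
          (K.trans (K.solve 3 (λ h x y → h K.:* x K.:- h K.:* y K.:= h K.:* (x K.:- y)) K.refl h (f x) (f y))
            (K.*-congˡ (K.sym (f-minus x y)))))
    ; nonzero = (h K.* K.1# , h K.* f K.1#) , (K.1# , V.≈ᴹ-refl) , λ (eq , _) → K.*-nonZero h≉0 K.1≉0 eq }

  orbit-≐ : ∀ h → image K (h V.*ₗ_) (U K f) ≐ Orbit h
  orbit-≐ h =
      (λ (v , (x , v≈) , u≈) → x , V.≈ᴹ-trans u≈ (V.*ₗ-congˡ v≈))
    , (λ (x , u≈) → (x , f x) , (x , V.≈ᴹ-refl) , u≈)

  Kind : Pred V.Carrierᴹ (c ⊔ ℓ) → Set (c ⊔ ℓ)
  Kind W = (∃[ v ] ((¬ v V.≈ᴹ V.0ᴹ) × W ≐ ⟨_⟩ K v)) ⊎ (∃[ h ] (h K.≉ K.0# × W ≐ Orbit h))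

  kind : ∀ {W} → W ∈ ℬ K f → Kind W
  kind (inj₁ (D , _)) = inj₁ D
  kind (inj₂ (h , h≉0 , W⊆ , ⊆W)) = inj₂ (h , h≉0 ,
    (λ Wu → proj₁ (orbit-≐ h) (W⊆ Wu)) , (λ Ou → ⊆W (proj₂ (orbit-≐ h) Ou)))

  component-≐ : ∀ {W W′} → W ≐ W′ → IsComponent W′ → IsComponent W
  component-≐ (W⊆ , ⊆W) C = record
    { resp = λ u≈v Wu → ⊆W (C.resp u≈v (W⊆ Wu))
    ; minus = λ Wu Wv → ⊆W (C.minus (W⊆ Wu) (W⊆ Wv))
    ; nonzero = let (w , Ww , w≉0) = C.nonzero in w , ⊆W Ww , w≉0 }
    where module C = IsComponent C

  component : ∀ {W} → W ∈ ℬ K f → IsComponent W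
  component W∈ℬ with kind W∈ℬ
  ... | inj₁ (v , v≉0 , eq) = component-≐ eq (span-component v≉0)
  ... | inj₂ (h , h≉0 , eq) = component-≐ eq (orbit-component h≉0)

  orbit∈ℬ : ∀ {h} → h K.≉ K.0# → Orbit h ∈ ℬ K f
  orbit∈ℬ {h} h≉0 = inj₂ (h , h≉0 , proj₂ (orbit-≐ h) , proj₁ (orbit-≐ h))

  orbit? : ∀ h v → Dec (Orbit h v)
  orbit? h (v₁ , v₂) = K.any?
    (λ x≈y (e₁ , e₂) → K.trans e₁ (K.*-congˡ x≈y) , K.trans e₂ (K.*-congˡ (f-cong x≈y)))
    (λ x → v₁ K.≟ h K.* x ×-dec v₂ K.≟ h K.* f x)

  orbit-of? : ∀ v → Dec (∃[ h ] (h K.≉ K.0# × Orbit h v))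
  orbit-of? v = K.any?
    (λ h≈g (h≉0 , x , e₁ , e₂) → (λ g≈0 → h≉0 (K.trans h≈g g≈0))
      , x , K.trans e₁ (K.*-congʳ h≈g) , K.trans e₂ (K.*-congʳ h≈g))
    (λ h → ¬? (h K.≟ K.0#) ×-dec orbit? h v)

  cover : ∀ {v} → ¬ v V.≈ᴹ V.0ᴹ → ∃[ W ] (W ∈ ℬ K f × W v)
  cover {v} v≉0 with orbit-of? v
  ... | yes (h , h≉0 , Ov) = Orbit h , orbit∈ℬ h≉0 , Ov
  ... | no  ¬orbit = ⟨_⟩ K v , inj₁ ((v , v≉0 , (λ p → p) , (λ p → p)) , ¬L) , (K.1# , V.≈ᴹ-sym (V.*ₗ-identityˡ v))
    where
    ¬L : ¬ L K f (⟨_⟩ K v)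
    ¬L (x , x≉0 , v⊆ , ⊆v) with v⊆ {v} (K.1# , V.≈ᴹ-sym (V.*ₗ-identityˡ v))
    ... | h , v≈ = ¬orbit (h , h≉0 , x , v≈)
      where
      h≉0 : h K.≉ K.0#
      h≉0 h≈0 = v≉0 (V.≈ᴹ-trans v≈ (V.≈ᴹ-trans (V.*ₗ-congʳ h≈0) (V.*ₗ-zeroˡ (x , f x))))

  -- A line through the image of u is a translate of a ray. A priori the ray depends on u as well as
  -- on W; `slope-difference` removes this dependence.
  image-slope : ∀ {W} → W ∈ ℬ K f → ∀ u →
    ∃[ s ] (∀ v → (W (v -ᴷ u) → ray s (bij.to v -ᴱ bij.to u)) × (ray s (bij.to v -ᴱ bij.to u) → W (v -ᴷ u)))
  image-slope {W} W∈ℬ u = s , λ v →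
      (λ Wv → proj₁ (on (bij.to v) u∈Y) (Equivalence.to (maps v) (v -ᴷ u , Wv , V.≈ᴹ-sym (VG.plus-minus u v))))
    , (λ r → let (w , Ww , v≈) = Equivalence.from (maps v) (proj₂ (on (bij.to v) u∈Y) r) in
         C.resp (V.≈ᴹ-sym (V.≈ᴹ-trans (V.+ᴹ-cong v≈ V.≈ᴹ-refl) (VG.plus-cancel u w))) Ww)
    where
    module C = IsComponent (component W∈ℬ)
    mapped = iso.line-to {image K (u V.+ᴹ_) W} (u , W , W∈ℬ , (λ p → p) , (λ p → p))
    Y-line = proj₁ (proj₂ mapped)
    maps = proj₂ (proj₂ mapped)
    s = proj₁ (slope-of Y-line)
    on = proj₂ (slope-of Y-line)
    u∈Y : bij.to u ∈ proj₁ mapped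
    u∈Y = Equivalence.to (maps u) (V.0ᴹ , C.has-0 , V.≈ᴹ-sym (V.+ᴹ-identityʳ u))

  o : P.Carrierᴹ
  o = bij.to V.0ᴹ

  ψ : V.Carrierᴹ → P.Carrierᴹ
  ψ v = bij.to v -ᴱ o

  ψ⁻¹ : P.Carrierᴹ → V.Carrierᴹ
  ψ⁻¹ p = bij.from (p P.+ᴹ o)

  ψ-cong : ∀ {u v} → u V.≈ᴹ v → ψ u P.≈ᴹ ψ v
  ψ-cong u≈v = P.+ᴹ-cong (bij.to-cong u≈v) P.≈ᴹ-refl

  ψ⁻¹-cong : ∀ {p q} → p P.≈ᴹ q → ψ⁻¹ p V.≈ᴹ ψ⁻¹ q
  ψ⁻¹-cong p≈q = bij.from-cong (P.+ᴹ-cong p≈q P.≈ᴹ-refl)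

  ψ-ψ⁻¹ : ∀ p → ψ (ψ⁻¹ p) P.≈ᴹ p
  ψ-ψ⁻¹ p = P.≈ᴹ-trans (P.+ᴹ-cong (bij.strictlyInverseˡ (p P.+ᴹ o)) P.≈ᴹ-refl)
    (P.≈ᴹ-trans (P.+ᴹ-cong (P.+ᴹ-comm p o) P.≈ᴹ-refl) (PG.plus-cancel o p))

  ψ⁻¹-ψ : ∀ v → ψ⁻¹ (ψ v) V.≈ᴹ v
  ψ⁻¹-ψ v = V.≈ᴹ-trans (bij.from-cong (PG.minus-cancel (bij.to v) o)) (bij.strictlyInverseʳ v)

  ψ-injective : ∀ {u v} → ψ u P.≈ᴹ ψ v → u V.≈ᴹ v
  ψ-injective {u} {v} eq = V.≈ᴹ-trans (V.≈ᴹ-sym (ψ⁻¹-ψ u)) (V.≈ᴹ-trans (ψ⁻¹-cong eq) (ψ⁻¹-ψ v))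

  ψ-0 : ψ V.0ᴹ P.≈ᴹ P.0ᴹ
  ψ-0 = P.-ᴹ‿inverseʳ o

  ψ-difference : ∀ u v → bij.to v -ᴱ bij.to u P.≈ᴹ ψ v -ᴱ ψ u
  ψ-difference u v = P.≈ᴹ-sym (PG.difference-of-differences (bij.to v) (bij.to u) o)

  slope : ∀ {W} → W ∈ ℬ K f → Slope
  slope W∈ℬ = proj₁ (image-slope W∈ℬ V.0ᴹ)

  slope-reflects : ∀ {W} (W∈ℬ : W ∈ ℬ K f) {v} → ray (slope W∈ℬ) (ψ v) → W v
  slope-reflects W∈ℬ {v} r = IsComponent.resp (component W∈ℬ) (VG.minus-zero v)
    (proj₂ (proj₂ (image-slope W∈ℬ V.0ᴹ) v) r)

  -- Parallel lines are disjoint or equal, and so are their images; lines of different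
  -- slopes meet in exactly one point.
  slope-difference : ∀ {W} (W∈ℬ : W ∈ ℬ K f) {u v} → W (v -ᴷ u) → ray (slope W∈ℬ) (ψ v -ᴱ ψ u)
  slope-difference {W} W∈ℬ {u} {v} Wvu with image-slope W∈ℬ u
  ... | s , on with compare s (slope W∈ℬ)
  ... | parallel ⊆ = ray-resp (slope W∈ℬ) (ψ-difference u v) (⊆ (proj₁ (on v) Wvu))
  ... | crossing only-0 meet = contradiction w≈0 w≉0
    where
    module C = IsComponent (component W∈ℬ)
    -- If the slopes differed, the images of u + W and W would meet in r. The preimage of r puts u
    -- into W, so both lines are the image of W, and every element of W would have to be zero.
    r = proj₁ (meet (bij.to u) o)
    v₀ = bij.from r
    v₀≈ : bij.to v₀ P.≈ᴹ r
    v₀≈ = bij.strictlyInverseˡ r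
    Wv₀u : W (v₀ -ᴷ u)
    Wv₀u = proj₂ (on v₀) (ray-resp s (P.+ᴹ-cong (P.≈ᴹ-sym v₀≈) P.≈ᴹ-refl) (proj₁ (proj₂ (meet (bij.to u) o))))
    Wv₀ : W v₀
    Wv₀ = slope-reflects W∈ℬ (ray-resp (slope W∈ℬ) (P.+ᴹ-cong (P.≈ᴹ-sym v₀≈) P.≈ᴹ-refl) (proj₂ (proj₂ (meet (bij.to u) o))))
    Wu : W u
    Wu = C.resp (K.solve 2 (λ a b → a K.:- (a K.:- b) K.:= b) K.refl (proj₁ v₀) (proj₁ u) ,
                 K.solve 2 (λ a b → a K.:- (a K.:- b) K.:= b) K.refl (proj₂ v₀) (proj₂ u))
         (C.minus Wv₀ Wv₀u)
    w = proj₁ C.nonzero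
    Ww = proj₁ (proj₂ C.nonzero)
    w≉0 = proj₂ (proj₂ C.nonzero)
    difference : ray s (bij.to w -ᴱ o)
    difference = ray-resp s (PG.difference-of-differences (bij.to w) o (bij.to u))
      (ray-minus s (proj₁ (on w) (C.minus Ww Wu)) (proj₁ (on V.0ᴹ) (C.minus C.has-0 Wu)))
    w≈0 : w V.≈ᴹ V.0ᴹ
    w≈0 = ψ-injective (P.≈ᴹ-trans
      (only-0 difference (proj₁ (proj₂ (image-slope W∈ℬ V.0ᴹ) w) (C.resp (V.≈ᴹ-sym (VG.minus-zero w)) Ww)))
      (P.≈ᴹ-sym ψ-0))

  slope-preserves : ∀ {W} (W∈ℬ : W ∈ ℬ K f) {v} → W v → ray (slope W∈ℬ) (ψ v)
  slope-preserves W∈ℬ {v} Wv = ray-resp (slope W∈ℬ)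
    (P.≈ᴹ-trans (-ᴱ-cong (P.≈ᴹ-refl {ψ v}) ψ-0) (PG.minus-zero (ψ v)))
    (slope-difference W∈ℬ (IsComponent.resp (component W∈ℬ) (V.≈ᴹ-sym (VG.minus-zero v)) Wv))

  private
    -- The parallelogram argument: ψ (u + v) - ψ u - ψ v lies on the rays of W₁ and of W₂. The
    -- vector z, in W₂ but not in W₁, shows that these rays are different, so they share only 0.
    ψ-+-independent : ∀ {W₁ W₂} (W₁∈ℬ : W₁ ∈ ℬ K f) (W₂∈ℬ : W₂ ∈ ℬ K f) {u v z} →
      W₁ u → W₂ v → W₂ z → ¬ W₁ z → ψ (u V.+ᴹ v) P.≈ᴹ ψ u P.+ᴹ ψ v
    ψ-+-independent {W₁} {W₂} W₁∈ℬ W₂∈ℬ {u} {v} {z} W₁u W₂v W₂z ¬W₁z with compare (slope W₂∈ℬ) (slope W₁∈ℬ)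
    ... | parallel ⊆ = contradiction (slope-reflects W₁∈ℬ (⊆ (slope-preserves W₂∈ℬ W₂z))) ¬W₁z
    ... | crossing only-0 _ = PG.minus≈0 (P.≈ᴹ-trans (P.≈ᴹ-sym rearrange) (only-0 in₂ (ray-resp (slope W₁∈ℬ) (PG.swap-minus _ _ _) in₁)))
      where
      w = u V.+ᴹ v
      in₂ : ray (slope W₂∈ℬ) (ψ w -ᴱ ψ u -ᴱ ψ v)
      in₂ = ray-minus (slope W₂∈ℬ)
        (slope-difference W₂∈ℬ (IsComponent.resp (component W₂∈ℬ) (V.≈ᴹ-sym (VG.plus-cancel u v)) W₂v))
        (slope-preserves W₂∈ℬ W₂v)
      in₁ : ray (slope W₁∈ℬ) (ψ w -ᴱ ψ v -ᴱ ψ u)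
      in₁ = ray-minus (slope W₁∈ℬ)
        (slope-difference W₁∈ℬ (IsComponent.resp (component W₁∈ℬ) (V.≈ᴹ-sym
          (V.≈ᴹ-trans (V.+ᴹ-cong (V.+ᴹ-comm u v) V.≈ᴹ-refl) (VG.plus-cancel v u))) W₁u))
        (slope-preserves W₁∈ℬ W₁u)
      rearrange : ψ w -ᴱ ψ u -ᴱ ψ v P.≈ᴹ ψ w -ᴱ (ψ u P.+ᴹ ψ v)
      rearrange = E.solve 3 (λ a b c → a E.:- b E.:- c E.:= a E.:- (b E.:+ c)) E.refl (proj₁ (ψ w)) (proj₁ (ψ u)) (proj₁ (ψ v))
                , E.solve 3 (λ a b c → a E.:- b E.:- c E.:= a E.:- (b E.:+ c)) E.refl (proj₂ (ψ w)) (proj₂ (ψ u)) (proj₂ (ψ v))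

    outside-component : ∀ {W} → W ∈ ℬ K f → ∃[ w ] ¬ W w
    outside-component W∈ℬ with off-ray (slope W∈ℬ)
    ... | p , ¬r = ψ⁻¹ p , λ Ww → ¬r (ray-resp (slope W∈ℬ) (ψ-ψ⁻¹ p) (slope-preserves W∈ℬ Ww))

    nonzero-outside : ∀ {W} → W ∈ ℬ K f → ∀ {w} → ¬ W w → ¬ w V.≈ᴹ V.0ᴹ
    nonzero-outside W∈ℬ ¬Ww w≈0 = ¬Ww (IsComponent.resp (component W∈ℬ) (V.≈ᴹ-sym w≈0) (IsComponent.has-0 (component W∈ℬ)))

    ψ-+-from : ∀ {W} (W∈ℬ : W ∈ ℬ K f) {u v} → W u → ¬ W v → ψ (u V.+ᴹ v) P.≈ᴹ ψ u P.+ᴹ ψ v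
    ψ-+-from W∈ℬ {u} {v} Wu ¬Wv with cover (nonzero-outside W∈ℬ ¬Wv)
    ... | W₂ , W₂∈ℬ , W₂v = ψ-+-independent W∈ℬ W₂∈ℬ Wu W₂v W₂v ¬Wv

    -- Inside one component there is no parallelogram to use. Adding a vector w outside W to both
    -- sides turns the claim into sums across different components.
    ψ-+-within : ∀ {W} (W∈ℬ : W ∈ ℬ K f) {u v} → W u → W v → ψ (u V.+ᴹ v) P.≈ᴹ ψ u P.+ᴹ ψ v
    ψ-+-within {W} W∈ℬ {u} {v} Wu Wv with outside-component W∈ℬ
    ... | w , ¬Ww = +ᴱ-cancelʳ (begin
      ψ (u V.+ᴹ v) P.+ᴹ ψ w           ≈⟨ ψ-+-from W∈ℬ (C.plus Wu Wv) ¬Ww ⟨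
      ψ (u V.+ᴹ v V.+ᴹ w)             ≈⟨ ψ-cong (V.+ᴹ-assoc u v w) ⟩
      ψ (u V.+ᴹ (v V.+ᴹ w))           ≈⟨ ψ-+-from W∈ℬ Wu (λ Wvw → ¬Ww (C.resp (VG.plus-cancel v w) (C.minus Wvw Wv))) ⟩
      ψ u P.+ᴹ ψ (v V.+ᴹ w)           ≈⟨ P.+ᴹ-cong (P.≈ᴹ-refl {ψ u}) (ψ-+-from W∈ℬ Wv ¬Ww) ⟩
      ψ u P.+ᴹ (ψ v P.+ᴹ ψ w)         ≈⟨ P.+ᴹ-assoc (ψ u) (ψ v) (ψ w) ⟨
      ψ u P.+ᴹ ψ v P.+ᴹ ψ w           ∎)
      where
      module C = IsComponent (component W∈ℬ)
      open import Relation.Binary.Reasoning.Setoid P.≈ᴹ-setoid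
      +ᴱ-cancelʳ : ∀ {x y z} → x P.+ᴹ z P.≈ᴹ y P.+ᴹ z → x P.≈ᴹ y
      +ᴱ-cancelʳ (e₁ , e₂) = E.+-cancelʳ _ _ _ e₁ , E.+-cancelʳ _ _ _ e₂

  ≈ᴹ-0? : ∀ v → Dec (v V.≈ᴹ V.0ᴹ)
  ≈ᴹ-0? (x , y) = x K.≟ K.0# ×-dec y K.≟ K.0#

  ψ-+ : ∀ u v → ψ (u V.+ᴹ v) P.≈ᴹ ψ u P.+ᴹ ψ v
  ψ-+ u v with ≈ᴹ-0? u
  ... | yes u≈0 = P.≈ᴹ-trans (ψ-cong (V.≈ᴹ-trans (V.+ᴹ-cong u≈0 V.≈ᴹ-refl) (V.+ᴹ-identityˡ v)))
    (P.≈ᴹ-trans (P.≈ᴹ-sym (P.+ᴹ-identityˡ (ψ v))) (P.+ᴹ-cong (P.≈ᴹ-sym (P.≈ᴹ-trans (ψ-cong u≈0) ψ-0)) P.≈ᴹ-refl))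
  ... | no u≉0 with cover u≉0
  ... | W , W∈ℬ , Wu with ray? (slope W∈ℬ) (ψ v)
  ... | yes r = ψ-+-within W∈ℬ Wu (slope-reflects W∈ℬ r)
  ... | no ¬r = ψ-+-from W∈ℬ Wu (λ Wv → ¬r (slope-preserves W∈ℬ Wv))

  record Describes (s : Slope) (W : Pred V.Carrierᴹ (c ⊔ ℓ)) : Set (c ⊔ ℓ ⊔ ℓ′) where
    field
      into : ∀ v → W v → ray s (ψ v)
      back : ∀ v → ray s (ψ v) → W v

  orbit-slope : ∀ {h} → h K.≉ K.0# → ∃[ s ] Describes s (Orbit h)
  orbit-slope h≉0 = slope (orbit∈ℬ h≉0) , record
    { into = λ v → slope-preserves (orbit∈ℬ h≉0) ; back = λ v → slope-reflects (orbit∈ℬ h≉0) }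

  -- The line of slope s through o is the image of some coset u + W. It contains the image of 0, so
  -- u lies in W and the coset is W itself.
  classify : ∀ s → (∃[ v ] ((¬ v V.≈ᴹ V.0ᴹ) × Describes s (⟨_⟩ K v)))
                 ⊎ (∃[ h ] (h K.≉ K.0# × Describes s (Orbit h)))
  classify s with iso.line-from (through s o)
  ... | X , (u , W , W∈ℬ , X⊆ , ⊆X) , maps = described (kind W∈ℬ)
    where
    module C = IsComponent (component W∈ℬ)
    Wu : W u
    Wu with X⊆ (Equivalence.from (maps V.0ᴹ) (ray-resp s (P.≈ᴹ-sym ψ-0) (ray-0 s)))
    ... | w , Ww , 0≈u+w = C.resp (V.≈ᴹ-trans (V.+ᴹ-cong 0≈u+w V.≈ᴹ-refl)
            (V.≈ᴹ-trans (V.+ᴹ-assoc u w _) (V.≈ᴹ-trans (V.+ᴹ-cong (V.≈ᴹ-refl {u}) (V.-ᴹ‿inverseʳ w)) (V.+ᴹ-identityʳ u))))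
            (C.minus C.has-0 Ww)
    describes : Describes s W
    describes = record
      { into = λ v Wv → Equivalence.to (maps v) (⊆X (v -ᴷ u , C.minus Wv Wu , V.≈ᴹ-sym (VG.plus-minus u v)))
      ; back = λ v r → let (w , Ww , v≈) = X⊆ (Equivalence.from (maps v) r) in C.resp (V.≈ᴹ-sym v≈) (C.plus Wu Ww) }
    via : ∀ {W′} → W ≐ W′ → Describes s W′
    via (W⊆ , ⊆W) = record
      { into = λ v W′v → Describes.into describes v (⊆W W′v)
      ; back = λ v r → W⊆ (Describes.back describes v r) }
    described : Kind W → _
    described (inj₁ (v , v≉0 , eq)) = inj₁ (v , v≉0 , via eq)
    described (inj₂ (h , h≉0 , eq)) = inj₂ (h , h≉0 , via eq)

-- The action of K* on the components

-- Applied in both directions to the bijection between K² and E², this shows that the two fields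
-- have the same order.
square-injection⇒≤ : ∀ {m n} (φ : Fin m × Fin m → Fin n × Fin n) →
  (∀ {p q} → φ p ≡ φ q → p ≡ q) → m ℕ.≤ n
square-injection⇒≤ {m} {n} φ inj = ℕ.≮⇒≥ λ n<m →
  ℕ.<⇒≱ (ℕ.*-mono-< n<m n<m) (Fin.injective⇒≤ {f = combined} combined-injective)
  where
  combined : Fin (m ℕ.* m) → Fin (n ℕ.* n)
  combined i = let (a , b) = φ (Fin.remQuot m i) in Fin.combine a b
  remQuot-injective : ∀ {i j : Fin (m ℕ.* m)} → Fin.remQuot {m} m i ≡ Fin.remQuot m j → i ≡ j
  remQuot-injective {i} {j} eq = ≡.trans (≡.sym (Fin.combine-remQuot {m} m i))
    (≡.trans (≡.cong (λ (a , b) → Fin.combine a b) eq) (Fin.combine-remQuot {m} m j))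
  combined-injective : ∀ {i j} → combined i ≡ combined j → i ≡ j
  combined-injective {i} {j} eq = remQuot-injective (inj (pair-≡ (Fin.combine-injective _ _ _ _ eq)))
    where
    pair-≡ : ∀ {x y : Fin n × Fin n} → proj₁ x ≡ proj₁ y × proj₂ x ≡ proj₂ y → x ≡ y
    pair-≡ (≡.refl , ≡.refl) = ≡.refl

module FixedSubfield {c ℓ} (K : FiniteField c ℓ) (q : ℕ)
  (^q-+ : FiniteFieldTheory.Additive K (λ x → FiniteField._^_ K x q)) where
  open FieldTheory K

  ^q-0 : 0# ^ q ≈ 0#
  ^q-0 = +-cancelˡ (0# ^ q) _ _ (trans (sym (^q-+ 0# 0#))
    (trans (^-congˡ q (+-identityʳ 0#)) (sym (+-identityʳ _))))

  ^q-minus : ∀ x y → (x - y) ^ q ≈ x ^ q - y ^ q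
  ^q-minus x y = +-cancelʳ (y ^ q) _ _ (trans (sym (^q-+ (x - y) y))
    (trans (^-congˡ q (solve 2 (λ x y → x :- y :+ y := x) refl x y))
      (solve 2 (λ a b → a := a :- b :+ b) refl (x ^ q) (y ^ q))))

  𝔽-resp : ∀ {x y} → x ≈ y → 𝔽 K q x → 𝔽 K q y
  𝔽-resp x≈y xq = trans (^-congˡ q (sym x≈y)) (trans xq x≈y)

  𝔽-0 : 𝔽 K q 0#
  𝔽-0 = ^q-0

  𝔽-1 : 𝔽 K q 1#
  𝔽-1 = 1^n≈1 q

  𝔽-minus : ∀ {x y} → 𝔽 K q x → 𝔽 K q y → 𝔽 K q (x - y)
  𝔽-minus xq yq = trans (^q-minus _ _) (+-cong xq (-‿cong yq))

  𝔽-* : ∀ {x y} → 𝔽 K q x → 𝔽 K q y → 𝔽 K q (x * y)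
  𝔽-* xq yq = trans (^-distrib-* _ _ q) (*-cong xq yq)

  𝔽-⁻¹ : ∀ {x} → x ≉ 0# → 𝔽 K q x → 𝔽 K q (x ⁻¹)
  𝔽-⁻¹ {x} x≉0 xq = *-cancelˡ x≉0 (trans (*-congʳ (sym xq))
    (trans (sym (^-distrib-* x (x ⁻¹) q)) (trans (^-congˡ q (⁻¹-inverseʳ x≉0))
      (trans 𝔽-1 (sym (⁻¹-inverseʳ x≉0))))))

module AxisGraph {c ℓ} (K : FiniteField c ℓ) (f : FiniteField.Carrier K → FiniteField.Carrier K) where
  open FieldTheory K
  private
    module V = LeftModule (F² K)

  -- U f is the graph {g v₀ + η(g) v₁} of an additive map η between the lines spanned by v₀ and v₁,
  -- and η is multiplicative up to the constant η(1).
  record SemilinearGraph : Set (c ⊔ ℓ) where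
    field
      v₀ v₁       : V.Carrierᴹ
      independent : ∀ g h → g V.*ₗ v₀ V.+ᴹ h V.*ₗ v₁ V.≈ᴹ V.0ᴹ → g ≈ 0# × h ≈ 0#
      η           : Carrier → Carrier
      η-cong      : ∀ {g h} → g ≈ h → η g ≈ η h
      η-+         : ∀ g h → η (g + h) ≈ η g + η h
      η-*         : ∀ g h → η (g * h) * η 1# ≈ η g * η h
      η-1         : η 1# ≉ 0#
      η-injective : ∀ {g h} → η g ≈ η h → g ≈ h
      in-U        : ∀ g → U K f (g V.*ₗ v₀ V.+ᴹ η g V.*ₗ v₁)
      of-U        : ∀ x → ∃[ g ] (x , f x) V.≈ᴹ g V.*ₗ v₀ V.+ᴹ η g V.*ₗ v₁

record IsLinear {c ℓ} (K : FiniteField c ℓ) (q : ℕ)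
  (f : FiniteField.Carrier K → FiniteField.Carrier K) : Set (c ⊔ ℓ) where
  open FiniteField K
  field
    f-cong  : ∀ {x y} → x ≈ y → f x ≈ f y
    f-+     : ∀ x y → f (x + y) ≈ f x + f y
    f-scale : ∀ {t} x → 𝔽 K q t → f (t * x) ≈ t * f x

module AndréPlane {c ℓ c′ ℓ′} (K : FiniteField c ℓ) (q : ℕ)
  (^q-+ : FiniteFieldTheory.Additive K (λ x → FiniteField._^_ K x q))
  (f : FiniteField.Carrier K → FiniteField.Carrier K)
  (linear : IsLinear K q f)
  (scattered : Scattered K q f)
  (S : GeneralizedAndréSystem c′ ℓ′)
  (isomorphism : 𝒜 K f ≅ GeneralizedAndréSystem.plane S) where

  open IsLinear linear
  open Coordinatization K f f-cong f-+ S isomorphism public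
  open AxisGraph K f
  module K = FieldTheory K
  module Kq = FixedSubfield K q ^q-+
  private
    module S = GeneralizedAndréSystem S
    module V = LeftModule (F² K)
    module P = LeftModule (F² S.F)
    module Q = IsQuasifield S.isQuasifield
  open Semilinearity S.F
  open SL

  orders : K.order ≡ order
  orders = ℕ.≤-antisym
    (square-injection⇒≤
      (λ (i , j) → let (x , y) = ψ (K.element i , K.element j) in index x , index y)
      (λ eq → pair-injective (ψ-injective (index-injective (≡.cong proj₁ eq) , index-injective (≡.cong proj₂ eq)))))
    (square-injection⇒≤
      (λ (i , j) → let (x , y) = ψ⁻¹ (element i , element j) in K.index x , K.index y)
      (λ eq → pair-injective′ (ψ⁻¹-injective (K.index-injective (≡.cong proj₁ eq) , K.index-injective (≡.cong proj₂ eq)))))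
    where
    pair-injective : ∀ {i i′ j j′} → (K.element i , K.element j) V.≈ᴹ (K.element i′ , K.element j′) →
                     (i , j) ≡ (i′ , j′)
    pair-injective (e₁ , e₂) = ≡.cong₂ _,_ (K.element-injective e₁) (K.element-injective e₂)
    pair-injective′ : ∀ {i i′ j j′} → (element i , element j) P.≈ᴹ (element i′ , element j′) →
                     (i , j) ≡ (i′ , j′)
    pair-injective′ (e₁ , e₂) = ≡.cong₂ _,_ (element-injective e₁) (element-injective e₂)
    ψ⁻¹-injective : ∀ {p p′} → ψ⁻¹ p V.≈ᴹ ψ⁻¹ p′ → p P.≈ᴹ p′
    ψ⁻¹-injective eq = P.≈ᴹ-trans (P.≈ᴹ-sym (ψ-ψ⁻¹ _)) (P.≈ᴹ-trans (ψ-cong eq) (ψ-ψ⁻¹ _))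

  ψ⁻¹-+ : ∀ p p′ → ψ⁻¹ (p P.+ᴹ p′) V.≈ᴹ ψ⁻¹ p V.+ᴹ ψ⁻¹ p′
  ψ⁻¹-+ p p′ = ψ-injective (P.≈ᴹ-trans (ψ-ψ⁻¹ _) (P.≈ᴹ-trans
    (P.+ᴹ-cong (P.≈ᴹ-sym (ψ-ψ⁻¹ p)) (P.≈ᴹ-sym (ψ-ψ⁻¹ p′))) (P.≈ᴹ-sym (ψ-+ _ _))))

  opaque
    act : K.Carrier → P.Carrierᴹ → P.Carrierᴹ
    act g p = ψ (g V.*ₗ ψ⁻¹ p)

    act-cong : ∀ {g h p p′} → g K.≈ h → p P.≈ᴹ p′ → act g p P.≈ᴹ act h p′
    act-cong g≈h p≈p′ = ψ-cong (V.*ₗ-cong g≈h (ψ⁻¹-cong p≈p′))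

    ψ-act : ∀ g v → ψ (g V.*ₗ v) P.≈ᴹ act g (ψ v)
    ψ-act g v = ψ-cong (V.*ₗ-congˡ (V.≈ᴹ-sym (ψ⁻¹-ψ v)))

    act-+ʳ : ∀ g p p′ → act g (p P.+ᴹ p′) P.≈ᴹ act g p P.+ᴹ act g p′
    act-+ʳ g p p′ = P.≈ᴹ-trans (ψ-cong (V.≈ᴹ-trans (V.*ₗ-congˡ (ψ⁻¹-+ p p′)) (V.*ₗ-distribˡ g _ _))) (ψ-+ _ _)

    act-+ˡ : ∀ g h p → act (g K.+ h) p P.≈ᴹ act g p P.+ᴹ act h p
    act-+ˡ g h p = P.≈ᴹ-trans (ψ-cong (V.*ₗ-distribʳ (ψ⁻¹ p) g h)) (ψ-+ _ _)

    act-* : ∀ g h p → act (g K.* h) p P.≈ᴹ act g (act h p)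
    act-* g h p = P.≈ᴹ-trans (ψ-cong (V.*ₗ-assoc g h (ψ⁻¹ p))) (ψ-act g _)

    act-1 : ∀ p → act K.1# p P.≈ᴹ p
    act-1 p = P.≈ᴹ-trans (ψ-cong (V.*ₗ-identityˡ (ψ⁻¹ p))) (ψ-ψ⁻¹ p)

    act-0ˡ : ∀ p → act K.0# p P.≈ᴹ P.0ᴹ
    act-0ˡ p = P.≈ᴹ-trans (ψ-cong (V.*ₗ-zeroˡ (ψ⁻¹ p))) ψ-0

    act-0ʳ : ∀ g → act g P.0ᴹ P.≈ᴹ P.0ᴹ
    act-0ʳ g = P.≈ᴹ-trans (ψ-cong (V.≈ᴹ-trans (V.*ₗ-congˡ ψ⁻¹-0) (V.*ₗ-zeroʳ g))) ψ-0
      where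
      ψ⁻¹-0 : ψ⁻¹ P.0ᴹ V.≈ᴹ V.0ᴹ
      ψ⁻¹-0 = ψ-injective (P.≈ᴹ-trans (ψ-ψ⁻¹ P.0ᴹ) (P.≈ᴹ-sym ψ-0))

  act-free : ∀ {g p} → g K.≉ K.0# → act g p P.≈ᴹ P.0ᴹ → p P.≈ᴹ P.0ᴹ
  act-free {g} {p} g≉0 eq = P.≈ᴹ-trans (P.≈ᴹ-sym (act-1 p))
    (P.≈ᴹ-trans (act-cong (K.sym (K.⁻¹-inverseˡ g≉0)) P.≈ᴹ-refl)
      (P.≈ᴹ-trans (act-* (g K.⁻¹) g p) (P.≈ᴹ-trans (act-cong K.refl eq) (act-0ʳ (g K.⁻¹)))))

  record Invariant (s : Slope) : Set (c ⊔ c′ ⊔ ℓ′) where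
    constructor invariant
    field
      fixes : ∀ g p → ray s p → ray s (act g p)

  open Describes
  open Invariant

  opaque
    unfolding act

    span-invariant : ∀ {s v} → Describes s (⟨_⟩ K v) → Invariant s
    span-invariant {s} {v} describes = invariant λ g p r →
      let (h , eq) = back describes (ψ⁻¹ p) (ray-resp s (P.≈ᴹ-sym (ψ-ψ⁻¹ p)) r) in
      into describes _ (g K.* h , V.≈ᴹ-trans (V.*ₗ-congˡ eq) (V.≈ᴹ-sym (V.*ₗ-assoc g h v)))

  orbit-act : ∀ {h g u} → Orbit h u → Orbit (g K.* h) (g V.*ₗ u)
  orbit-act (x , e₁ , e₂) = x , K.trans (K.*-congˡ e₁) (K.sym (K.*-assoc _ _ _))
                              , K.trans (K.*-congˡ e₂) (K.sym (K.*-assoc _ _ _))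

  orbit-≈ : ∀ {h u v} → u V.≈ᴹ v → Orbit h u → Orbit h v
  orbit-≈ u≈v (x , e) = x , V.≈ᴹ-trans (V.≈ᴹ-sym u≈v) e

  orbit-resp : ∀ {h h′ u} → h K.≈ h′ → Orbit h u → Orbit h′ u
  orbit-resp h≈h′ (x , e₁ , e₂) = x , K.trans e₁ (K.*-congʳ h≈h′) , K.trans e₂ (K.*-congʳ h≈h′)

  orbit-𝔽 : ∀ {h t u} → 𝔽 K q t → Orbit (h K.* t) u → Orbit h u
  orbit-𝔽 {h} {t} t∈𝔽 (x , e₁ , e₂) = t K.* x , K.trans e₁ (K.*-assoc _ _ _)
    , K.trans e₂ (K.trans (K.*-assoc _ _ _) (K.*-congˡ (K.sym (f-scale x t∈𝔽))))

  -- A common vector h (x , f x) = h′ (y , f y) gives y f x = x f y, so x and y are 𝔽-dependent by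
  -- scatteredness. The factor t is x / y, written as - b / a from the dependence a x + b y = 0.
  orbits-meet : ∀ {h h′ u} → h K.≉ K.0# → h′ K.≉ K.0# → ¬ u V.≈ᴹ V.0ᴹ → Orbit h u → Orbit h′ u →
    ∃[ t ] (𝔽 K q t × t K.≉ K.0# × h′ K.≈ h K.* t)
  orbits-meet {h} {h′} {u} h≉0 h′≉0 u≉0 (x , ux , ufx) (y , uy , ufy) =
    t , Kq.𝔽-resp (K.solve 2 (λ a b → (K.:0 K.:- a) K.:* b K.:= K.:- (a K.:* b)) K.refl b (a K.⁻¹))
          (Kq.𝔽-* (Kq.𝔽-minus Kq.𝔽-0 b∈𝔽) (Kq.𝔽-⁻¹ a≉0 a∈𝔽))
      , (λ t≈0 → h′≉0 (K.trans h′≈ (K.trans (K.*-congˡ t≈0) (K.zeroʳ h))))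
      , h′≈
    where
    nonzero : ∀ {h x} → u V.≈ᴹ (h K.* x , h K.* f x) → x K.≉ K.0#
    nonzero {h} (e₁ , e₂) x≈0 = u≉0
      ( K.trans e₁ (K.trans (K.*-congˡ x≈0) (K.zeroʳ h))
      , K.trans e₂ (K.trans (K.*-congˡ (K.trans (f-cong x≈0) f-0)) (K.zeroʳ h)))
    x≉0 = nonzero (ux , ufx)
    y≉0 = nonzero (uy , ufy)
    hx≈h′y : h K.* x K.≈ h′ K.* y
    hx≈h′y = K.trans (K.sym ux) uy
    hfx≈h′fy : h K.* f x K.≈ h′ K.* f y
    hfx≈h′fy = K.trans (K.sym ufx) ufy
    aligned : y K.* f x K.- x K.* f y K.≈ K.0#
    aligned = K.integralˡ (K.*-nonZero h≉0 h′≉0) (K.trans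
      (K.solve 6 (λ h h′ x y p r → h K.:* h′ K.:* (y K.:* p K.:- x K.:* r) K.:=
         (h′ K.:* y) K.:* (h K.:* p) K.:- (h K.:* x) K.:* (h′ K.:* r)) K.refl h h′ x y (f x) (f y))
      (K.x≈y⇒x-y≈0 (K.*-cong (K.sym hx≈h′y) hfx≈h′fy)))
    dependent = scattered x y aligned
    a = proj₁ dependent
    b = proj₁ (proj₂ dependent)
    a∈𝔽 = proj₁ (proj₂ (proj₂ dependent))
    b∈𝔽 = proj₁ (proj₂ (proj₂ (proj₂ dependent)))
    ¬both = proj₁ (proj₂ (proj₂ (proj₂ (proj₂ dependent))))
    ax+by≈0 = proj₂ (proj₂ (proj₂ (proj₂ (proj₂ dependent))))
    a≉0 : a K.≉ K.0#
    a≉0 a≈0 = ¬both (a≈0 , K.integralʳ y≉0 (K.trans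
      (K.trans (K.sym (K.+-identityˡ _)) (K.+-congʳ (K.sym (K.trans (K.*-congʳ a≈0) (K.zeroˡ x))))) ax+by≈0))
    t = K.- (b K.* a K.⁻¹)
    h′≈ : h′ K.≈ h K.* t
    h′≈ = K.*-cancelʳ (K.*-nonZero a≉0 y≉0) (begin
      h′ K.* (a K.* y)             ≈⟨ K.solve 3 (λ h a y → h K.:* (a K.:* y) K.:= a K.:* (h K.:* y)) K.refl h′ a y ⟩
      a K.* (h′ K.* y)             ≈⟨ K.*-congˡ hx≈h′y ⟨
      a K.* (h K.* x)              ≈⟨ K.solve 5 (λ a h x b y → a K.:* (h K.:* x) K.:=
                                        h K.:* (a K.:* x K.:+ b K.:* y) K.:- h K.:* (b K.:* y)) K.refl a h x b y ⟩
      h K.* (a K.* x K.+ b K.* y) K.- h K.* (b K.* y)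
                                   ≈⟨ K.+-congʳ (K.trans (K.*-congˡ ax+by≈0) (K.zeroʳ h)) ⟩
      K.0# K.- h K.* (b K.* y)     ≈⟨ K.+-congˡ (K.-‿cong (K.*-congˡ (K.*-congˡ (K.*-identityˡ y)))) ⟨
      K.0# K.- h K.* (b K.* (K.1# K.* y))
                                   ≈⟨ K.+-congˡ (K.-‿cong (K.*-congˡ (K.*-congˡ (K.*-congʳ (K.⁻¹-inverseˡ a≉0))))) ⟨
      K.0# K.- h K.* (b K.* (a K.⁻¹ K.* a K.* y))
                                   ≈⟨ K.solve 5 (λ h b i a y → K.:0 K.:- h K.:* (b K.:* (i K.:* a K.:* y)) K.:=
                                        h K.:* (K.:- (b K.:* i)) K.:* (a K.:* y)) K.refl h b (a K.⁻¹) a y ⟩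
      h K.* t K.* (a K.* y)        ∎)
      where open import Relation.Binary.Reasoning.Setoid K.setoid

  multiplier : ∀ {m} → m ≉ 0# → SL
  multiplier {m} m≉0 = record
    { to = S._∘ m
    ; from = λ y → proj₁ (preimage y)
    ; to-cong = ∘-congʳ
    ; from-cong = λ {x} {y} x≈y → injective (trans (proj₂ (preimage x)) (trans x≈y (sym (proj₂ (preimage y)))))
    ; to-+ = ∘-+ m
    ; to-* = λ x y → begin
        (x * y) S.∘ m * 1# S.∘ m       ≈⟨ *-cong (S.∘-def _ m m≉0) (S.∘-def _ m m≉0) ⟩
        ρ (x * y) * m * (ρ 1# * m)     ≈⟨ *-cong (*-congʳ (ρ-* x y)) (trans (*-congʳ ρ-1) (*-identityˡ m)) ⟩
        ρ x * ρ y * m * m              ≈⟨ solve 3 (λ a b m → a :* b :* m :* m := a :* m :* (b :* m)) refl (ρ x) (ρ y) m ⟩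
        ρ x * m * (ρ y * m)            ≈⟨ *-cong (S.∘-def _ m m≉0) (S.∘-def _ m m≉0) ⟨
        x S.∘ m * y S.∘ m              ∎
    ; to-from = λ y → proj₂ (preimage y)
    ; from-to = λ x → injective (proj₂ (preimage (x S.∘ m)))
    }
    where
    open import Relation.Binary.Reasoning.Setoid setoid
    ρ = proj₁ (S.λ′ (m , m≉0))
    open RingMorphisms.IsRingIsomorphism (proj₂ (S.λ′ (m , m≉0))) using () renaming (*-homo to ρ-*; 1#-homo to ρ-1)
    injective : ∀ {x y} → x S.∘ m ≈ y S.∘ m → x ≈ y
    injective {x} {y} eq with x - y ≟ 0#
    ... | yes x-y≈0 = x-y≈0⇒x≈y x y x-y≈0
    ... | no  x-y≉0 = contradiction (trans (∘-minus m x y) (x≈y⇒x-y≈0 eq)) (Q.∘-nonZero x-y≉0 m≉0)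
    preimage : ∀ y → ∃[ x ] x S.∘ m ≈ y
    preimage = injective⇒inverse {S._∘ m} ∘-congʳ injective

  1∘ : ∀ {m} → m ≉ 0# → 1# S.∘ m ≈ m
  1∘ {m} m≉0 = trans (S.∘-def 1# m m≉0) (trans (*-congʳ ρ-1) (*-identityˡ m))
    where
    open RingMorphisms.IsRingIsomorphism (proj₂ (S.λ′ (m , m≉0))) using () renaming (1#-homo to ρ-1)

  on-axis : ∀ {x y} → ray [ 0# ] (x , y) → y ≈ 0#
  on-axis {x} r = trans r (S.∘-zero x)

  axis : ∀ x → ray [ 0# ] (x , 0#)
  axis x = sym (S.∘-zero x)

  point : ∀ s → ∃[ p ] (ray s p × ¬ p P.≈ᴹ P.0ᴹ)
  point ∞     = (0# , 1#) , refl , λ (_ , eq) → 1≉0 eq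
  point [ m ] = (1# , 1# S.∘ m) , refl , λ (eq , _) → 1≉0 eq

  ψ⁻¹-nonzero : ∀ {p} → ¬ p P.≈ᴹ P.0ᴹ → ¬ ψ⁻¹ p V.≈ᴹ V.0ᴹ
  ψ⁻¹-nonzero p≉0 eq = p≉0 (P.≈ᴹ-trans (P.≈ᴹ-sym (ψ-ψ⁻¹ _)) (P.≈ᴹ-trans (ψ-cong eq) ψ-0))

  describes-orbit : ∀ {s h} → Describes s (Orbit h) → ∀ p → ray s p → Orbit h (ψ⁻¹ p)
  describes-orbit {s} describes p r = back describes (ψ⁻¹ p) (ray-resp s (P.≈ᴹ-sym (ψ-ψ⁻¹ p)) r)

  orbit-describes : ∀ {s h} → Describes s (Orbit h) → ∀ p → Orbit h (ψ⁻¹ p) → ray s p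
  orbit-describes {s} describes p O = ray-resp s (ψ-ψ⁻¹ p) (into describes (ψ⁻¹ p) O)

  opaque
    unfolding act

    orbit-of-act : ∀ {s h} → Describes s (Orbit h) → ∀ g p → ray s p → Orbit (g K.* h) (ψ⁻¹ (act g p))
    orbit-of-act {h = h} describes g p r = orbit-≈ (V.≈ᴹ-sym (ψ⁻¹-ψ _)) (orbit-act (describes-orbit describes p r))

    moved : ∀ {s h s′ g} → Describes s (Orbit h) → Describes s′ (Orbit (g K.* h)) →
            ∀ p → ray s p → ray s′ (act g p)
    moved {g = g} describes describes′ p r = into describes′ (g V.*ₗ ψ⁻¹ p) (orbit-act (describes-orbit describes p r))

  same-slope : ∀ {s h h′} → h K.≉ K.0# → h′ K.≉ K.0# → Describes s (Orbit h) → Describes s (Orbit h′) →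
    ∃[ t ] (𝔽 K q t × t K.≉ K.0# × h′ K.≈ h K.* t)
  same-slope {s} h≉0 h′≉0 describes describes′ with point s
  ... | p , r , p≉0 = orbits-meet h≉0 h′≉0 (ψ⁻¹-nonzero p≉0)
    (describes-orbit describes p r) (describes-orbit describes′ p r)

  slopes-equal : ∀ {m m′ h h′} → Describes [ m ] (Orbit h) → Describes [ m′ ] (Orbit h′) →
    (∀ {u} → Orbit h u → Orbit h′ u) → m ≉ 0# → m′ ≉ 0# → m ≈ m′
  slopes-equal {m} {m′} describes describes′ ⊆ m≉0 m′≉0 =
    trans (sym (1∘ m≉0)) (trans (orbit-describes describes′ (1# , 1# S.∘ m) (⊆ (describes-orbit describes (1# , 1# S.∘ m) refl))) (1∘ m′≉0))

  opaque
    unfolding act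

    -- The nonzero vector g p lies on hU by hypothesis and on (g h)U because p lies on hU;
    -- `orbits-meet` then gives g h = h t with t in 𝔽.
    stabilizer : ∀ {s h g p} → h K.≉ K.0# → g K.≉ K.0# → Describes s (Orbit h) → ¬ p P.≈ᴹ P.0ᴹ →
      ray s p → ray s (act g p) → 𝔽 K q g
    stabilizer {s} {h} {g} {p} h≉0 g≉0 describes p≉0 r r′ =
      let (t , t∈𝔽 , _ , gh≈ht) = orbits-meet h≉0 (K.*-nonZero g≉0 h≉0)
            (ψ⁻¹-nonzero (λ eq → p≉0 (act-free g≉0 eq)))
            (describes-orbit describes (act g p) r′)
            (orbit-of-act describes g p r)
      in Kq.𝔽-resp (K.*-cancelʳ h≉0 (K.trans (K.*-comm t h) (K.sym gh≈ht))) t∈𝔽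

  orbit-not-invariant : ∀ {s h g} → h K.≉ K.0# → ¬ 𝔽 K q g → Describes s (Orbit h) → ¬ Invariant s
  orbit-not-invariant {s} {h} {g} h≉0 g∉𝔽 describes inv with point s
  ... | p , r , p≉0 = g∉𝔽 (stabilizer {s} {h} {g} {p} h≉0 g≉0 describes p≉0 r (fixes inv g p r))
    where
    g≉0 : g K.≉ K.0#
    g≉0 g≈0 = g∉𝔽 (Kq.𝔽-resp (K.sym g≈0) Kq.𝔽-0)

  invariant-resp : ∀ {m m′} → m ≈ m′ → Invariant [ m ] → Invariant [ m′ ]
  invariant-resp m≈m′ inv = invariant λ g p r →
    trans (fixes inv g p (trans r (Q.∘-cong refl (sym m≈m′)))) (Q.∘-cong refl m≈m′)

  -- Here 1, t and t′ are three distinct elements of 𝔽*, g₀ is a witness that no orbit component is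
  -- invariant, and `5≤order` allows four values of E to be avoided at once.
  module Pigeonhole {t t′ g₀ : K.Carrier} (t∈𝔽 : 𝔽 K q t) (t′∈𝔽 : 𝔽 K q t′)
    (t≉0 : t K.≉ K.0#) (t′≉0 : t′ K.≉ K.0#) (t≉1 : t K.≉ K.1#) (t′≉1 : t′ K.≉ K.1#) (t≉t′ : t K.≉ t′)
    (g₀∉𝔽 : ¬ 𝔽 K q g₀) (5≤order : 5 ℕ.≤ order) where

    data Class (i : Fin order) : Set (c ⊔ ℓ ⊔ c′ ⊔ ℓ′) where
      null  : element i ≈ 0# → Class i
      fixed : element i ≉ 0# → Invariant [ element i ] → Class i
      orbit : ∀ h → element i ≉ 0# → h K.≉ K.0# → Describes [ element i ] (Orbit h) → Class i

    class : ∀ i → Class i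
    class i with element i ≟ 0#
    ... | yes m≈0 = null m≈0
    ... | no  m≉0 with classify [ element i ]
    ... | inj₁ (_ , _ , describes)   = fixed m≉0 (span-invariant describes)
    ... | inj₂ (h , h≉0 , describes) = orbit h m≉0 h≉0 describes

    -- An orbit component has many labels h. The field `label` singles out the one that `class`
    -- returned, which makes h unique for each slope.
    record Labelled (i : Fin order) (h : K.Carrier) : Set (c ⊔ ℓ ⊔ c′ ⊔ ℓ′) where
      constructor labelled
      field
        m≉0       : element i ≉ 0#
        h≉0       : h K.≉ K.0#
        describes : Describes [ element i ] (Orbit h)
        label     : class i ≡ orbit h m≉0 h≉0 describes

    label-unique : ∀ {i h h′} → Labelled i h → Labelled i h′ → h ≡ h′
    label-unique (labelled _ _ _ eq) (labelled _ _ _ eq′) with ≡.trans (≡.sym eq) eq′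
    ... | ≡.refl = ≡.refl

    label-injective : ∀ {i j h h′ s} → 𝔽 K q s → Labelled i h → Labelled j h′ → h K.≈ h′ K.* s → i ≡ j
    label-injective s∈𝔽 (labelled m≉0 _ describes _) (labelled m′≉0 _ describes′ _) h≈h′s =
      element-injective (slopes-equal describes describes′ (λ O → orbit-𝔽 s∈𝔽 (orbit-resp h≈h′s O)) m≉0 m′≉0)

    -- The orbit components are hU, and each of them has at least the three labels h, ht, ht′. So if δ sent
    -- every fixed slope to an orbit slope, then m ↦ h(m) for orbit slopes and m ↦ h(δ m) t for fixed ones
    -- would be an injection of E into K missing h t′.
    pigeonhole : ∀ (δ : Carrier → Carrier) → (∀ {x y} → δ x ≈ δ y → x ≈ y) →
      (∀ {x} → x ≉ 0# → δ x ≉ 0#) →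
      (∀ m → m ≉ 0# → Invariant [ m ] → Invariant [ δ m ] → ⊥) → ⊥
    pigeonhole δ δ-injective δ-nonZero never = missed labelled-index
      where
      partner : Fin order → Fin order
      partner i = index (δ (element i))

      -- Kept as a relation, so that injectivity becomes a case analysis on how each value arose.
      data Image (i : Fin order) : K.Carrier → Set (c ⊔ ℓ ⊔ c′ ⊔ ℓ′) where
        zero  : element i ≈ 0# → Image i K.0#
        own   : ∀ {h} → Labelled i h → Image i h
        shift : ∀ {h} → element i ≉ 0# → Labelled (partner i) h → Image i (h K.* t)

      partner-labelled : ∀ i → element i ≉ 0# → Invariant [ element i ] → ∃[ h ] Labelled (partner i) h
      partner-labelled i m≉0 inv with class (partner i) in eq
      ... | null  δ≈0 = contradiction (trans (sym (element-index _)) δ≈0) (δ-nonZero m≉0)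
      ... | fixed _ inv′ = ⊥-elim (never (element i) m≉0 inv (invariant-resp (element-index _) inv′))
      ... | orbit h δ≉0 h≉0 describes = h , labelled δ≉0 h≉0 describes eq

      valued : ∀ i → ∃[ y ] Image i y
      valued i with class i in eq
      ... | null m≈0 = _ , zero m≈0
      ... | fixed m≉0 inv = let (h , L) = partner-labelled i m≉0 inv in _ , shift m≉0 L
      ... | orbit h m≉0 h≉0 describes = h , own (labelled m≉0 h≉0 describes eq)

      t≉self : ∀ {h s} → h K.≉ K.0# → s K.≉ K.1# → h K.≉ h K.* s
      t≉self h≉0 s≉1 eq = s≉1 (K.*-cancelˡ h≉0 (K.trans (K.sym eq) (K.sym (K.*-identityʳ _))))

      partner-injective : ∀ {i j} → partner i ≡ partner j → i ≡ j
      partner-injective eq = element-injective (δ-injective (index-injective eq))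

      image-injective : ∀ {i j y z} → Image i y → Image j z → y K.≈ z → i ≡ j
      image-injective (zero i≈0) (zero j≈0) _ = element-injective (trans i≈0 (sym j≈0))
      image-injective (zero _) (own L) eq = contradiction (K.sym eq) (Labelled.h≉0 L)
      image-injective (zero _) (shift _ L) eq = contradiction (K.sym eq) (K.*-nonZero (Labelled.h≉0 L) t≉0)
      image-injective (own L) (zero _) eq = contradiction eq (Labelled.h≉0 L)
      image-injective (own L) (own L′) eq = label-injective Kq.𝔽-1 L L′ (K.trans eq (K.sym (K.*-identityʳ _)))
      -- Labels that agree up to a factor in 𝔽 belong to one slope, for which only one label was
      -- chosen; so h = h t, against t ≉ 1.
      image-injective (own L) (shift _ L′) eq with label-injective t∈𝔽 L L′ eq
      ... | ≡.refl with label-unique L L′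
      ... | ≡.refl = contradiction eq (t≉self (Labelled.h≉0 L) t≉1)
      image-injective (shift _ L) (zero _) eq = contradiction eq (K.*-nonZero (Labelled.h≉0 L) t≉0)
      image-injective (shift _ L) (own L′) eq with label-injective t∈𝔽 L′ L (K.sym eq)
      ... | ≡.refl with label-unique L L′
      ... | ≡.refl = contradiction (K.sym eq) (t≉self (Labelled.h≉0 L) t≉1)
      image-injective (shift _ L) (shift _ L′) eq = partner-injective
        (label-injective Kq.𝔽-1 L L′ (K.trans (K.*-cancelʳ t≉0 eq) (K.sym (K.*-identityʳ _))))

      not-shifted : ∀ {i₀ h₀} → Labelled i₀ h₀ → ∀ {i y} → Image i y → y K.≉ h₀ K.* t′
      not-shifted L₀ (zero _) eq = K.*-nonZero (Labelled.h≉0 L₀) t′≉0 (K.sym eq)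
      not-shifted L₀ (own L) eq with label-injective t′∈𝔽 L L₀ eq
      ... | ≡.refl with label-unique L L₀
      ... | ≡.refl = t≉self (Labelled.h≉0 L₀) t′≉1 eq
      not-shifted {h₀ = h₀} L₀ (shift {h} _ L) eq
        with label-injective (Kq.𝔽-* t′∈𝔽 (Kq.𝔽-⁻¹ t≉0 t∈𝔽)) L L₀
          (K.*-cancelʳ t≉0 (K.trans eq (K.trans (K.*-congˡ (K.sym (K.trans (K.*-assoc _ _ _)
            (K.trans (K.*-congˡ (K.⁻¹-inverseˡ t≉0)) (K.*-identityʳ t′))))) (K.sym (K.*-assoc _ _ _)))))
      ... | ≡.refl with label-unique L L₀
      ... | ≡.refl = t≉t′ (K.*-cancelˡ (Labelled.h≉0 L₀) eq)

      labelled-index : ∃[ i ] ∃[ h ] Labelled i h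
      labelled-index with class (index 1#) in eq
      ... | null 1≈0 = contradiction (trans (sym (element-index 1#)) 1≈0) 1≉0
      ... | fixed m≉0 inv = _ , partner-labelled (index 1#) m≉0 inv
      ... | orbit h m≉0 h≉0 describes = _ , h , labelled m≉0 h≉0 describes eq

      Θ : Carrier → K.Carrier
      Θ x = proj₁ (valued (index x))

      Θ-injective : ∀ {x y} → Θ x K.≈ Θ y → x ≈ y
      Θ-injective {x} {y} eq = index-injective
        (image-injective (proj₂ (valued (index x))) (proj₂ (valued (index y))) eq)

      missed : ∃[ i ] ∃[ h ] Labelled i h → ⊥
      missed (_ , h₀ , L₀) =
        let (x , eq) = TwoFields.injective⇒surjectiveᴷ S.F K (≡.sym orders) {Θ} Θ-injective (h₀ K.* t′)
        in not-shifted L₀ (proj₂ (valued (index x))) eq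

    scaled : ∀ {e} → e ≉ 0# → (∀ m → m ≉ 0# → Invariant [ m ] → Invariant [ e * m ] → ⊥) → ⊥
    scaled {e} e≉0 = pigeonhole (e *_) (*-cancelˡ e≉0) (*-nonZero e≉0)

    -- Multiplication by an e other than 0 and 1 must send some fixed slope m to a fixed slope, and
    -- e m differs from m.
    two-fixed : (∀ m m′ → m ≉ 0# → m′ ≉ 0# → m ≉ m′ → Invariant [ m ] → Invariant [ m′ ] → ⊥) → ⊥
    two-fixed goal with avoid (ℕ.≤-trans (ℕ.s≤s (ℕ.s≤s (ℕ.s≤s ℕ.z≤n))) 5≤order) (λ { 0F → 0# ; 1F → 1# })
    ... | e , e≉ = scaled (e≉ 0F) λ m m≉0 inv inv′ →
      goal m (e * m) m≉0 (*-nonZero (e≉ 0F) m≉0)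
        (λ m≈em → e≉ 1F (*-cancelʳ m≉0 (trans (sym m≈em) (sym (*-identityˡ m))))) inv inv′

    -- Besides 0 and 1, the factor e avoids both quotients of the two slopes already found. So m and
    -- e m cannot be exactly these two, and one of them is a third fixed slope.
    three-fixed : (∀ (m : Fin 3 → Carrier) → (∀ i → m i ≉ 0#) → (∀ {i j} → m i ≈ m j → i ≡ j) →
                   (∀ i → Invariant [ m i ]) → ⊥) → ⊥
    three-fixed goal = two-fixed λ m₁ m₂ m₁≉0 m₂≉0 m₁≉m₂ inv₁ inv₂ →
      let
        distinct : ∀ m → m ≉ m₁ → m ≉ m₂ → m ≉ 0# → Invariant [ m ] → ⊥
        distinct m m≉m₁ m≉m₂ m≉0 inv = goal
          (λ { 0F → m₁ ; 1F → m₂ ; 2F → m })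
          (λ { 0F → m₁≉0 ; 1F → m₂≉0 ; 2F → m≉0 })
          (λ { {0F} {0F} _ → ≡.refl ; {1F} {1F} _ → ≡.refl ; {2F} {2F} _ → ≡.refl
             ; {0F} {1F} eq → contradiction eq m₁≉m₂ ; {1F} {0F} eq → contradiction (sym eq) m₁≉m₂
             ; {0F} {2F} eq → contradiction (sym eq) m≉m₁ ; {2F} {0F} eq → contradiction eq m≉m₁
             ; {1F} {2F} eq → contradiction (sym eq) m≉m₂ ; {2F} {1F} eq → contradiction eq m≉m₂ })
          (λ { 0F → inv₁ ; 1F → inv₂ ; 2F → inv })
        (e , e≉) = avoid 5≤order (λ { 0F → 0# ; 1F → 1# ; 2F → m₁ * m₂ ⁻¹ ; 3F → m₂ * m₁ ⁻¹ })
        quotient : ∀ {a b} → a ≉ 0# → e * a ≈ b → e ≈ b * a ⁻¹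
        quotient {a} a≉0 ea≈b = trans (sym (*-identityʳ e)) (trans (*-congˡ (sym (⁻¹-inverseʳ a≉0)))
          (trans (sym (*-assoc e a _)) (*-congʳ ea≈b)))
        fresh : ∀ {m} → m ≉ 0# → e * m ≉ m
        fresh {m} m≉0 em≈m = e≉ 1F (*-cancelʳ m≉0 (trans em≈m (sym (*-identityˡ m))))
      in scaled (e≉ 0F) λ m m≉0 inv inv′ → third distinct m≉0 inv inv′ fresh
           (λ m≈m₁ em≈m₂ → e≉ 3F (quotient m₁≉0 (trans (*-congˡ (sym m≈m₁)) em≈m₂)))
           (λ m≈m₂ em≈m₁ → e≉ 2F (quotient m₂≉0 (trans (*-congˡ (sym m≈m₂)) em≈m₁)))
           (*-nonZero (e≉ 0F) m≉0)
      where
      third : ∀ {m₁ m₂ m e} → (∀ m → m ≉ m₁ → m ≉ m₂ → m ≉ 0# → Invariant [ m ] → ⊥) →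
        m ≉ 0# → Invariant [ m ] → Invariant [ e * m ] → (∀ {m} → m ≉ 0# → e * m ≉ m) →
        (m ≈ m₁ → e * m ≉ m₂) → (m ≈ m₂ → e * m ≉ m₁) → e * m ≉ 0# → ⊥
      third {m₁} {m₂} {m} {e} distinct m≉0 inv inv′ fresh 1↛2 2↛1 em≉0 with m ≟ m₁ | m ≟ m₂
      ... | no m≉m₁ | no m≉m₂ = distinct m m≉m₁ m≉m₂ m≉0 inv
      ... | yes m≈m₁ | _ = distinct (e * m) (λ eq → fresh m≉0 (trans eq (sym m≈m₁))) (1↛2 m≈m₁) em≉0 inv′
      ... | no _ | yes m≈m₂ = distinct (e * m) (2↛1 m≈m₂) (λ eq → fresh m≉0 (trans eq (sym m≈m₂))) em≉0 inv′

    open TwoFields K S.F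
    open AxisCases K S.F

    A B C D : K.Carrier → Carrier → Carrier
    A g x = proj₁ (act g (x , 0#))
    C g x = proj₂ (act g (x , 0#))
    B g y = proj₁ (act g (0# , y))
    D g y = proj₂ (act g (0# , y))

    first-+ : ∀ x y → (x + y , 0#) P.≈ᴹ (x , 0#) P.+ᴹ (y , 0#)
    first-+ x y = refl , sym (+-identityʳ 0#)

    second-+ : ∀ x y → (0# , x + y) P.≈ᴹ (0# , x) P.+ᴹ (0# , y)
    second-+ x y = sym (+-identityʳ 0#) , refl

    A-op : Operators A
    A-op = record { cong₂ = λ g≈h x≈y → proj₁ (act-cong g≈h (x≈y , refl))
                  ; +ˡ = λ g h x → proj₁ (act-+ˡ g h (x , 0#))
                  ; +ʳ = λ g x y → trans (proj₁ (act-cong {g} K.refl (first-+ x y))) (proj₁ (act-+ʳ g (x , 0#) (y , 0#))) }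
    C-op : Operators C
    C-op = record { cong₂ = λ g≈h x≈y → proj₂ (act-cong g≈h (x≈y , refl))
                  ; +ˡ = λ g h x → proj₂ (act-+ˡ g h (x , 0#))
                  ; +ʳ = λ g x y → trans (proj₂ (act-cong {g} K.refl (first-+ x y))) (proj₂ (act-+ʳ g (x , 0#) (y , 0#))) }
    B-op : Operators B
    B-op = record { cong₂ = λ g≈h x≈y → proj₁ (act-cong g≈h (refl , x≈y))
                  ; +ˡ = λ g h x → proj₁ (act-+ˡ g h (0# , x))
                  ; +ʳ = λ g x y → trans (proj₁ (act-cong {g} K.refl (second-+ x y))) (proj₁ (act-+ʳ g (0# , x) (0# , y))) }
    D-op : Operators D
    D-op = record { cong₂ = λ g≈h x≈y → proj₂ (act-cong g≈h (refl , x≈y))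
                  ; +ˡ = λ g h x → proj₂ (act-+ˡ g h (0# , x))
                  ; +ʳ = λ g x y → trans (proj₂ (act-cong {g} K.refl (second-+ x y))) (proj₂ (act-+ʳ g (0# , x) (0# , y))) }
    module A = Operators A-op
    module B = Operators B-op
    module C = Operators C-op
    module D = Operators D-op

    matrix : ∀ g x y → act g (x , y) P.≈ᴹ (A g x + B g y , C g x + D g y)
    matrix g x y = P.≈ᴹ-trans (act-cong K.refl (sym (+-identityʳ x) , sym (+-identityˡ y)))
      (act-+ʳ g (x , 0#) (0# , y))

    𝔽-subgroup : SubgroupPred (𝔽 K q)
    𝔽-subgroup = record { resp = Kq.𝔽-resp ; minus = Kq.𝔽-minus }

    opaque
      unfolding act

      𝔽-fixes : ∀ {s h g} → Describes s (Orbit h) → 𝔽 K q g → ∀ p → ray s p → ray s (act g p)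
      𝔽-fixes {s} {h} {g} describes g∈𝔽 p r = into describes (g V.*ₗ ψ⁻¹ p)
        (orbit-𝔽 g∈𝔽 (orbit-resp (K.*-comm g h) (orbit-act (describes-orbit describes p r))))

    invariant-∞-B : Invariant ∞ → ∀ g y → B g y ≈ 0#
    invariant-∞-B inv g y = fixes inv g (0# , y) refl

    invariant-0-C : Invariant [ 0# ] → ∀ g x → C g x ≈ 0#
    invariant-0-C inv g x = on-axis (fixes inv g (x , 0#) (axis x))

    fixed-graph : ∀ {m} → Invariant [ m ] → ∀ g x →
      C g x + D g (x S.∘ m) ≈ (A g x + B g (x S.∘ m)) S.∘ m
    fixed-graph {m} inv g x = trans (sym (proj₂ (matrix g x (x S.∘ m))))
      (trans (fixes inv g (x , x S.∘ m) refl) (∘-congʳ (proj₁ (matrix g x (x S.∘ m)))))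

    nonzero-outside-𝔽 : ∀ {g} → ¬ 𝔽 K q g → g K.≉ K.0#
    nonzero-outside-𝔽 g∉𝔽 g≈0 = g∉𝔽 (Kq.𝔽-resp (K.sym g≈0) Kq.𝔽-0)

    slope-cong : ∀ {m m′ p} → m ≈ m′ → ray [ m ] p → ray [ m′ ] p
    slope-cong m≈m′ r = trans r (Q.∘-cong refl m≈m′)

    -- For g outside 𝔽 the image of the first axis is a proper graph: it is not the axis itself, by
    -- `stabilizer`, nor the other axis, which is invariant. Hence g₀ acts by a scalar on the first
    -- coordinate, and `one-moved-axis` rules out two fixed graphs.
    first-axis-moved : Invariant ∞ → ∀ {h} → h K.≉ K.0# → Describes [ 0# ] (Orbit h) → ⊥
    first-axis-moved inv∞ {h} h≉0 describes = two-fixed contradictory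
      where
      graph : ∀ g → ¬ 𝔽 K q g → ∃[ T ] (∀ x → C g x ≈ to T (A g x))
      graph g g∉𝔽 = at (orbit-slope gh≉0)
        where
        g≉0 = nonzero-outside-𝔽 g∉𝔽
        gh≉0 = K.*-nonZero g≉0 h≉0
        finite : ∀ m → Describes [ m ] (Orbit (g K.* h)) → Dec (m ≈ 0#) → ∃[ T ] (∀ x → C g x ≈ to T (A g x))
        finite m describes′ (no m≉0) = multiplier m≉0 , λ x → moved describes describes′ (x , 0#) (axis x)
        finite m describes′ (yes m≈0) = contradiction
          (stabilizer {[ 0# ]} {h} {g} {1# , 0#} h≉0 g≉0 describes (λ (eq , _) → 1≉0 eq) (axis 1#)
            (slope-cong m≈0 (moved describes describes′ (1# , 0#) (axis 1#)))) g∉𝔽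
        at : ∃[ s ] Describes s (Orbit (g K.* h)) → ∃[ T ] (∀ x → C g x ≈ to T (A g x))
        at (∞     , describes′) = contradiction inv∞ (orbit-not-invariant gh≉0 g₀∉𝔽 describes′)
        at ([ m ] , describes′) = finite m describes′ (m ≟ 0#)

      free : ∀ {g x} → g K.≉ K.0# → A g x ≈ 0# → C g x ≈ 0# → x ≈ 0#
      free g≉0 A≈0 C≈0 = proj₁ (act-free g≉0 (A≈0 , C≈0))

      module Axis = AxisAction A-op C-op free 𝔽-subgroup graph Kq.𝔽-1 t∈𝔽 t≉0 (λ eq → t≉1 (K.sym eq))
        (λ x → proj₁ (act-1 (x , 0#))) (λ x → proj₂ (act-1 (x , 0#)))
        (λ x → on-axis (𝔽-fixes describes t∈𝔽 (x , 0#) (axis x)))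

      T : SL
      T = proj₁ (graph g₀ g₀∉𝔽)
      C≈ : ∀ x → C g₀ x ≈ to T (A g₀ x)
      C≈ = proj₂ (graph g₀ g₀∉𝔽)

      a≉0 : A g₀ 1# ≉ 0#
      a≉0 a≈0 = 1≉0 (free (nonzero-outside-𝔽 g₀∉𝔽) a≈0 (trans (C≈ 1#) (trans (to-cong T a≈0) (to-0 T))))

      contradictory : ∀ m m′ → m ≉ 0# → m′ ≉ 0# → m ≉ m′ → Invariant [ m ] → Invariant [ m′ ] → ⊥
      contradictory m m′ m≉0 m′≉0 m≉m′ inv inv′ = one-moved-axis T a≉0 (C g₀) (D g₀)
        (λ x → trans (C≈ x) (to-cong T (Axis.scalar g₀ g₀∉𝔽 x))) (D.cong₂ K.refl)
        (multiplier m≉0) (multiplier m′≉0) distinct (fixed′ inv) (fixed′ inv′)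
        where
        fixed′ : ∀ {m} → Invariant [ m ] → ∀ x → C g₀ x + D g₀ (x S.∘ m) ≈ (A g₀ 1# * x) S.∘ m
        fixed′ inv x = trans (fixed-graph inv g₀ x) (∘-congʳ
          (trans (+-cong (Axis.scalar g₀ g₀∉𝔽 x) (invariant-∞-B inv∞ g₀ _)) (+-identityʳ _)))
        -- Equal preimages x of 1 would make (x , 1) a common nonzero point of the rays of slopes m
        -- and m′.
        distinct : from (multiplier m≉0) 1# ≉ from (multiplier m′≉0) 1#
        distinct eq = apart (compare [ m ] [ m′ ])
          where
          apart : Comparison [ m ] [ m′ ] → ⊥
          apart (parallel ⊆) = m≉m′ (trans (sym (1∘ m≉0)) (trans (⊆ {1# , 1# S.∘ m} refl) (1∘ m′≉0)))
          apart (crossing only-0 _) = 1≉0 (proj₂ (only-0 {from (multiplier m≉0) 1# , 1#}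
                (sym (to-from (multiplier m≉0) 1#))
                (trans (sym (to-from (multiplier m′≉0) 1#)) (∘-congʳ (sym eq)))))

    -- The first case with the coordinates exchanged. A ray of slope m is now read over the second
    -- axis, as the graph of the inverse of the multiplier of m.
    second-axis-moved : Invariant [ 0# ] → ∀ {h} → h K.≉ K.0# → Describes ∞ (Orbit h) → ⊥
    second-axis-moved inv0 {h} h≉0 describes = two-fixed contradictory
      where
      graph : ∀ g → ¬ 𝔽 K q g → ∃[ T ] (∀ y → B g y ≈ to T (D g y))
      graph g g∉𝔽 = at (orbit-slope gh≉0)
        where
        g≉0 = nonzero-outside-𝔽 g∉𝔽
        gh≉0 = K.*-nonZero g≉0 h≉0
        finite : ∀ m → Describes [ m ] (Orbit (g K.* h)) → Dec (m ≈ 0#) → ∃[ T ] (∀ y → B g y ≈ to T (D g y))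
        finite m describes′ (no m≉0) = inverse (multiplier m≉0) , λ y → trans (sym (from-to (multiplier m≉0) _))
          (from-cong (multiplier m≉0) (sym (moved describes describes′ (0# , y) refl)))
        finite m describes′ (yes m≈0) = contradiction (invariant-resp (sym m≈0) inv0)
          (orbit-not-invariant gh≉0 g₀∉𝔽 describes′)
        at : ∃[ s ] Describes s (Orbit (g K.* h)) → ∃[ T ] (∀ y → B g y ≈ to T (D g y))
        at (∞     , describes′) = contradiction
          (stabilizer {∞} {h} {g} {0# , 1#} h≉0 g≉0 describes (λ (_ , eq) → 1≉0 eq) refl
            (moved describes describes′ (0# , 1#) refl)) g∉𝔽
        at ([ m ] , describes′) = finite m describes′ (m ≟ 0#)

      free : ∀ {g y} → g K.≉ K.0# → D g y ≈ 0# → B g y ≈ 0# → y ≈ 0#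
      free g≉0 D≈0 B≈0 = proj₂ (act-free g≉0 (B≈0 , D≈0))

      module Axis = AxisAction D-op B-op free 𝔽-subgroup graph Kq.𝔽-1 t∈𝔽 t≉0 (λ eq → t≉1 (K.sym eq))
        (λ y → proj₂ (act-1 (0# , y))) (λ y → proj₁ (act-1 (0# , y)))
        (λ y → 𝔽-fixes describes t∈𝔽 (0# , y) refl)

      T : SL
      T = proj₁ (graph g₀ g₀∉𝔽)
      B≈ : ∀ y → B g₀ y ≈ to T (D g₀ y)
      B≈ = proj₂ (graph g₀ g₀∉𝔽)

      d≉0 : D g₀ 1# ≉ 0#
      d≉0 d≈0 = 1≉0 (free (nonzero-outside-𝔽 g₀∉𝔽) d≈0 (trans (B≈ 1#) (trans (to-cong T d≈0) (to-0 T))))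

      contradictory : ∀ m m′ → m ≉ 0# → m′ ≉ 0# → m ≉ m′ → Invariant [ m ] → Invariant [ m′ ] → ⊥
      contradictory m m′ m≉0 m′≉0 m≉m′ inv inv′ = one-moved-axis T d≉0 (B g₀) (A g₀)
        (λ y → trans (B≈ y) (to-cong T (Axis.scalar g₀ g₀∉𝔽 y))) (A.cong₂ K.refl)
        (inverse (multiplier m≉0)) (inverse (multiplier m′≉0))
        (λ eq → m≉m′ (trans (sym (1∘ m≉0)) (trans eq (1∘ m′≉0)))) (fixed′ m≉0 inv) (fixed′ m′≉0 inv′)
        where
        fixed′ : ∀ {m} (m≉0 : m ≉ 0#) → Invariant [ m ] → ∀ y →
          B g₀ y + A g₀ (from (multiplier m≉0) y) ≈ from (multiplier m≉0) (D g₀ 1# * y)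
        fixed′ {m} m≉0 inv y = trans (+-comm _ _) (trans
          (sym (trans (from-cong M (sym image-point)) (from-to M _)))
          (from-cong M (trans (D.cong₂ K.refl (to-from M y)) (Axis.scalar g₀ g₀∉𝔽 y))))
          where
          M = multiplier m≉0
          x = from M y
          image-point : (A g₀ x + B g₀ y) S.∘ m ≈ D g₀ (x S.∘ m)
          image-point = trans (∘-congʳ (+-congˡ (B.cong₂ K.refl (sym (to-from M y)))))
            (trans (sym (fixed-graph inv g₀ x)) (trans (+-congʳ (invariant-0-C inv0 g₀ x)) (+-identityˡ _)))

    -- A decidable proper subgroup containing 𝔽 and k 𝔽. In `both-axes-moved` these are the elements
    -- that keep the first axis or carry it to the second, so every g outside W carries it to a
    -- proper graph.
    record ProperHull (k : K.Carrier) : Set (c ⊔ Level.suc ℓ) where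
      field
        W        : K.Carrier → Set ℓ
        subgroup : SubgroupPred W
        W?       : ∀ g → Dec (W g)
        𝔽⊆W      : ∀ {t} → 𝔽 K q t → W t
        k𝔽⊆W     : ∀ {t} → 𝔽 K q t → W (k K.* t)
        outsider : K.Carrier
        outside  : ¬ W outsider

    both-axes-moved : (∀ k → ProperHull k) → ∀ {h₀ h₁} → h₀ K.≉ K.0# → h₁ K.≉ K.0# →
      Describes [ 0# ] (Orbit h₀) → Describes ∞ (Orbit h₁) → ⊥
    both-axes-moved hull {h₀} {h₁} h₀≉0 h₁≉0 describes₀ describes₁ = three-fixed contradictory
      where
      -- The axes are the components h₀U and h₁U, so k = h₁ / h₀ carries the first to the second.
      k : K.Carrier
      k = h₁ K.* h₀ K.⁻¹
      kh₀≈h₁ : k K.* h₀ K.≈ h₁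
      kh₀≈h₁ = K.trans (K.*-assoc _ _ _) (K.trans (K.*-congˡ (K.⁻¹-inverseˡ h₀≉0)) (K.*-identityʳ h₁))
      k≉0 : k K.≉ K.0#
      k≉0 = K.*-nonZero h₁≉0 (K.⁻¹-nonZero h₀≉0)

      open ProperHull (hull k)
      module W = SubgroupPred subgroup

      free : ∀ {g x} → g K.≉ K.0# → A g x ≈ 0# → C g x ≈ 0# → x ≈ 0#
      free g≉0 A≈0 C≈0 = proj₁ (act-free g≉0 (A≈0 , C≈0))

      A-1 : ∀ x → A K.1# x ≈ x
      A-1 x = proj₁ (act-1 (x , 0#))
      C-1 : ∀ x → C K.1# x ≈ 0#
      C-1 x = proj₂ (act-1 (x , 0#))

      A-k𝔽 : ∀ {g} → 𝔽 K q g → ∀ x → A (k K.* g) x ≈ 0#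
      A-k𝔽 {g} g∈𝔽 x = orbit-describes describes₁ (act (k K.* g) (x , 0#))
        (orbit-𝔽 g∈𝔽 (orbit-resp (K.trans (K.solve 3 (λ k g h → k K.:* g K.:* h K.:= k K.:* h K.:* g) K.refl k g h₀)
                                          (K.*-congʳ kh₀≈h₁))
          (orbit-of-act describes₀ (k K.* g) (x , 0#) (axis x))))

      A-k : ∀ x → A k x ≈ 0#
      A-k x = trans (A.cong₂ (K.sym (K.*-identityʳ k)) refl) (A-k𝔽 Kq.𝔽-1 x)

      Graph : K.Carrier → Set (c′ ⊔ ℓ′)
      Graph g = ∃[ m ] ∃[ m≉0 ] (∀ x → C g x ≈ to (multiplier {m} m≉0) (A g x))

      graph-or : ∀ g → g K.≉ K.0# → Graph g ⊎ (𝔽 K q g ⊎ ∃[ s ] (𝔽 K q s × g K.≈ k K.* s))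
      graph-or g g≉0 = at (orbit-slope gh≉0)
        where
        gh≉0 = K.*-nonZero g≉0 h₀≉0
        finite : ∀ m → Describes [ m ] (Orbit (g K.* h₀)) → Dec (m ≈ 0#) →
                 Graph g ⊎ (𝔽 K q g ⊎ ∃[ s ] (𝔽 K q s × g K.≈ k K.* s))
        finite m describes (no m≉0) = inj₁ (m , m≉0 , λ x → moved describes₀ describes (x , 0#) (axis x))
        finite m describes (yes m≈0) = inj₂ (inj₁
          (stabilizer {[ 0# ]} {h₀} {g} {1# , 0#} h₀≉0 g≉0 describes₀ (λ (eq , _) → 1≉0 eq) (axis 1#)
            (slope-cong m≈0 (moved describes₀ describes (1# , 0#) (axis 1#)))))
        at : ∃[ s ] Describes s (Orbit (g K.* h₀)) → Graph g ⊎ (𝔽 K q g ⊎ ∃[ s ] (𝔽 K q s × g K.≈ k K.* s))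
        at ([ m ] , describes) = finite m describes (m ≟ 0#)
        at (∞ , describes) = let (s , s∈𝔽 , _ , gh₀≈) = same-slope h₁≉0 gh≉0 describes₁ describes in
          inj₂ (inj₂ (s , s∈𝔽 , K.*-cancelʳ h₀≉0 (K.trans gh₀≈ (K.trans (K.*-congʳ (K.sym kh₀≈h₁))
            (K.solve 3 (λ k h s → k K.:* h K.:* s K.:= k K.:* s K.:* h) K.refl k h₀ s)))))

      graph-outside : ∀ g → ¬ W g → Graph g
      graph-outside g g∉W = pick (graph-or g (λ g≈0 → g∉W (W.resp (K.sym g≈0) (𝔽⊆W Kq.𝔽-0))))
        where
        pick : Graph g ⊎ (𝔽 K q g ⊎ ∃[ s ] (𝔽 K q s × g K.≈ k K.* s)) → Graph g
        pick (inj₁ graph) = graph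
        pick (inj₂ (inj₁ g∈𝔽)) = contradiction (𝔽⊆W g∈𝔽) g∉W
        pick (inj₂ (inj₂ (s , s∈𝔽 , g≈))) = contradiction (W.resp (K.sym g≈) (k𝔽⊆W s∈𝔽)) g∉W

      A-1+k : ∀ x → A (K.1# K.+ k) x ≈ x
      A-1+k x = trans (A.+ˡ K.1# k x) (trans (+-cong (A-1 x) (A-k x)) (+-identityʳ x))
      C-1+k : ∀ x → C (K.1# K.+ k) x ≈ C k x
      C-1+k x = trans (C.+ˡ K.1# k x) (trans (+-congʳ (C-1 x)) (+-identityˡ _))

      -- The graph of multiplication by k from the first axis to the second.
      graph-k : ∃[ Q ] (∀ x → C k x ≈ to Q x)
      -- 1 + k sends (x , 0) to (x , C k x), so the image of the first axis is the graph of C k.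
      -- Membership of 1 + k in 𝔽 or in k 𝔽 would make one of the two coordinates vanish.
      graph-k = pick (graph-or (K.1# K.+ k) 1+k≉0)
        where
        1+k≉0 : K.1# K.+ k K.≉ K.0#
        1+k≉0 eq = 1≉0 (trans (sym (A-1+k 1#)) (trans (A.cong₂ eq refl) (proj₁ (act-0ˡ (1# , 0#)))))
        pick : Graph (K.1# K.+ k) ⊎ (𝔽 K q (K.1# K.+ k) ⊎ ∃[ s ] (𝔽 K q s × K.1# K.+ k K.≈ k K.* s)) →
               ∃[ Q ] (∀ x → C k x ≈ to Q x)
        pick (inj₁ (m , m≉0 , C≈)) = multiplier m≉0 , λ x →
          trans (sym (C-1+k x)) (trans (C≈ x) (to-cong (multiplier m≉0) (A-1+k x)))
        pick (inj₂ (inj₁ 1+k∈𝔽)) = contradiction (free k≉0 (A-k 1#) (trans (sym (C-1+k 1#))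
          (on-axis (𝔽-fixes describes₀ 1+k∈𝔽 (1# , 0#) (axis 1#))))) 1≉0
        pick (inj₂ (inj₂ (s , s∈𝔽 , eq))) = contradiction
          (trans (sym (A-1+k 1#)) (trans (A.cong₂ eq refl) (A-k𝔽 s∈𝔽 1#))) 1≉0

      Q : SL
      Q = proj₁ graph-k

      -- Second coordinates are pulled back along Q, so that k becomes (x , 0) ↦ (0 , x), the
      -- normalization of `TwoMovedAxes`.
      C′ : K.Carrier → Carrier → Carrier
      C′ g x = from Q (C g x)

      C′-op : Operators C′
      C′-op = record
        { cong₂ = λ g≈h x≈y → from-cong Q (C.cong₂ g≈h x≈y)
        ; +ˡ = λ g h x → trans (from-cong Q (C.+ˡ g h x)) (to-+ (inverse Q) _ _)
        ; +ʳ = λ g x y → trans (from-cong Q (C.+ʳ g x y)) (to-+ (inverse Q) _ _) }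

      C≈0 : ∀ {g x} → C′ g x ≈ 0# → C g x ≈ 0#
      C≈0 eq = trans (sym (to-from Q _)) (trans (to-cong Q eq) (to-0 Q))

      C′≈0 : ∀ {g x} → C g x ≈ 0# → C′ g x ≈ 0#
      C′≈0 eq = trans (from-cong Q eq) (from-0 Q)

      second-by-k : ∀ y → (0# , y) P.≈ᴹ act k (from Q y , 0#)
      second-by-k y = sym (A-k (from Q y)) , sym (trans (proj₂ graph-k (from Q y)) (to-from Q y))

      split : ∀ g x y → act g (x , y) P.≈ᴹ (A g x + A (g K.* k) (from Q y) , C g x + C (g K.* k) (from Q y))
      split g x y = P.≈ᴹ-trans (act-cong K.refl (sym (+-identityʳ x) , sym (+-identityˡ y)))
        (P.≈ᴹ-trans (act-+ʳ g (x , 0#) (0# , y)) (P.+ᴹ-cong (P.≈ᴹ-refl {act g (x , 0#)})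
          (P.≈ᴹ-trans (act-cong K.refl (second-by-k y)) (P.≈ᴹ-sym (act-* g k (from Q y , 0#))))))

      product : ∀ g h x → act (g K.* h) (x , 0#) P.≈ᴹ
        (A g (A h x) + A (g K.* k) (C′ h x) , C g (A h x) + C (g K.* k) (C′ h x))
      product g h x = P.≈ᴹ-trans (act-* g h (x , 0#)) (split g (A h x) (C h x))

      stabilizer-in-W : ∀ g → (∀ x → C′ g x ≈ 0#) → W g × W (k K.* g)
      stabilizer-in-W g C′≈ = 𝔽⊆W g∈𝔽 , k𝔽⊆W g∈𝔽
        where
        decide : Dec (g K.≈ K.0#) → 𝔽 K q g
        decide (yes g≈0) = Kq.𝔽-resp (K.sym g≈0) Kq.𝔽-0
        decide (no  g≉0) = stabilizer {[ 0# ]} {h₀} {g} {1# , 0#} h₀≉0 g≉0 describes₀ (λ (eq , _) → 1≉0 eq) (axis 1#)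
          (trans (C≈0 (C′≈ 1#)) (sym (S.∘-zero _)))
        g∈𝔽 : 𝔽 K q g
        g∈𝔽 = decide (g K.≟ K.0#)

      contradictory : ∀ (m : Fin 3 → Carrier) → (∀ i → m i ≉ 0#) → (∀ {i j} → m i ≈ m j → i ≡ j) →
                      (∀ i → Invariant [ m i ]) → ⊥
      contradictory m m≉0 m-distinct inv = TwoMovedAxes.impossible orders A-op C′-op k
        A-1 (λ x → C′≈0 (C-1 x)) A-k (λ x → trans (from-cong Q (proj₂ graph-k x)) (from-to Q x))
        (λ g h x → proj₁ (product g h x))
        (λ g h x → trans (from-cong Q (proj₂ (product g h x))) (to-+ (inverse Q) _ _))
        (λ g≉0 A≈ C′≈ → free g≉0 A≈ (C≈0 C′≈))
        subgroup W? t≉0 t≉1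
        (λ x → C′≈0 (on-axis (𝔽-fixes describes₀ t∈𝔽 (x , 0#) (axis x)))) (A-k𝔽 t∈𝔽)
        (𝔽⊆W Kq.𝔽-1) (𝔽⊆W t∈𝔽) (W.resp (K.*-identityʳ k) (k𝔽⊆W Kq.𝔽-1)) (k𝔽⊆W t∈𝔽)
        (λ g g∉W → let (μ , μ≉0 , C≈) = graph-outside g g∉W in
          inverse Q ⊙ multiplier μ≉0 , λ x → from-cong Q (C≈ x))
        stabilizer-in-W outside
        (λ i → inverse Q ⊙ multiplier (m≉0 i))
        (λ {i} {j} eq → m-distinct (trans (sym (1∘ (m≉0 i))) (trans (to-injective (inverse Q) eq) (1∘ (m≉0 j)))))
        (λ i g x → trans (from-cong Q (trans
            (to-cong (multiplier (m≉0 i)) (sym (proj₁ (split g x (x S.∘ m i)))))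
            (trans (sym (fixes (inv i) g (x , x S.∘ m i) refl)) (proj₂ (split g x (x S.∘ m i))))))
          (to-+ (inverse Q) _ _))

    both-axes-fixed : ∀ {v₀ v₁} → ¬ v₀ V.≈ᴹ V.0ᴹ → ¬ v₁ V.≈ᴹ V.0ᴹ →
      Describes [ 0# ] (⟨_⟩ K v₀) → Describes ∞ (⟨_⟩ K v₁) → SemilinearGraph
    both-axes-fixed {v₀} {v₁} v₀≉0 v₁≉0 describes₀ describes₁ = at (orbit-slope K.1≉0)
      where
      inv₀ : Invariant [ 0# ]
      inv₀ = span-invariant describes₀
      inv₁ : Invariant ∞
      inv₁ = span-invariant describes₁

      C≈0 : ∀ g x → C g x ≈ 0#
      C≈0 = invariant-0-C inv₀
      B≈0 : ∀ g y → B g y ≈ 0#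
      B≈0 = invariant-∞-B inv₁

      diagonal : ∀ g x y → act g (x , y) P.≈ᴹ (A g x , D g y)
      diagonal g x y = P.≈ᴹ-trans (matrix g x y)
        (trans (+-congˡ (B≈0 g y)) (+-identityʳ _) , trans (+-congʳ (C≈0 g x)) (+-identityˡ _))

      A-free : ∀ {g x} → g K.≉ K.0# → A g x ≈ 0# → x ≈ 0#
      A-free {g} {x} g≉0 eq = proj₁ (act-free {g} {x , 0#} g≉0 (eq , C≈0 g x))
      D-free : ∀ {g y} → g K.≉ K.0# → D g y ≈ 0# → y ≈ 0#
      D-free {g} {y} g≉0 eq = proj₂ (act-free {g} {0# , y} g≉0 (B≈0 g y , eq))

      orbit-injective : ∀ {P : K.Carrier → Carrier → Carrier} → Operators P →
        (∀ {g x} → g K.≉ K.0# → P g x ≈ 0# → x ≈ 0#) →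
        ∀ {x} → x ≉ 0# → ∀ {g h} → P g x ≈ P h x → g K.≈ h
      orbit-injective P-op P-free {x} x≉0 {g} {h} eq = decide (g K.- h K.≟ K.0#)
        where
        decide : Dec (g K.- h K.≈ K.0#) → g K.≈ h
        decide (yes g-h≈0) = K.x-y≈0⇒x≈y g h g-h≈0
        decide (no  g-h≉0) = contradiction
          (P-free g-h≉0 (trans (Operators.minusˡ P-op g h x) (x≈y⇒x-y≈0 eq))) x≉0

      A-onto : ∀ {x} → x ≉ 0# → ∀ y → ∃[ g ] A g x ≈ y
      A-onto {x} x≉0 = injective⇒surjectiveᴷ orders {λ g → A g x} (orbit-injective A-op A-free x≉0)
      D-onto : ∀ {y} → y ≉ 0# → ∀ z → ∃[ g ] D g y ≈ z
      D-onto {y} y≉0 = injective⇒surjectiveᴷ orders {λ g → D g y} (orbit-injective D-op D-free y≉0)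

      A-* : ∀ g h x → A (g K.* h) x ≈ A g (A h x)
      A-* g h x = trans (proj₁ (act-* g h (x , 0#))) (proj₁ (act-cong (K.refl {g}) (refl , C≈0 h x)))
      D-* : ∀ g h y → D (g K.* h) y ≈ D g (D h y)
      D-* g h y = trans (proj₂ (act-* g h (0# , y))) (proj₂ (act-cong (K.refl {g}) (B≈0 h y , refl)))

      D-comm : ∀ g h y → D g (D h y) ≈ D h (D g y)
      D-comm g h y = trans (sym (D-* g h y)) (trans (D.cong₂ (K.*-comm g h) refl) (D-* h g y))

      intertwines : ∀ {m} → Invariant [ m ] → ∀ g x → D g (x S.∘ m) ≈ A g x S.∘ m
      intertwines {m} inv g x = trans (sym (proj₂ (diagonal g x (x S.∘ m))))
        (trans (fixes inv g (x , x S.∘ m) refl) (∘-congʳ (proj₁ (diagonal g x (x S.∘ m)))))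

      -- By the pigeonhole principle D g maps some fixed slope m to a fixed slope m′, and then
      -- D g is the quotient of the two multipliers.
      D-semilinear : ∀ g → g K.≉ K.0# → (∀ (T : SL) → (∀ y → D g y ≈ to T y) → ⊥) → ⊥
      D-semilinear g g≉0 goal = pigeonhole (D g) D-injective (λ y≉0 eq → y≉0 (D-free g≉0 eq)) quotient
        where
        D-injective : ∀ {x y} → D g x ≈ D g y → x ≈ y
        D-injective {x} {y} eq = x-y≈0⇒x≈y x y (D-free g≉0 (trans (D.minusʳ g x y) (x≈y⇒x-y≈0 eq)))
        quotient : ∀ m → m ≉ 0# → Invariant [ m ] → Invariant [ D g m ] → ⊥
        quotient m m≉0 inv inv′ = goal (M′ ⊙ inverse M) λ y →
          trans (D.cong₂ K.refl (sym (to-from M y))) (agree (from M y))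
          where
          m′≉0 : D g m ≉ 0#
          m′≉0 eq = m≉0 (D-free g≉0 eq)
          M = multiplier m≉0
          M′ = multiplier m′≉0
          -- Every x is A h 1 for some h. Since D g commutes with D h, its value at the single point
          -- m determines it along the whole graph.
          agree-on-orbit : ∀ h → D g (A h 1# S.∘ m) ≈ A h 1# S.∘ D g m
          agree-on-orbit h = begin
            D g (A h 1# S.∘ m)      ≈⟨ D.cong₂ K.refl (intertwines inv h 1#) ⟨
            D g (D h (1# S.∘ m))    ≈⟨ D-comm g h (1# S.∘ m) ⟩
            D h (D g (1# S.∘ m))    ≈⟨ D.cong₂ (K.refl {h}) (trans (D.cong₂ (K.refl {g}) (1∘ m≉0)) (sym (1∘ m′≉0))) ⟩
            D h (1# S.∘ D g m)      ≈⟨ intertwines inv′ h 1# ⟩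
            A h 1# S.∘ D g m        ∎
            where open import Relation.Binary.Reasoning.Setoid setoid
          agree : ∀ x → D g (x S.∘ m) ≈ x S.∘ D g m
          agree x = let (h , eq) = A-onto 1≉0 x in
            trans (D.cong₂ K.refl (∘-congʳ (sym eq))) (trans (agree-on-orbit h) (∘-congʳ eq))

      D-1 : ∀ y → D K.1# y ≈ y
      D-1 y = proj₂ (act-1 (0# , y))

      -- D g, the identity and D (g + 1) satisfy a relation with nonzero coefficients, so they share
      -- one character, the trivial one. This needs g and g + 1 nonzero; the other two cases are
      -- direct. The equation is decided first because `D-semilinear` only refutes.
      D-scalar : ∀ g y → D g y ≈ D g 1# * y
      D-scalar g y = decide (D g y ≟ D g 1# * y) (g K.≟ K.0#) (g K.+ K.1# K.≟ K.0#)
        where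
        decide : Dec (D g y ≈ D g 1# * y) → Dec (g K.≈ K.0#) → Dec (g K.+ K.1# K.≈ K.0#) → D g y ≈ D g 1# * y
        decide (yes eq) _ _ = eq
        decide (no _) (yes g≈0) _ = trans (zero-at y) (sym (trans (*-congʳ (zero-at 1#)) (zeroˡ y)))
          where
          zero-at : ∀ y → D g y ≈ 0#
          zero-at y = trans (D.cong₂ g≈0 refl) (proj₂ (act-0ˡ (0# , y)))
        decide (no _) (no _) (yes g+1≈0) = trans (minus-at y)
          (trans (sym (trans (sym (-‿distribˡ-* 1# y)) (-‿cong (*-identityˡ y)))) (*-congʳ (sym (minus-at 1#))))
          where
          minus-at : ∀ y → D g y ≈ - y
          minus-at y = +-cancelʳ y _ _ (trans (+-congˡ (sym (D-1 y))) (trans (sym (D.+ˡ g K.1# y))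
            (trans (D.cong₂ g+1≈0 refl) (trans (proj₂ (act-0ˡ (0# , y))) (sym (-‿inverseˡ y))))))
        decide (no ≉scalar) (no g≉0) (no g+1≉0) = ⊥-elim
          (D-semilinear g g≉0 λ T T≈ → D-semilinear (g K.+ K.1#) g+1≉0 λ T′ T′≈ →
            ≉scalar (trans (T≈ y) (trans (to-Scalar T (scalar T T≈ T′ T′≈) y) (*-congʳ (sym (T≈ 1#))))))
          where
          scalar : ∀ T → (∀ y → D g y ≈ to T y) → ∀ T′ → (∀ y → D (g K.+ K.1#) y ≈ to T′ y) → Scalar T
          scalar T T≈ T′ T′≈ = all-equal₃ (to T 1#) (character T) 1# trivial (- to T′ 1#) (character T′)
            (to-1≉0 T) 1≉0 (λ eq → to-1≉0 T′ (trans (solve 1 (λ x → x := :- (:- x)) refl (to T′ 1#))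
                                                   (trans (-‿cong eq) -0#≈0#)))
            λ x → trans (+-cong (sym (to-χ T x)) (+-cong (*-identityˡ x)
                    (trans (sym (-‿distribˡ-* _ _)) (-‿cong (sym (to-χ T′ x))))))
                  (trans (sym (+-assoc _ _ _)) (x≈y⇒x-y≈0 (trans (+-cong (sym (T≈ x)) (sym (D-1 x)))
                    (trans (sym (D.+ˡ g K.1# x)) (T′≈ x)))))

      -- The multiplier M of a fixed slope conjugates A g into D g, and conjugating a scalar by a
      -- semilinear map gives a scalar.
      A-scalar : ∀ g x → A g x ≈ A g 1# * x
      A-scalar g x = decide (A g x ≟ A g 1# * x)
        where
        decide : Dec (A g x ≈ A g 1# * x) → A g x ≈ A g 1# * x
        decide (yes eq) = eq
        decide (no ≉scalar) = ⊥-elim (two-fixed λ m _ m≉0 _ _ inv _ → ≉scalar (by-multiplier m≉0 inv))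
          where
          by-multiplier : ∀ {m} → m ≉ 0# → Invariant [ m ] → A g x ≈ A g 1# * x
          by-multiplier {m} m≉0 inv = trans (A≈ x) (*-congʳ (sym (trans (A≈ 1#) (*-identityʳ _))))
            where
            M = multiplier m≉0
            A≈ : ∀ x → A g x ≈ χ (character (inverse M)) (D g 1#) * x
            A≈ x = begin
              A g x                                     ≈⟨ from-to M _ ⟨
              from M (A g x S.∘ m)                      ≈⟨ from-cong M (intertwines inv g x) ⟨
              from M (D g (x S.∘ m))                    ≈⟨ from-cong M (D-scalar g _) ⟩
              from M (D g 1# * (x S.∘ m))               ≈⟨ to-scale (inverse M) _ _ ⟩
              χ (character (inverse M)) (D g 1#) * from M (x S.∘ m) ≈⟨ *-congˡ (from-to M x) ⟩
              χ (character (inverse M)) (D g 1#) * x    ∎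
              where open import Relation.Binary.Reasoning.Setoid setoid

      in-span : ∀ v → ⟨_⟩ K v v
      in-span v = K.1# , V.≈ᴹ-sym (V.*ₗ-identityˡ v)

      ψ-nonzero : ∀ {v} → ¬ v V.≈ᴹ V.0ᴹ → ¬ ψ v P.≈ᴹ P.0ᴹ
      ψ-nonzero v≉0 eq = v≉0 (ψ-injective (P.≈ᴹ-trans eq (P.≈ᴹ-sym ψ-0)))

      x₀ y₁ : Carrier
      x₀ = proj₁ (ψ v₀)
      y₁ = proj₂ (ψ v₁)
      ψv₀ : ψ v₀ P.≈ᴹ (x₀ , 0#)
      ψv₀ = refl , on-axis {x₀} (into describes₀ v₀ (in-span v₀))
      ψv₁ : ψ v₁ P.≈ᴹ (0# , y₁)
      ψv₁ = into describes₁ v₁ (in-span v₁) , refl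
      x₀≉0 : x₀ ≉ 0#
      x₀≉0 eq = ψ-nonzero v₀≉0 (P.≈ᴹ-trans ψv₀ (eq , refl))
      y₁≉0 : y₁ ≉ 0#
      y₁≉0 eq = ψ-nonzero v₁≉0 (P.≈ᴹ-trans ψv₁ (refl , eq))

      coordinates : ∀ g h → ψ (g V.*ₗ v₀ V.+ᴹ h V.*ₗ v₁) P.≈ᴹ (A g x₀ , D h y₁)
      coordinates g h = P.≈ᴹ-trans (ψ-+ _ _) (P.≈ᴹ-trans
        (P.+ᴹ-cong (P.≈ᴹ-trans (ψ-act g v₀) (P.≈ᴹ-trans (act-cong K.refl ψv₀) (diagonal g x₀ 0#)))
                   (P.≈ᴹ-trans (ψ-act h v₁) (P.≈ᴹ-trans (act-cong K.refl ψv₁) (diagonal h 0# y₁))))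
        ( trans (+-congˡ (A.0ʳ h)) (+-identityʳ _) , trans (+-congʳ (D.0ʳ g)) (+-identityˡ _)))

      at : ∃[ s ] Describes s (Orbit K.1#) → SemilinearGraph
      at (∞ , describes) = contradiction inv₁ (orbit-not-invariant K.1≉0 g₀∉𝔽 describes)
      at ([ m ] , describes) = finite (m ≟ 0#)
        where
        finite : Dec (m ≈ 0#) → SemilinearGraph
        finite (yes m≈0) = contradiction (invariant-resp (sym m≈0) inv₀) (orbit-not-invariant K.1≉0 g₀∉𝔽 describes)
        finite (no m≉0) = record
          { v₀ = v₀ ; v₁ = v₁
          ; independent = λ g h eq → let eq′ = P.≈ᴹ-trans (P.≈ᴹ-sym (coordinates g h)) (P.≈ᴹ-trans (ψ-cong eq) ψ-0) in
              A-zero (trans (proj₁ eq′) (sym (proj₁ (act-0ˡ (x₀ , 0#))))) ,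
              D-zero (trans (proj₂ eq′) (sym (proj₂ (act-0ˡ (0# , y₁)))))
          ; η = η
          ; η-cong = λ g≈h → D-zero (trans (η≈ _) (trans (to-cong T (A.cong₂ g≈h refl)) (sym (η≈ _))))
          ; η-+ = λ g h → D-zero (trans (η≈ _) (trans (to-cong T (A.+ˡ g h x₀)) (trans (to-+ T _ _)
              (trans (+-cong (sym (η≈ g)) (sym (η≈ h))) (sym (D.+ˡ _ _ y₁))))))
          ; η-* = λ g h → D-zero (begin
              D (η (g K.* h) K.* η K.1#) y₁                   ≈⟨ D-product _ _ ⟩
              D (η (g K.* h)) 1# * D (η K.1#) y₁              ≈⟨ *-cong (η-χ (g K.* h)) (η≈ K.1#) ⟩
              τ * χ θ (A (g K.* h) 1#) * to T (A K.1# x₀)     ≈⟨ *-cong (*-congˡ (trans (χ-cong θ (trans (A-* g h 1#) (A-scalar g _))) (χ-* θ _ _)))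
                                                                   (to-cong T (proj₁ (act-1 (x₀ , 0#)))) ⟩
              τ * (χ θ (A g 1#) * χ θ (A h 1#)) * to T x₀     ≈⟨ solve 4 (λ t p q r → t :* (p :* q) :* r := t :* p :* (q :* r)) refl
                                                                   τ (χ θ (A g 1#)) (χ θ (A h 1#)) (to T x₀) ⟩
              τ * χ θ (A g 1#) * (χ θ (A h 1#) * to T x₀)     ≈⟨ *-cong (η-χ g) (trans (η≈ h) (scaled-T h)) ⟨
              D (η g) 1# * D (η h) y₁                         ≈⟨ D-product _ _ ⟨
              D (η g K.* η h) y₁                              ∎)
          ; η-1 = λ eq → x₀≉0 (to-injective T (trans (to-cong T (sym (proj₁ (act-1 (x₀ , 0#)))))
              (trans (sym (η≈ K.1#)) (trans (D.cong₂ eq refl) (trans (proj₂ (act-0ˡ (0# , y₁))) (sym (to-0 T)))))))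
          ; η-injective = λ eq → A-zero (to-injective T (trans (sym (η≈ _)) (trans (D.cong₂ eq refl) (η≈ _))))
          ; in-U = λ g → let (x , e₁ , e₂) = back describes _ (ray-resp [ m ] (P.≈ᴹ-sym (coordinates g (η g))) (η≈ g)) in
              x , K.trans e₁ (K.*-identityˡ x) , K.trans e₂ (K.*-identityˡ (f x))
          ; of-U = λ x → let (g , A≈) = A-onto x₀≉0 (proj₁ (ψ (x , f x))) in
              g , ψ-injective (P.≈ᴹ-trans (on-graph x g A≈) (P.≈ᴹ-sym (coordinates g (η g)))) }
          where
          open import Relation.Binary.Reasoning.Setoid setoid
          T : SL
          T = multiplier m≉0
          θ : Character
          θ = character T
          A-zero : ∀ {g h} → A g x₀ ≈ A h x₀ → g K.≈ h
          A-zero = orbit-injective A-op A-free x₀≉0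
          D-zero : ∀ {g h} → D g y₁ ≈ D h y₁ → g K.≈ h
          D-zero = orbit-injective D-op D-free y₁≉0
          -- U is the preimage under ψ of the graph of T, and η g is chosen so that g v₀ + η g v₁
          -- falls on it.
          η : K.Carrier → K.Carrier
          η g = proj₁ (D-onto y₁≉0 (to T (A g x₀)))
          η≈ : ∀ g → D (η g) y₁ ≈ to T (A g x₀)
          η≈ g = proj₂ (D-onto y₁≉0 (to T (A g x₀)))
          scaled-T : ∀ g → to T (A g x₀) ≈ χ θ (A g 1#) * to T x₀
          scaled-T g = trans (to-cong T (A-scalar g x₀)) (to-scale T _ _)
          τ : Carrier
          τ = to T x₀ * y₁ ⁻¹
          η-χ : ∀ g → D (η g) 1# ≈ τ * χ θ (A g 1#)
          η-χ g = *-cancelʳ y₁≉0 (begin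
            D (η g) 1# * y₁                       ≈⟨ D-scalar (η g) y₁ ⟨
            D (η g) y₁                            ≈⟨ trans (η≈ g) (scaled-T g) ⟩
            χ θ (A g 1#) * to T x₀                ≈⟨ *-congˡ (trans (*-congˡ (⁻¹-inverseˡ y₁≉0)) (*-identityʳ _)) ⟨
            χ θ (A g 1#) * (to T x₀ * (y₁ ⁻¹ * y₁)) ≈⟨ solve 4 (λ p t i y → p :* (t :* (i :* y)) := t :* i :* p :* y) refl
                                                       (χ θ (A g 1#)) (to T x₀) (y₁ ⁻¹) y₁ ⟩
            τ * χ θ (A g 1#) * y₁                 ∎)
          D-product : ∀ g h → D (g K.* h) y₁ ≈ D g 1# * D h y₁
          D-product g h = trans (D-* g h y₁) (D-scalar g (D h y₁))
          on-graph : ∀ x g → A g x₀ ≈ proj₁ (ψ (x , f x)) → ψ (x , f x) P.≈ᴹ (A g x₀ , D (η g) y₁)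
          on-graph x g A≈ = sym A≈ , trans (into describes (x , f x) (x , K.sym (K.*-identityˡ x) , K.sym (K.*-identityˡ (f x))))
            (trans (∘-congʳ (sym A≈)) (sym (η≈ g)))

    fixed-axes : (∀ k → ProperHull k) → SemilinearGraph
    fixed-axes hull = at (classify [ 0# ]) (classify ∞)
      where
      Classification : Slope → Set (c ⊔ ℓ ⊔ ℓ′)
      Classification s = (∃[ v ] ((¬ v V.≈ᴹ V.0ᴹ) × Describes s (⟨_⟩ K v)))
                       ⊎ (∃[ h ] (h K.≉ K.0# × Describes s (Orbit h)))
      at : Classification [ 0# ] → Classification ∞ → SemilinearGraph
      at (inj₁ (v₀ , v₀≉0 , d₀)) (inj₁ (v₁ , v₁≉0 , d₁)) = both-axes-fixed v₀≉0 v₁≉0 d₀ d₁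
      at (inj₁ (v₀ , v₀≉0 , d₀)) (inj₂ (h₁ , h₁≉0 , d₁)) = ⊥-elim (second-axis-moved (span-invariant d₀) h₁≉0 d₁)
      at (inj₂ (h₀ , h₀≉0 , d₀)) (inj₁ (v₁ , v₁≉0 , d₁)) = ⊥-elim (first-axis-moved (span-invariant d₁) h₀≉0 d₀)
      at (inj₂ (h₀ , h₀≉0 , d₀)) (inj₂ (h₁ , h₁≉0 , d₁)) = ⊥-elim (both-axes-moved hull h₀≉0 h₁≉0 d₀ d₁)

-- With δ g = g ^ q - g and κ = (δ k) ^ (q - 1), the additive polynomial (δ g) ^ q - κ (δ g)
-- of degree q ^ 2 vanishes on 𝔽 + k 𝔽.
module Hull {c ℓ} (K : FiniteField c ℓ) (r : ℕ)
  (^q-+ : FiniteFieldTheory.Additive K (λ x → FiniteField._^_ K x (suc (suc r))))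
  (k : FiniteField.Carrier K) where
  open FiniteFieldTheory K
  open import Relation.Binary.Reasoning.Setoid setoid

  q : ℕ
  q = suc (suc r)

  open FixedSubfield K q ^q-+

  δ : Carrier → Carrier
  δ g = g ^ q - g

  κ : Carrier
  κ = δ k ^ suc r

  Hull : Carrier → Set ℓ
  Hull g = δ g ^ q ≈ κ * δ g

  Hull? : ∀ g → Dec (Hull g)
  Hull? g = δ g ^ q ≟ κ * δ g

  δ-cong : ∀ {g h} → g ≈ h → δ g ≈ δ h
  δ-cong g≈h = +-cong (^-congˡ q g≈h) (-‿cong g≈h)

  δ-minus : ∀ g h → δ (g - h) ≈ δ g - δ h
  δ-minus g h = trans (+-congʳ (^q-minus g h))
    (solve 4 (λ a b g h → (a :- b) :- (g :- h) := (a :- g) :- (b :- h)) refl (g ^ q) (h ^ q) g h)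

  Hull-resp : ∀ {g h} → g ≈ h → Hull g → Hull h
  Hull-resp g≈h hull = trans (^-congˡ q (δ-cong (sym g≈h))) (trans hull (*-congˡ (δ-cong g≈h)))

  Hull-minus : ∀ {g h} → Hull g → Hull h → Hull (g - h)
  Hull-minus {g} {h} hull-g hull-h = begin
    δ (g - h) ^ q          ≈⟨ ^-congˡ q (δ-minus g h) ⟩
    (δ g - δ h) ^ q        ≈⟨ ^q-minus (δ g) (δ h) ⟩
    δ g ^ q - δ h ^ q      ≈⟨ +-cong hull-g (-‿cong hull-h) ⟩
    κ * δ g - κ * δ h      ≈⟨ solve 3 (λ k a b → k :* a :- k :* b := k :* (a :- b)) refl κ (δ g) (δ h) ⟩
    κ * (δ g - δ h)        ≈⟨ *-congˡ (δ-minus g h) ⟨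
    κ * δ (g - h)          ∎

  𝔽⊆Hull : ∀ {t} → 𝔽 K q t → Hull t
  𝔽⊆Hull {t} t∈𝔽 = begin
    δ t ^ q     ≈⟨ ^-congˡ q (x≈y⇒x-y≈0 t∈𝔽) ⟩
    0# ^ q      ≈⟨ ^q-0 ⟩
    0#          ≈⟨ zeroʳ κ ⟨
    κ * 0#      ≈⟨ *-congˡ (x≈y⇒x-y≈0 t∈𝔽) ⟨
    κ * δ t     ∎

  k𝔽⊆Hull : ∀ {t} → 𝔽 K q t → Hull (k * t)
  k𝔽⊆Hull {t} t∈𝔽 = begin
    δ (k * t) ^ q        ≈⟨ ^-congˡ q δkt ⟩
    (δ k * t) ^ q        ≈⟨ ^-distrib-* (δ k) t q ⟩
    δ k ^ q * t ^ q      ≈⟨ *-congˡ t∈𝔽 ⟩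
    -- Since q = r + 2, the power `δ k ^ q` is `δ k * κ` by definition.
    δ k * κ * t          ≈⟨ solve 3 (λ d κ t → d :* κ :* t := κ :* (d :* t)) refl (δ k) κ t ⟩
    κ * (δ k * t)        ≈⟨ *-congˡ δkt ⟨
    κ * δ (k * t)        ∎
    where
    δkt : δ (k * t) ≈ δ k * t
    δkt = begin
      (k * t) ^ q - k * t    ≈⟨ +-congʳ (^-distrib-* k t q) ⟩
      k ^ q * t ^ q - k * t  ≈⟨ +-congʳ (*-congˡ t∈𝔽) ⟩
      k ^ q * t - k * t      ≈⟨ solve 3 (λ a k t → a :* t :- k :* t := (a :- k) :* t) refl (k ^ q) k t ⟩
      δ k * t                ∎

  Hull-Monic : Monic (q ℕ.* q) (λ g → δ g ^ q - κ * δ g)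
  Hull-Monic = Monic-≈ polynomial
    (Monic-+-Below (Monic-+-Below (^-Monic (q ℕ.* q)) (Below-scale (- (1# + κ)) (Monic-Below (^-Monic q) q<q²)))
                   (Below-scale κ (Monic-Below (^-Monic 1) (ℕ.<-trans (ℕ.s≤s (ℕ.s≤s ℕ.z≤n)) q<q²))))
    where
    q<q² : q ℕ.< q ℕ.* q
    q<q² = ℕ.m<m*n q q (ℕ.s≤s (ℕ.s≤s ℕ.z≤n))
    polynomial : ∀ g → δ g ^ q - κ * δ g ≈ g ^ (q ℕ.* q) + - (1# + κ) * g ^ q + κ * g ^ 1
    polynomial g = begin
      δ g ^ q - κ * δ g
        ≈⟨ +-congʳ (trans (^q-minus (g ^ q) g) (+-congʳ (^-assocʳ g q q))) ⟩
      (g ^ (q ℕ.* q) - g ^ q) - κ * (g ^ q - g)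
        ≈⟨ solve 4 (λ x y g k → (x :- y) :- k :* (y :- g) := x :+ :- (:1 :+ k) :* y :+ k :* (g :* :1)) refl
             (g ^ (q ℕ.* q)) (g ^ q) g κ ⟩
      g ^ (q ℕ.* q) + - (1# + κ) * g ^ q + κ * g ^ 1 ∎

  Hull-proper : q ℕ.* q ℕ.< order → ∃[ g ] ¬ Hull g
  Hull-proper q²<N = proj₁ found , λ hull → proj₂ found (x≈y⇒x-y≈0 hull)
    where
    found : ∃[ g ] δ g ^ q - κ * δ g ≉ 0#
    found = nonRoot Hull-Monic q²<N

-- q-polynomials and the pseudoregulus type

module QPolynomials {c ℓ} (K : FiniteField c ℓ) (r : ℕ)
  (^q-+ : FiniteFieldTheory.Additive K (λ x → FiniteField._^_ K x (suc (suc r)))) where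
  open FiniteFieldTheory K
  open import Algebra.Properties.Semiring.Sum semiring using (*-distribˡ-sum)
  open import Relation.Binary.Reasoning.Setoid setoid

  q : ℕ
  q = suc (suc r)

  power-+ : ∀ i → Additive (_^ (q ℕ.^ i))
  power-+ zero    x y = trans (*-identityʳ _) (sym (+-cong (*-identityʳ x) (*-identityʳ y)))
  power-+ (suc i) x y = begin
    (x + y) ^ (q ℕ.* q ℕ.^ i)                    ≈⟨ ^-assocʳ (x + y) q (q ℕ.^ i) ⟨
    ((x + y) ^ q) ^ (q ℕ.^ i)                    ≈⟨ ^-congˡ (q ℕ.^ i) (^q-+ x y) ⟩
    (x ^ q + y ^ q) ^ (q ℕ.^ i)                  ≈⟨ power-+ i (x ^ q) (y ^ q) ⟩
    (x ^ q) ^ (q ℕ.^ i) + (y ^ q) ^ (q ℕ.^ i)    ≈⟨ +-cong (^-assocʳ x q (q ℕ.^ i)) (^-assocʳ y q (q ℕ.^ i)) ⟩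
    x ^ (q ℕ.* q ℕ.^ i) + y ^ (q ℕ.* q ℕ.^ i)    ∎

  power-fixed : ∀ {x Q} → x ^ Q ≈ x → ∀ i → x ^ (Q ℕ.^ i) ≈ x
  power-fixed {x}     xQ zero    = *-identityʳ x
  power-fixed {x} {Q} xQ (suc i) = trans (sym (^-assocʳ x Q (Q ℕ.^ i)))
    (trans (^-congˡ (Q ℕ.^ i) xQ) (power-fixed xQ i))

  module _ {n} (as : Vector Carrier n) where
    private
      f = qPolynomial K q as

    qPolynomial-cong : ∀ {x y} → x ≈ y → f x ≈ f y
    qPolynomial-cong {x} {y} x≈y = sum-cong-≋ {n} {λ i → as i * x ^ (q ℕ.^ Fin.toℕ i)} {λ i → as i * y ^ (q ℕ.^ Fin.toℕ i)} λ i → *-congˡ (^-congˡ (q ℕ.^ Fin.toℕ i) x≈y)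

    qPolynomial-+ : ∀ x y → f (x + y) ≈ f x + f y
    qPolynomial-+ x y = trans
      (sum-cong-≋ λ i → trans (*-congˡ (power-+ (Fin.toℕ i) x y)) (distribˡ (as i) _ _))
      (∑-distrib-+ (λ i → as i * x ^ (q ℕ.^ Fin.toℕ i)) _)

    qPolynomial-scale : ∀ {t} x → 𝔽 K q t → f (t * x) ≈ t * f x
    qPolynomial-scale {t} x t∈𝔽 = trans
      (sum-cong-≋ λ i → begin
        as i * (t * x) ^ (q ℕ.^ Fin.toℕ i)
          ≈⟨ *-congˡ (trans (^-distrib-* t x (q ℕ.^ Fin.toℕ i)) (*-congʳ (power-fixed {t} {q} t∈𝔽 (Fin.toℕ i)))) ⟩
        as i * (t * x ^ (q ℕ.^ Fin.toℕ i))
          ≈⟨ solve 3 (λ a t y → a :* (t :* y) := t :* (a :* y)) refl (as i) t (x ^ (q ℕ.^ Fin.toℕ i)) ⟩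
        t * (as i * x ^ (q ℕ.^ Fin.toℕ i)) ∎)
      (sym (*-distribˡ-sum t (λ i → as i * x ^ (q ℕ.^ Fin.toℕ i))))

  qPolynomial-linear : ∀ {n} (as : Vector Carrier n) → IsLinear K q (qPolynomial K q as)
  qPolynomial-linear as = record
    { f-cong = qPolynomial-cong as ; f-+ = qPolynomial-+ as
    ; f-scale = λ x → qPolynomial-scale as x }

  combination : ∀ {n} → Carrier → Carrier → Vector Carrier (suc n) → Vector Carrier (suc n)
  combination l m as zero    = l + m * as zero
  combination l m as (suc i) = m * as (suc i)

  combination-value : ∀ {n} l m (as : Vector Carrier (suc n)) x →
    qPolynomial K q (combination l m as) x ≈ l * x + m * qPolynomial K q as x
  combination-value l m as x = begin
    (l + m * as zero) * (x * 1#) + sum (λ i → m * as (suc i) * y i)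
      ≈⟨ +-congˡ (trans (sum-cong-≋ λ i → *-assoc m (as (suc i)) (y i)) (sym (*-distribˡ-sum m (λ i → as (suc i) * y i)))) ⟩
    (l + m * as zero) * (x * 1#) + m * sum (λ i → as (suc i) * y i)
      ≈⟨ solve 5 (λ l m a x s → (l :+ m :* a) :* (x :* :1) :+ m :* s := l :* x :+ m :* (a :* (x :* :1) :+ s)) refl
           l m (as zero) x (sum (λ i → as (suc i) * y i)) ⟩
    l * x + m * (as zero * (x * 1#) + sum (λ i → as (suc i) * y i)) ∎
    where
    y = λ i → x ^ (q ℕ.^ Fin.toℕ (suc i))

  power : ℕ → Character
  power i = record
    { χ = _^ (q ℕ.^ i) ; χ-cong = ^-congˡ (q ℕ.^ i)
    ; χ-* = λ x y → ^-distrib-* x y (q ℕ.^ i) ; χ-1 = 1^n≈1 (q ℕ.^ i) }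

  -- X ^ q ^ j - X ^ q ^ i is monic of degree q ^ j, which is below the order of the field.
  powers-differ : ∀ {n} → order ≡ q ℕ.^ n → ∀ {i j} → i ℕ.< j → j ℕ.< n →
                  ∃[ x ] x ^ (q ℕ.^ i) ≉ x ^ (q ℕ.^ j)
  powers-differ order≡ {i} {j} i<j j<n
    with nonRoot (Monic-+-Below (^-Monic (q ℕ.^ j)) (Below-scale (- 1#) (Monic-Below (^-Monic (q ℕ.^ i))
           (ℕ.^-monoʳ-< q (ℕ.s≤s (ℕ.s≤s ℕ.z≤n)) i<j))))
         (≡.subst (q ℕ.^ j ℕ.<_) (≡.sym order≡) (ℕ.^-monoʳ-< q (ℕ.s≤s (ℕ.s≤s ℕ.z≤n)) j<n))
  ... | x , ≉0 = x , λ eq → ≉0 (trans (+-congʳ (sym eq))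
          (solve 1 (λ y → y :+ :- :1 :* y := :0) refl (x ^ (q ℕ.^ i))))

  eval-++ : ∀ ts us x → eval (ts List.++ us) x ≈ eval ts x + eval us x
  eval-++ []             us x = sym (+-identityˡ _)
  eval-++ ((a , φ) ∷ ts) us x = trans (+-congˡ (eval-++ ts us x)) (sym (+-assoc _ _ _))

  eval-tabulate : ∀ {n} (a : Fin n → Carrier) (φ : Fin n → Character) x →
    eval (List.tabulate (λ i → a i , φ i)) x ≈ sum (λ i → a i * χ (φ i) x)
  eval-tabulate {zero}  a φ x = refl
  eval-tabulate {suc n} a φ x = +-congˡ (eval-tabulate (a ∘ suc) (φ ∘ suc) x)

module PseudoregulusCriterion {c′ ℓ′} (K : FiniteField c′ ℓ′) (r n′ : ℕ)
  (^q-+ : FiniteFieldTheory.Additive K (λ x → FiniteField._^_ K x (suc (suc r))))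
  (order≡ : FiniteField.order K ≡ suc (suc r) ℕ.^ suc n′)
  (as : Vector (FiniteField.Carrier K) (suc n′))
  (scattered : Scattered K (suc (suc r)) (qPolynomial K (suc (suc r)) as))
  (graph : AxisGraph.SemilinearGraph K (qPolynomial K (suc (suc r)) as)) where
  open FiniteFieldTheory K
  open QPolynomials K r ^q-+
  open FixedSubfield K q ^q-+
  open AxisGraph.SemilinearGraph graph
  open import Relation.Binary.Reasoning.Setoid setoid
  private
    module V = LeftModule (F² K)
    n : ℕ
    n = suc n′
    f : Carrier → Carrier
    f = qPolynomial K q as
    a = proj₁ v₀
    b = proj₂ v₀
    e = η 1#
    -- Rescaling v₁ by e = η 1 replaces η by σ = η / e, which is multiplicative with σ 1 = 1.
    c₁ = e * proj₁ v₁
    d₁ = e * proj₂ v₁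
    Δ = a * d₁ - b * c₁

  Δ≉0 : Δ ≉ 0#
  Δ≉0 Δ≈0 = 1≉0 (proj₁ (independent 1# 0# (a≈ , b≈)))
    where
    c = proj₁ v₁
    d = proj₂ v₁
    ad≈bc : a * d - b * c ≈ 0#
    ad≈bc = integralˡ η-1 (trans (solve 5 (λ a b c d e → e :* (a :* d :- b :* c) := a :* (e :* d) :- b :* (e :* c)) refl a b c d e) Δ≈0)
    first = independent d (- b) (trans (solve 4 (λ a b c d → d :* a :+ (:- b) :* c := a :* d :- b :* c) refl a b c d) ad≈bc
                                , solve 2 (λ b d → d :* b :+ (:- b) :* d := :0) refl b d)
    second = independent c (- a) (solve 2 (λ a c → c :* a :+ (:- a) :* c := :0) refl a c
      , trans (solve 4 (λ a b c d → c :* b :+ (:- a) :* d := :0 :- (a :* d :- b :* c)) refl a b c d)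
              (trans (+-congˡ (-‿cong ad≈bc)) (-‿inverseʳ 0#)))
    vanish : ∀ {x y} → - x ≈ 0# → 1# * x + 0# * y ≈ 0#
    vanish {x} {y} -x≈0 = trans (solve 2 (λ x y → :1 :* x :+ :0 :* y := :- (:- x)) refl x y) (trans (-‿cong -x≈0) -0#≈0#)
    a≈ : 1# * a + 0# * c ≈ 0#
    a≈ = vanish (proj₂ second)
    b≈ : 1# * b + 0# * d ≈ 0#
    b≈ = vanish (proj₂ first)

  σ : Carrier → Carrier
  σ g = η g * e ⁻¹

  η≈ : ∀ g → η g ≈ σ g * e
  η≈ g = trans (sym (*-identityʳ _)) (trans (*-congˡ (sym (⁻¹-inverseˡ η-1))) (sym (*-assoc _ _ _)))

  σ-+ : ∀ x y → σ (x + y) ≈ σ x + σ y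
  σ-+ x y = trans (*-congʳ (η-+ x y)) (distribʳ _ _ _)

  σ-character : Character
  σ-character = record
    { χ = σ
    ; χ-cong = λ x≈y → *-congʳ (η-cong x≈y)
    ; χ-* = λ x y → *-cancelʳ (*-nonZero η-1 η-1) (begin
        σ (x * y) * (e * e)        ≈⟨ *-assoc _ _ _ ⟨
        σ (x * y) * e * e          ≈⟨ *-congʳ (η≈ _) ⟨
        η (x * y) * e              ≈⟨ η-* x y ⟩
        η x * η y                  ≈⟨ *-cong (η≈ x) (η≈ y) ⟩
        σ x * e * (σ y * e)        ≈⟨ solve 3 (λ s t e → s :* e :* (t :* e) := s :* t :* (e :* e)) refl (σ x) (σ y) e ⟩
        σ x * σ y * (e * e)        ∎)
    ; χ-1 = ⁻¹-inverseʳ η-1 }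

  σ-injective : ∀ {x y} → σ x ≈ σ y → x ≈ y
  σ-injective eq = η-injective (trans (η≈ _) (trans (*-congʳ eq) (sym (η≈ _))))

  σ-0 : σ 0# ≈ 0#
  σ-0 = +-cancelˡ (σ 0#) _ _ (trans (sym (σ-+ 0# 0#))
    (trans (χ-cong σ-character (+-identityʳ 0#)) (sym (+-identityʳ _))))

  σ-sum : ∀ {m} (t : Vector Carrier m) → σ (sum t) ≈ sum (λ i → σ (t i))
  σ-sum {zero}  t = σ-0
  σ-sum {suc m} t = trans (σ-+ _ _) (+-congˡ (σ-sum (t ∘ suc)))

  vector : Carrier → Carrier → V.Carrierᴹ
  vector g h = g * a + h * c₁ , g * b + h * d₁

  graph-vector : ∀ g → g V.*ₗ v₀ V.+ᴹ η g V.*ₗ v₁ V.≈ᴹ vector g (σ g)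
  graph-vector g = +-congˡ (rescale (proj₁ v₁)) , +-congˡ (rescale (proj₂ v₁))
    where
    rescale : ∀ x → η g * x ≈ σ g * (e * x)
    rescale x = trans (*-congʳ (η≈ g)) (*-assoc _ _ _)

  -- Cramer's rule for the inverse of the matrix with columns v₀ and e v₁.
  φ : V.Carrierᴹ → V.Carrierᴹ
  φ (x , y) = (d₁ * x - c₁ * y) * Δ ⁻¹ , (a * y - b * x) * Δ ⁻¹

  cancel-Δ : ∀ {x z} → x ≈ z * Δ → x * Δ ⁻¹ ≈ z
  cancel-Δ eq = trans (*-congʳ eq) (trans (*-assoc _ _ _) (trans (*-congˡ (⁻¹-inverseʳ Δ≉0)) (*-identityʳ _)))

  φ-vector : ∀ g h → φ (vector g h) V.≈ᴹ (g , h)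
  φ-vector g h =
      cancel-Δ (solve 6 (λ a b c d g h → d :* (g :* a :+ h :* c) :- c :* (g :* b :+ h :* d) :=
        g :* (a :* d :- b :* c)) refl a b c₁ d₁ g h)
    , cancel-Δ (solve 6 (λ a b c d g h → a :* (g :* b :+ h :* d) :- b :* (g :* a :+ h :* c) :=
        h :* (a :* d :- b :* c)) refl a b c₁ d₁ g h)

  vector-φ : ∀ x y → vector (proj₁ (φ (x , y))) (proj₂ (φ (x , y))) V.≈ᴹ (x , y)
  vector-φ x y =
      trans (solve 7 (λ a b c d x y i → (d :* x :- c :* y) :* i :* a :+ (a :* y :- b :* x) :* i :* c :=
        x :* (a :* d :- b :* c) :* i) refl a b c₁ d₁ x y (Δ ⁻¹)) (cancel-Δ refl)
    , trans (solve 7 (λ a b c d x y i → (d :* x :- c :* y) :* i :* b :+ (a :* y :- b :* x) :* i :* d :=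
        y :* (a :* d :- b :* c) :* i) refl a b c₁ d₁ x y (Δ ⁻¹)) (cancel-Δ refl)

  φ-cong : ∀ {u v} → u V.≈ᴹ v → φ u V.≈ᴹ φ v
  φ-cong (e₁ , e₂) = *-congʳ (+-cong (*-congˡ e₁) (-‿cong (*-congˡ e₂)))
                   , *-congʳ (+-cong (*-congˡ e₂) (-‿cong (*-congˡ e₁)))

  vector-cong : ∀ {g h g′ h′} → g ≈ g′ → h ≈ h′ → vector g h V.≈ᴹ vector g′ h′
  vector-cong e₁ e₂ = +-cong (*-congʳ e₁) (*-congʳ e₂) , +-cong (*-congʳ e₁) (*-congʳ e₂)

  φ-injective : ∀ {u v} → φ u V.≈ᴹ φ v → u V.≈ᴹ v
  φ-injective {x , y} {x′ , y′} (e₁ , e₂) =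
    V.≈ᴹ-trans (V.≈ᴹ-sym (vector-φ x y)) (V.≈ᴹ-trans (vector-cong e₁ e₂) (vector-φ x′ y′))

  φ-scale : ∀ h u → φ (h V.*ₗ u) V.≈ᴹ h V.*ₗ φ u
  φ-scale h (x , y) =
      solve 6 (λ h c d x y i → (d :* (h :* x) :- c :* (h :* y)) :* i := h :* ((d :* x :- c :* y) :* i)) refl h c₁ d₁ x y (Δ ⁻¹)
    , solve 6 (λ h a b x y i → (a :* (h :* y) :- b :* (h :* x)) :* i := h :* ((a :* y :- b :* x) :* i)) refl h a b x y (Δ ⁻¹)

  φ-GL : IsGL K φ
  φ-GL = record
    { isLeftModuleMonomorphism = record
      { isLeftModuleHomomorphism = record
        { +ᴹ-isGroupHomomorphism = record
          { isMonoidHomomorphism = record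
            { isMagmaHomomorphism = record
              { isRelHomomorphism = record { cong = φ-cong }
              ; homo = λ (x , y) (x′ , y′) →
                  distribute d₁ c₁ x y x′ y′
                , distribute a b y x y′ x′ }
            ; ε-homo = zero-value d₁ c₁ , zero-value a b }
          ; ⁻¹-homo = λ (x , y) → negate d₁ c₁ x y , negate a b y x }
        ; *ₗ-homo = φ-scale }
      ; injective = φ-injective }
    ; surjective = λ (g , h) → vector g h , λ eq → V.≈ᴹ-trans (φ-cong eq) (φ-vector g h) }
    where
    distribute : ∀ p q x y x′ y′ → (p * (x + x′) - q * (y + y′)) * Δ ⁻¹ ≈ (p * x - q * y) * Δ ⁻¹ + (p * x′ - q * y′) * Δ ⁻¹
    distribute p q x y x′ y′ = trans
      (*-congʳ (solve 6 (λ p q x y x′ y′ → p :* (x :+ x′) :- q :* (y :+ y′) := (p :* x :- q :* y) :+ (p :* x′ :- q :* y′)) refl p q x y x′ y′))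
      (distribʳ _ _ _)
    zero-value : ∀ p q → (p * 0# - q * 0#) * Δ ⁻¹ ≈ 0#
    zero-value p q = solve 3 (λ p q i → (p :* :0 :- q :* :0) :* i := :0) refl p q (Δ ⁻¹)
    negate : ∀ p q x y → (p * - x - q * - y) * Δ ⁻¹ ≈ - ((p * x - q * y) * Δ ⁻¹)
    negate p q x y = solve 5 (λ p q x y i → (p :* (:- x) :- q :* (:- y)) :* i := :- ((p :* x :- q :* y) :* i)) refl p q x y (Δ ⁻¹)

  φ-graph : ∀ x → ∃[ g ] (φ (x , f x) V.≈ᴹ (g , σ g))
  φ-graph x = let (g , eq) = of-U x in
    g , V.≈ᴹ-trans (φ-cong (V.≈ᴹ-trans eq (graph-vector g))) (φ-vector g (σ g))

  p ρ : Vector Carrier n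
  p = combination (d₁ * Δ ⁻¹) (- (c₁ * Δ ⁻¹)) as
  ρ = combination (- (b * Δ ⁻¹)) (a * Δ ⁻¹) as

  p-value : ∀ x → qPolynomial K q p x ≈ proj₁ (φ (x , f x))
  p-value x = trans (combination-value _ _ as x)
    (solve 5 (λ d c i x y → d :* i :* x :+ (:- (c :* i)) :* y := (d :* x :- c :* y) :* i) refl d₁ c₁ (Δ ⁻¹) x (f x))

  ρ-value : ∀ x → qPolynomial K q ρ x ≈ proj₂ (φ (x , f x))
  ρ-value x = trans (combination-value _ _ as x)
    (solve 5 (λ a b i x y → (:- (b :* i)) :* x :+ a :* i :* y := (a :* y :- b :* x) :* i) refl a b (Δ ⁻¹) x (f x))

  -- φ maps U f onto the graph of σ, which turns the coordinate polynomials of φ on U f into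
  -- a relation between the characters σ (x ^ q ^ i) and x ^ q ^ j.
  relation : ∀ x → σ (qPolynomial K q p x) ≈ qPolynomial K q ρ x
  relation x = let (g , e₁ , e₂) = φ-graph x in
    trans (χ-cong σ-character (trans (p-value x) e₁)) (trans (sym e₂) (sym (ρ-value x)))

  σ-power : ℕ → Character
  σ-power i = record
    { χ = λ x → σ (x ^ (q ℕ.^ i))
    ; χ-cong = λ eq → χ-cong σ-character (χ-cong (power i) eq)
    ; χ-* = λ x y → trans (χ-cong σ-character (χ-* (power i) x y)) (χ-* σ-character _ _)
    ; χ-1 = trans (χ-cong σ-character (χ-1 (power i))) (χ-1 σ-character) }

  σ-powers-differ : ∀ {i j : Fin n} → ¬ i ≡ j → ∃[ y ] χ (σ-power (Fin.toℕ j)) y ≉ χ (σ-power (Fin.toℕ i)) y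
  σ-powers-differ {i} {j} i≢j with ℕ.<-cmp (Fin.toℕ i) (Fin.toℕ j)
  ... | tri< i<j _ _ = let (y , d) = powers-differ order≡ i<j (Fin.toℕ<n j) in y , λ eq → d (sym (σ-injective eq))
  ... | tri≈ _ i≡j _ = contradiction (Fin.toℕ-injective i≡j) i≢j
  ... | tri> _ _ j<i = let (y , d) = powers-differ order≡ j<i (Fin.toℕ<n i) in y , λ eq → d (σ-injective eq)

  module _ (differ : ∀ (i j : Fin n) → ∃[ y ] χ (power (Fin.toℕ j)) y ≉ χ (σ-power (Fin.toℕ i)) y) where

    -- If no character σ (x ^ q ^ i) equals a power x ^ q ^ j, then it differs from all other
    -- characters in the relation between p and ρ, and its coefficient σ (p i) must vanish.
    p-vanishes : ∀ i → p i ≈ 0#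
    p-vanishes i = σ-injective (trans
      (isolated-coefficient (σ (p i)) (σ-power (Fin.toℕ i)) (others List.++ powers) balanced
        (All.++⁺ (All.tabulate⁺ {f = λ j → σ (p (Fin.punchIn i j)) , σ-power (Fin.toℕ (Fin.punchIn i j))}
                    (λ j → σ-powers-differ {i} {Fin.punchIn i j} (λ eq → Fin.punchInᵢ≢i i j (≡.sym eq))))
                 (All.tabulate⁺ {f = λ j → - ρ j , power (Fin.toℕ j)} (λ j → differ i j))))
      (sym σ-0))
      where
      term : Carrier → Vector Carrier n
      term x j = σ (p j) * σ (x ^ (q ℕ.^ Fin.toℕ j))
      others powers : Combination
      others = List.tabulate λ j → σ (p (Fin.punchIn i j)) , σ-power (Fin.toℕ (Fin.punchIn i j))
      powers = List.tabulate λ j → - ρ j , power (Fin.toℕ j)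
      negative-sum : ∀ {m} (t s : Vector Carrier m) → sum (λ j → - t j * s j) ≈ - sum (λ j → t j * s j)
      negative-sum {zero}  t s = sym -0#≈0#
      negative-sum {suc m} t s = trans (+-congˡ (negative-sum (t ∘ suc) (s ∘ suc)))
        (solve 3 (λ t s r → (:- t) :* s :+ (:- r) := :- (t :* s :+ r)) refl (t zero) (s zero) _)
      balanced : ∀ x → σ (p i) * σ (x ^ (q ℕ.^ Fin.toℕ i)) + eval (others List.++ powers) x ≈ 0#
      balanced x = begin
        term x i + eval (others List.++ powers) x
          ≈⟨ +-congˡ (trans (eval-++ others powers x) (+-cong
               (eval-tabulate (λ j → σ (p (Fin.punchIn i j))) (λ j → σ-power (Fin.toℕ (Fin.punchIn i j))) x)
               (eval-tabulate (λ j → - ρ j) (λ j → power (Fin.toℕ {n} j)) x))) ⟩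
        term x i + (sum (λ j → term x (Fin.punchIn i j)) + sum (λ j → - ρ j * x ^ (q ℕ.^ Fin.toℕ j)))
          ≈⟨ +-assoc _ _ _ ⟨
        term x i + sum (λ j → term x (Fin.punchIn i j)) + sum (λ j → - ρ j * x ^ (q ℕ.^ Fin.toℕ j))
          ≈⟨ +-cong (sym (sum-remove {i = i} (term x))) (negative-sum ρ (λ j → x ^ (q ℕ.^ Fin.toℕ j))) ⟩
        sum (term x) - qPolynomial K q ρ x
          ≈⟨ +-congʳ (sum-cong-≋ λ j → χ-* σ-character (p j) (x ^ (q ℕ.^ Fin.toℕ j))) ⟨
        sum (λ j → σ (p j * x ^ (q ℕ.^ Fin.toℕ j))) - qPolynomial K q ρ x
          ≈⟨ +-congʳ (σ-sum (λ j → p j * x ^ (q ℕ.^ Fin.toℕ j))) ⟨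
        σ (qPolynomial K q p x) - qPolynomial K q ρ x
          ≈⟨ x≈y⇒x-y≈0 (relation x) ⟩
        0# ∎

    -- With p = 0 the first coordinate of φ would vanish on U, but φ takes the value (1 , σ 1)
    -- there.
    no-match : ⊥
    no-match = let (x , eq) = in-U 1# in 1≉0 (begin
      1#                                ≈⟨ proj₁ (φ-vector 1# (σ 1#)) ⟨
      proj₁ (φ (vector 1# (σ 1#)))      ≈⟨ proj₁ (φ-cong (V.≈ᴹ-trans (V.≈ᴹ-sym (graph-vector 1#)) eq)) ⟩
      proj₁ (φ (x , f x))               ≈⟨ p-value x ⟨
      qPolynomial K q p x               ≈⟨ sum-cong-≋ (λ i → trans (*-congʳ (p-vanishes i)) (zeroˡ (x ^ (q ℕ.^ Fin.toℕ i)))) ⟩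
      sum (replicate n 0#)              ≈⟨ sum-replicate-zero n ⟩
      0#                                ∎)

  match? : ∀ i j → Dec (power j ≈χ σ-power i)
  match? i j with ≈χ⊎differ (power j) (σ-power i)
  ... | inj₁ eq      = yes eq
  ... | inj₂ (y , d) = no λ eq → d (eq y)

  match : ∃[ i ] ∃[ j ] power (Fin.toℕ j) ≈χ σ-power (Fin.toℕ {n} i)
  match = decide (Fin.any? λ i → Fin.any? λ j → match? (Fin.toℕ i) (Fin.toℕ j))
    where
    decide : Dec (∃[ i ] ∃[ j ] power (Fin.toℕ {n} j) ≈χ σ-power (Fin.toℕ {n} i)) →
             ∃[ i ] ∃[ j ] power (Fin.toℕ j) ≈χ σ-power (Fin.toℕ {n} i)
    decide (yes found) = found
    decide (no unmatched) = ⊥-elim (no-match λ i j → apart i j (≈χ⊎differ (power (Fin.toℕ j)) (σ-power (Fin.toℕ i))))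
      where
      apart : ∀ i j → power (Fin.toℕ j) ≈χ σ-power (Fin.toℕ i) ⊎
              (∃[ y ] χ (power (Fin.toℕ j)) y ≉ χ (σ-power (Fin.toℕ i)) y) →
              ∃[ y ] χ (power (Fin.toℕ j)) y ≉ χ (σ-power (Fin.toℕ i)) y
      apart i j (inj₁ eq) = contradiction (i , j , eq) unmatched
      apart i j (inj₂ d)  = d

  private
    i = Fin.toℕ (proj₁ match)
    j = Fin.toℕ (proj₁ (proj₂ match))

  -- The match reads σ (x ^ q ^ i) = x ^ q ^ j. Substituting x ^ q ^ (n - i) for x turns the left
  -- side into σ x, because x ^ q ^ n = x.
  s : ℕ
  s = (n ℕ.∸ i) ℕ.+ j

  σ≈power : ∀ x → σ x ≈ x ^ (q ℕ.^ s)
  σ≈power x = begin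
    σ x                                     ≈⟨ χ-cong σ-character (fermat x) ⟨
    σ (x ^ order)                           ≈⟨ χ-cong σ-character (^-congʳ x exponent) ⟩
    σ (x ^ (q ℕ.^ (n ℕ.∸ i) ℕ.* q ℕ.^ i))   ≈⟨ χ-cong σ-character (^-assocʳ x (q ℕ.^ (n ℕ.∸ i)) (q ℕ.^ i)) ⟨
    σ ((x ^ (q ℕ.^ (n ℕ.∸ i))) ^ (q ℕ.^ i)) ≈⟨ proj₂ (proj₂ match) (x ^ (q ℕ.^ (n ℕ.∸ i))) ⟨
    (x ^ (q ℕ.^ (n ℕ.∸ i))) ^ (q ℕ.^ j)     ≈⟨ ^-assocʳ x (q ℕ.^ (n ℕ.∸ i)) (q ℕ.^ j) ⟩
    x ^ (q ℕ.^ (n ℕ.∸ i) ℕ.* q ℕ.^ j)       ≈⟨ ^-congʳ x (ℕ.^-distribˡ-+-* q (n ℕ.∸ i) j) ⟨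
    x ^ (q ℕ.^ s)                           ∎
    where
    exponent : order ≡ q ℕ.^ (n ℕ.∸ i) ℕ.* q ℕ.^ i
    exponent = ≡.trans order≡ (≡.trans
      (≡.cong (q ℕ.^_) (≡.sym (ℕ.m∸n+n≡m (ℕ.<⇒≤ (Fin.toℕ<n (proj₁ match))))))
      (ℕ.^-distribˡ-+-* q (n ℕ.∸ i) i))

  -- If σ fixes g, then U contains both a nonzero vector (y , f y) and g times it. Scatteredness
  -- makes y and g y dependent over 𝔽, which puts g into 𝔽.
  σ-fixed∈𝔽 : ∀ {g} → σ g ≈ g → 𝔽 K q g
  σ-fixed∈𝔽 {g} σg≈g = 𝔽-resp (sym g≈) (𝔽-* (𝔽-minus 𝔽-0 b∈𝔽) (𝔽-⁻¹ a≉0 a∈𝔽))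
    where
    y = proj₁ (in-U 1#)
    z = proj₁ (in-U g)
    at-1 : (y , f y) V.≈ᴹ vector 1# 1#
    at-1 = V.≈ᴹ-trans (V.≈ᴹ-sym (proj₂ (in-U 1#))) (V.≈ᴹ-trans (graph-vector 1#) (vector-cong refl (χ-1 σ-character)))
    at-g : (z , f z) V.≈ᴹ g V.*ₗ (y , f y)
    at-g = V.≈ᴹ-trans (V.≈ᴹ-sym (proj₂ (in-U g))) (V.≈ᴹ-trans (graph-vector g) (V.≈ᴹ-trans (vector-cong refl σg≈g)
      (V.≈ᴹ-trans (solve 3 (λ g a c → g :* a :+ g :* c := g :* (:1 :* a :+ :1 :* c)) refl g a c₁
                 , solve 3 (λ g a c → g :* a :+ g :* c := g :* (:1 :* a :+ :1 :* c)) refl g b d₁)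
        (V.*ₗ-congˡ (V.≈ᴹ-sym at-1)))))
    f-0 : f 0# ≈ 0#
    f-0 = +-cancelˡ (f 0#) _ _ (trans (sym (qPolynomial-+ as 0# 0#))
      (trans (qPolynomial-cong as (+-identityʳ 0#)) (sym (+-identityʳ _))))
    y≉0 : y ≉ 0#
    y≉0 y≈0 = 1≉0 (begin
      1#                               ≈⟨ proj₁ (φ-vector 1# 1#) ⟨
      proj₁ (φ (vector 1# 1#))         ≈⟨ proj₁ (φ-cong (V.≈ᴹ-trans (V.≈ᴹ-sym at-1) (y≈0 , trans (qPolynomial-cong as y≈0) f-0))) ⟩
      (d₁ * 0# - c₁ * 0#) * Δ ⁻¹       ≈⟨ solve 3 (λ p q i → (p :* :0 :- q :* :0) :* i := :0) refl d₁ c₁ (Δ ⁻¹) ⟩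
      0#                               ∎)
    dependent = scattered y z (trans (+-cong (*-congʳ (proj₁ at-g)) (-‿cong (*-congˡ (proj₂ at-g))))
      (solve 3 (λ g y t → g :* y :* t :- y :* (g :* t) := :0) refl g y (f y)))
    b′ = proj₁ dependent
    a′ = proj₁ (proj₂ dependent)
    b∈𝔽 = proj₁ (proj₂ (proj₂ dependent))
    a∈𝔽 = proj₁ (proj₂ (proj₂ (proj₂ dependent)))
    b+ag≈0 : b′ + a′ * g ≈ 0#
    b+ag≈0 = integralʳ y≉0 (trans (solve 4 (λ b a g y → (b :+ a :* g) :* y := b :* y :+ a :* (g :* y)) refl b′ a′ g y)
      (trans (+-congˡ (*-congˡ (sym (proj₁ at-g)))) (proj₂ (proj₂ (proj₂ (proj₂ (proj₂ dependent)))))))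
    a≉0 : a′ ≉ 0#
    a≉0 a≈0 = proj₁ (proj₂ (proj₂ (proj₂ (proj₂ dependent))))
      (trans (sym (trans (+-congˡ (trans (*-congʳ a≈0) (zeroˡ g))) (+-identityʳ b′))) b+ag≈0 , a≈0)
    g≈ : g ≈ (0# - b′) * a′ ⁻¹
    g≈ = *-cancelˡ a≉0 (begin
      a′ * g                        ≈⟨ solve 2 (λ b t → t := (b :+ t) :- b) refl b′ (a′ * g) ⟩
      (b′ + a′ * g) - b′            ≈⟨ +-congʳ b+ag≈0 ⟩
      0# - b′                       ≈⟨ *-identityʳ _ ⟨
      (0# - b′) * 1#                ≈⟨ *-congˡ (⁻¹-inverseʳ a≉0) ⟨
      (0# - b′) * (a′ * a′ ⁻¹)      ≈⟨ solve 3 (λ b a i → b :* (a :* i) := a :* (b :* i)) refl (0# - b′) a′ (a′ ⁻¹) ⟩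
      a′ * ((0# - b′) * a′ ⁻¹)      ∎)

  -- A common divisor d > 1 of s and n would make σ fix the roots of X ^ Q - X with Q = q ^ d, and
  -- one of them lies outside 𝔽 because X ^ q - X has degree only q < Q.
  gcd-trivial : ∀ d → d ∣ s → d ∣ n → d ≡ 1
  gcd-trivial zero _ 0∣n = contradiction (0∣⇒≡0 0∣n) λ ()
  gcd-trivial (suc zero) _ _ = ≡.refl
  gcd-trivial d@(suc (suc d′)) (divides k s≡) (divides m n≡) = contradiction
    (σ-fixed∈𝔽 (trans (σ≈power x) (trans (^-congʳ x q^s≡) (power-fixed xQ k)))) λ x∈𝔽 → x∉𝔽 (x≈y⇒x-y≈0 x∈𝔽)
    where
    Q = q ℕ.^ d
    q<Q : q ℕ.< Q
    q<Q = ≡.subst (ℕ._< Q) (ℕ.*-identityʳ q) (ℕ.^-monoʳ-< q (ℕ.s≤s (ℕ.s≤s ℕ.z≤n)) {1} {d} (ℕ.s≤s (ℕ.s≤s ℕ.z≤n)))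
    0<m : 0 ℕ.< m
    0<m = ℕ.n≢0⇒n>0 λ m≡0 → contradiction (≡.trans n≡ (≡.cong (ℕ._* d) m≡0)) λ ()
    power-of-Q : ∀ l → q ℕ.^ (l ℕ.* d) ≡ Q ℕ.^ l
    power-of-Q l = ≡.trans (≡.cong (q ℕ.^_) (ℕ.*-comm l d)) (≡.sym (ℕ.^-*-assoc q d l))
    found = subfield-nonRoot Q m (ℕ.<-trans (ℕ.s≤s (ℕ.s≤s ℕ.z≤n)) q<Q) 0<m
      (≡.trans order≡ (≡.trans (≡.cong (q ℕ.^_) n≡) (power-of-Q m))) (^-identity-Monic r) q<Q
    x : Carrier
    x = proj₁ found
    xQ : x ^ Q ≈ x
    xQ = proj₁ (proj₂ found)
    x∉𝔽 : x ^ q - x ≉ 0#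
    x∉𝔽 = proj₂ (proj₂ found)
    q^s≡ : q ℕ.^ s ≡ Q ℕ.^ k
    q^s≡ = ≡.trans (≡.cong (q ℕ.^_) s≡) (power-of-Q k)

  φ-span : ∀ {u w} → φ u V.≈ᴹ w → image K φ (⟨_⟩ K u) ≐ ⟨_⟩ K w
  φ-span {u} φu≈w =
      (λ (v , (h , v≈) , x≈) → h , V.≈ᴹ-trans x≈ (V.≈ᴹ-trans (φ-cong v≈) (V.≈ᴹ-trans (φ-scale h u) (V.*ₗ-congˡ φu≈w))))
    , (λ (h , x≈) → h V.*ₗ u , (h , V.≈ᴹ-refl) , V.≈ᴹ-trans x≈ (V.≈ᴹ-trans (V.*ₗ-congˡ (V.≈ᴹ-sym φu≈w)) (V.≈ᴹ-sym (φ-scale h u))))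

  φ-0 : φ V.0ᴹ V.≈ᴹ V.0ᴹ
  φ-0 = solve 3 (λ p q i → (p :* :0 :- q :* :0) :* i := :0) refl d₁ c₁ (Δ ⁻¹)
      , solve 3 (λ p q i → (p :* :0 :- q :* :0) :* i := :0) refl a b (Δ ⁻¹)

  pseudoregulus : PseudoregulusType K q n f
  pseudoregulus = φ , s , φ-GL , gcd-trivial _ (gcd[m,n]∣m s n) (gcd[m,n]∣n s n) , onto , from
    where
    Pow : Carrier → Carrier
    Pow x = x ^ (q ℕ.^ s)
    image-≐ : ∀ {P Q : Subset K} → P ≐ Q → image K φ P ≐ image K φ Q
    image-≐ (⊆ , ⊇) = (λ (v , Pv , x≈) → v , ⊆ Pv , x≈) , (λ (v , Qv , x≈) → v , ⊇ Qv , x≈)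
    ≐-trans : ∀ {P Q R : Subset K} → P ≐ Q → Q ≐ R → P ≐ R
    ≐-trans (f , f′) (g , g′) = (λ x → g (f x)) , (λ x → f′ (g′ x))
    ≐-sym : ∀ {P Q : Subset K} → P ≐ Q → Q ≐ P
    ≐-sym (f , g) = g , f
    onto : ∀ P → P ∈ L K f → image K φ P ∈ L K Pow
    onto P (x , x≉0 , P≐) = let (g , φ≈) = φ-graph x in
      g , (λ g≈0 → x≉0 (proj₁ (φ-injective (V.≈ᴹ-trans φ≈ (V.≈ᴹ-trans
             (g≈0 , trans (χ-cong σ-character g≈0) σ-0) (V.≈ᴹ-sym φ-0))))))
        , ≐-trans (image-≐ P≐) (φ-span (V.≈ᴹ-trans φ≈ (refl , σ≈power g)))
    from : ∀ Q → Q ∈ L K Pow → ∃[ P ] (P ∈ L K f × Q ≐ image K φ P)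
    from Q (g , g≉0 , Q≐) = let
        (x , eq) = in-U g
        φ≈ = V.≈ᴹ-trans (φ-cong (V.≈ᴹ-trans (V.≈ᴹ-sym eq) (graph-vector g))) (φ-vector g (σ g))
        f-0 = +-cancelˡ (f 0#) _ _ (trans (sym (qPolynomial-+ as 0# 0#))
          (trans (qPolynomial-cong as (+-identityʳ 0#)) (sym (+-identityʳ _))))
      in ⟨_⟩ K (x , f x)
       , (x , (λ x≈0 → g≉0 (trans (sym (proj₁ φ≈)) (proj₁ (V.≈ᴹ-trans
                 (φ-cong (x≈0 , trans (qPolynomial-cong as x≈0) f-0)) φ-0)))) , (λ w → w) , (λ w → w))
       , ≐-trans Q≐ (≐-sym (φ-span (V.≈ᴹ-trans φ≈ (refl , σ≈power g))))

-- The case n = 2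

module QuadraticCase {c ℓ} (K : FiniteField c ℓ) (r : ℕ)
  (^q-+ : FiniteFieldTheory.Additive K (λ x → FiniteField._^_ K x (suc (suc r))))
  (as : Vector (FiniteField.Carrier K) 2)
  (scattered : Scattered K (suc (suc r)) (qPolynomial K (suc (suc r)) as))
  {g₀ : FiniteField.Carrier K} (g₀∉𝔽 : ¬ 𝔽 K (suc (suc r)) g₀) where
  open FieldTheory K
  open FixedSubfield K (suc (suc r)) ^q-+
  open AxisGraph K (qPolynomial K (suc (suc r)) as)
  open import Relation.Binary.Reasoning.Setoid setoid
  private
    q : ℕ
    q = suc (suc r)
    f : Carrier → Carrier
    f = qPolynomial K q as
    a₀ = as 0F
    a₁ = as 1F

  f≈ : ∀ x → f x ≈ x * a₀ + x ^ q * a₁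
  f≈ x = trans (+-congˡ (+-congʳ (*-congˡ (^-congʳ x (ℕ.*-identityʳ q)))))
    (solve 4 (λ a b x y → a :* (x :* :1) :+ (b :* y :+ :0) := x :* a :+ y :* b) refl a₀ a₁ x (x ^ q))

  -- With a₁ = 0 the map f is multiplication by a₀. Then scatteredness makes 1 and g₀ dependent over
  -- 𝔽, against the choice of g₀.
  leading-nonZero : a₁ ≉ 0#
  leading-nonZero a₁≈0 = g₀∉𝔽 (𝔽-resp (sym g₀≈) (𝔽-* (𝔽-minus 𝔽-0 (proj₁ (proj₂ (proj₂ dependent)))) (𝔽-⁻¹ b≉0 b∈𝔽)))
    where
    linear : ∀ x → f x ≈ x * a₀
    linear x = trans (f≈ x) (trans (+-congˡ (trans (*-congˡ a₁≈0) (zeroʳ _))) (+-identityʳ _))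
    dependent = scattered 1# g₀ (trans (+-cong (*-congˡ (linear 1#)) (-‿cong (*-congˡ (linear g₀))))
      (solve 2 (λ g a → g :* (:1 :* a) :- :1 :* (g :* a) := :0) refl g₀ a₀))
    a = proj₁ dependent
    b = proj₁ (proj₂ dependent)
    b∈𝔽 = proj₁ (proj₂ (proj₂ (proj₂ dependent)))
    relation : a * 1# + b * g₀ ≈ 0#
    relation = proj₂ (proj₂ (proj₂ (proj₂ (proj₂ dependent))))
    b≉0 : b ≉ 0#
    b≉0 b≈0 = proj₁ (proj₂ (proj₂ (proj₂ (proj₂ dependent))))
      (trans (solve 2 (λ a g → a := a :* :1 :+ :0 :* g) refl a g₀) (trans (+-congˡ (*-congʳ (sym b≈0))) relation) , b≈0)
    g₀≈ : g₀ ≈ (0# - a) * b ⁻¹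
    g₀≈ = *-cancelˡ b≉0 (begin
      b * g₀                       ≈⟨ solve 2 (λ a t → t := (a :* :1 :+ t) :- a) refl a (b * g₀) ⟩
      (a * 1# + b * g₀) - a        ≈⟨ +-congʳ relation ⟩
      0# - a                       ≈⟨ *-identityʳ _ ⟨
      (0# - a) * 1#                ≈⟨ *-congˡ (⁻¹-inverseʳ b≉0) ⟨
      (0# - a) * (b * b ⁻¹)        ≈⟨ solve 3 (λ p b i → p :* (b :* i) := b :* (p :* i)) refl (0# - a) b (b ⁻¹) ⟩
      b * ((0# - a) * b ⁻¹)        ∎)

  -- (x , f x) = x (1 , a₀) + x ^ q (0 , a₁), so η is the Frobenius map x ↦ x ^ q.
  semilinearGraph : SemilinearGraph
  semilinearGraph = record
    { v₀ = 1# , a₀ ; v₁ = 0# , a₁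
    ; independent = λ g h (e₁ , e₂) →
        let g≈0 = trans (solve 2 (λ g h → g := g :* :1 :+ h :* :0) refl g h) e₁ in
        g≈0 , integralʳ leading-nonZero (trans
          (solve 3 (λ a h b → h :* b := :0 :* a :+ h :* b) refl a₀ h a₁) (trans (+-congʳ (*-congʳ (sym g≈0))) e₂))
    ; η = _^ q
    ; η-cong = ^-congˡ q
    ; η-+ = ^q-+
    ; η-* = λ g h → trans (*-cong (^-distrib-* g h q) 𝔽-1) (*-identityʳ _)
    ; η-1 = λ eq → 1≉0 (trans (sym 𝔽-1) eq)
    ; η-injective = λ {g} {h} eq → injective g h eq (g - h ≟ 0#)
    ; in-U = λ g → g , on-graph g
    ; of-U = λ x → x , sym (proj₁ (on-graph x)) , sym (proj₂ (on-graph x)) }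
    where
    on-graph : ∀ g → g * 1# + g ^ q * 0# ≈ g × g * a₀ + g ^ q * a₁ ≈ f g
    on-graph g = solve 2 (λ g h → g :* :1 :+ h :* :0 := g) refl g (g ^ q) , sym (f≈ g)
    injective : ∀ g h → g ^ q ≈ h ^ q → Dec (g - h ≈ 0#) → g ≈ h
    injective g h eq (yes g-h≈0) = x-y≈0⇒x≈y g h g-h≈0
    injective g h eq (no g-h≉0) = contradiction (trans (^q-minus g h) (x≈y⇒x-y≈0 eq)) (^-nonZero q g-h≉0)

-- The case n > 2: choice of the auxiliary elements

module GeneralCase {c ℓ c′ ℓ′} (K : FiniteField c ℓ) (r m : ℕ)
  (^q-+ : FiniteFieldTheory.Additive K (λ x → FiniteField._^_ K x (suc (suc r))))
  (order≡ : FiniteField.order K ≡ suc (suc r) ℕ.^ suc (suc (suc m)))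
  (3<q : 3 ℕ.< suc (suc r))
  (as : Vector (FiniteField.Carrier K) (suc (suc (suc m))))
  (scattered : Scattered K (suc (suc r)) (qPolynomial K (suc (suc r)) as))
  (S : GeneralizedAndréSystem c′ ℓ′)
  (isomorphism : 𝒜 K (qPolynomial K (suc (suc r)) as) ≅ GeneralizedAndréSystem.plane S) where
  open FiniteFieldTheory K
  open FixedSubfield K (suc (suc r)) ^q-+
  open QPolynomials K r ^q-+ hiding (q)
  private
    q n : ℕ
    q = suc (suc r)
    n = suc (suc (suc m))
    f : Carrier → Carrier
    f = qPolynomial K q as
    1<q : 1 ℕ.< q
    1<q = ℕ.s≤s (ℕ.s≤s ℕ.z≤n)

    module Plane = AndréPlane K q ^q-+ f (qPolynomial-linear as) scattered S isomorphism

  q²<order : q ℕ.* q ℕ.< order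
  q²<order = ≡.subst₂ ℕ._<_ (≡.cong (q ℕ.*_) (ℕ.*-identityʳ q)) (≡.sym order≡)
    (ℕ.^-monoʳ-< q 1<q {2} {n} (ℕ.s≤s (ℕ.s≤s (ℕ.s≤s ℕ.z≤n))))

  q<order : q ℕ.< order
  q<order = ℕ.<-trans (ℕ.m<m*n q q 1<q) q²<order

  5≤order : 5 ℕ.≤ order
  5≤order = ℕ.≤-trans (ℕ.s≤s 3<q) q<order

  private
    first : Fin 2 → Carrier
    first 0F = 0#
    first 1F = 1#

    t-exists : ∃[ t ] (t ^ q ≈ t × ∀ i → t ≉ first i)
    t-exists = subfield-avoid q n 1<q ℕ.z<s order≡ (ℕ.≤-trans (ℕ.s≤s (ℕ.s≤s (ℕ.s≤s ℕ.z≤n))) 3<q) first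
    t = proj₁ t-exists

    second : Fin 3 → Carrier
    second 0F = 0#
    second 1F = 1#
    second 2F = t

    -- Avoiding three values inside 𝔽 is possible exactly because q > 3.
    t′-exists : ∃[ t′ ] (t′ ^ q ≈ t′ × ∀ i → t′ ≉ second i)
    t′-exists = subfield-avoid q n 1<q ℕ.z<s order≡ 3<q second

    g₀-exists : ∃[ g ] g ^ q - g ≉ 0#
    g₀-exists = nonRoot (^-identity-Monic r) q<order

    t′ = proj₁ t′-exists
    g₀ = proj₁ g₀-exists

    g₀∉𝔽 : ¬ 𝔽 K q g₀
    g₀∉𝔽 g₀∈𝔽 = proj₂ g₀-exists (x≈y⇒x-y≈0 g₀∈𝔽)
    t≉t′ : t ≉ t′
    t≉t′ t≈t′ = proj₂ (proj₂ t′-exists) 2F (sym t≈t′)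

    open Plane.Pigeonhole {t} {t′} {g₀} (proj₁ (proj₂ t-exists)) (proj₁ (proj₂ t′-exists))
      (proj₂ (proj₂ t-exists) 0F) (proj₂ (proj₂ t′-exists) 0F)
      (proj₂ (proj₂ t-exists) 1F) (proj₂ (proj₂ t′-exists) 1F)
      t≉t′ g₀∉𝔽 (≡.subst (5 ℕ.≤_) Plane.orders 5≤order)

  properHull : ∀ k → ProperHull k
  properHull k = record
    { W = Hull
    ; subgroup = record { resp = Hull-resp ; minus = Hull-minus }
    ; W? = Hull?
    ; 𝔽⊆W = 𝔽⊆Hull
    ; k𝔽⊆W = k𝔽⊆Hull
    ; outsider = proj₁ (Hull-proper q²<order)
    ; outside = proj₂ (Hull-proper q²<order) }
    where open Hull K r ^q-+ k hiding (q)

  semilinearGraph : AxisGraph.SemilinearGraph K f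
  semilinearGraph = fixed-axes properHull

prime-power-additive : ∀ {c ℓ} (K : FiniteField c ℓ) {q} n → IsPrimePower q →
  FiniteField.order K ≡ q ℕ.^ n → FiniteFieldTheory.Additive K (λ x → FiniteField._^_ K x q)
prime-power-additive K n (p , k , pp , _ , ≡.refl) order≡ =
  ^-additive pp (characteristic p (k ℕ.* n) (≡.trans order≡ (ℕ.^-*-assoc p k n))) k
  where open FiniteFieldTheory K

open import Data.Nat.Base using (_<_; _^_)

theorem5p9 : ∀ {c ℓ c′ ℓ′} (q n : ℕ) → IsPrimePower q → 3 < q → 1 < n →
    (F : FiniteField c ℓ) → FiniteField.order F ≡ q ^ n →
    (as : Vector (FiniteField.Carrier F) n) →
    let f = qPolynomial F q as in
    Scattered F q f →
    ¬ PseudoregulusType F q n f →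
    ¬ IsGeneralizedAndréPlane c′ ℓ′ (𝒜 F f)
theorem5p9 q@(suc (suc r)) n@(suc (suc zero)) pp 3<q 1<n F order≡ as scattered ¬pseudoregulus _ =
  ¬pseudoregulus (PseudoregulusCriterion.pseudoregulus F r 1 ^q-+ order≡ as scattered
    (QuadraticCase.semilinearGraph F r ^q-+ as scattered λ g∈𝔽 → proj₂ outsider (x≈y⇒x-y≈0 g∈𝔽)))
  where
  open FiniteFieldTheory F using (Additive; nonRoot; ^-identity-Monic; x≈y⇒x-y≈0)
  ^q-+ : Additive (λ x → FiniteField._^_ F x q)
  ^q-+ = prime-power-additive F n pp order≡
  q<order : q < FiniteField.order F
  q<order = ≡.subst₂ _<_ (ℕ.*-identityʳ q) (≡.sym order≡) (ℕ.^-monoʳ-< q (ℕ.s≤s (ℕ.s≤s ℕ.z≤n)) {1} {2} (ℕ.s≤s (ℕ.s≤s ℕ.z≤n)))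
  outsider = nonRoot (^-identity-Monic r) q<order
theorem5p9 q@(suc (suc r)) n@(suc (suc (suc m))) pp 3<q 1<n F order≡ as scattered ¬pseudoregulus (S , isomorphism) =
  ¬pseudoregulus (PseudoregulusCriterion.pseudoregulus F r (suc (suc m)) ^q-+ order≡ as scattered
    (GeneralCase.semilinearGraph F r m ^q-+ order≡ 3<q as scattered S isomorphism))
  where
  open FiniteFieldTheory F using (Additive)
  ^q-+ : Additive (λ x → FiniteField._^_ F x q)
  ^q-+ = prime-power-additive F n pp order≡
theorem5p9 zero          _          _ ()
theorem5p9 (suc zero)    _          _ (ℕ.s≤s ())
theorem5p9 (suc (suc _)) zero       _ _ ()
theorem5p9 (suc (suc _)) (suc zero) _ _ (ℕ.s≤s ())
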